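{- For all integers $\nu\geq 0$ and $m\geq 1$, \[ \sum_{k=0}^\infty\frac{\binom{2k}{k}}{4^k(2k+2m)}\cdot\frac{1}{(2k-1)(2k-3)\cdots(2k-2\nu+1)} =(-1)^\nu 2^{2m+\nu-1}\frac{(m-1)!\,(m+\nu)!}{(2m+2\nu)!}, \] and for all integers $\nu\ge0$ and $m\geq 0$, \[ \sum_{k=0}^\infty\frac{\binom{2k}{k}}{4^k(2k+2m+1)}\cdot\frac{1}{(2k-1)(2k-3)\cdots(2k-2\nu+1)} =\frac{(-1)^\nu}{2^{2m+\nu+1}}\cdot\frac{(2m)!\,\pi}{(m+\nu)!\,m!}. \]
   Context: The product $(2k-1)(2k-3)\cdots(2k-2\nu+1)$ has $\nu$ factors $2k-(2j-1)$, $j=1,\dots,\nu$; for $\nu=0$ it is the empty product $1$. -}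

module Defs where

open import Data.Nat as ℕ using (ℕ; zero; suc)
open import Data.Nat.Combinatorics using (_C_)
open import Data.Nat using (_!)
open import Data.Integer as ℤ using (ℤ; +_; -[1+_])
open import Data.Rational as ℚ using (ℚ; 0ℚ; _/_; ∣_∣)
open import Data.Product using (∃; _×_)

-- Division of integers into ℚ; total, with the convention n ÷ 0 = 0
-- (only ever applied to nonzero denominators below).
_÷_ : ℤ → ℤ → ℚ
n ÷ (+ zero)   = 0ℚ
n ÷ (+ suc d)  = n / suc d
n ÷ -[1+ d ]   = (ℤ.- n) / suc d

-- (2k-1)(2k-3)...(2k-2ν+1) as an integer (ν factors; empty product = 1)
oddProd : ℕ → ℕ → ℤ
oddProd zero    k = + 1
oddProd (suc ν) k = oddProd ν k ℤ.* ((+ (2 ℕ.* k ℕ.+ 1)) ℤ.- (+ (2 ℕ.* suc ν)))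

sgn : ℕ → ℤ
sgn zero    = + 1
sgn (suc ν) = ℤ.- sgn ν

partialSum : (ℕ → ℚ) → ℕ → ℚ
partialSum f zero    = 0ℚ
partialSum f (suc n) = partialSum f n ℚ.+ f n

ConvergesTo : (ℕ → ℚ) → ℚ → Set
ConvergesTo a L = ∀ (ε : ℚ) → ε ℚ.> 0ℚ → ∃ λ N → ∀ n → N ℕ.≤ n → ∣ a n ℚ.- L ∣ ℚ.< ε

SameLimit : (ℕ → ℚ) → (ℕ → ℚ) → Set
SameLimit a b = ∀ (ε : ℚ) → ε ℚ.> 0ℚ → ∃ λ N → ∀ n → N ℕ.≤ n → ∣ a n ℚ.- b n ∣ ℚ.< ε

term₁ : ℕ → ℕ → ℕ → ℚ
term₁ ν m k = (+ ((2 ℕ.* k) C k)) ÷ ((+ (4 ℕ.^ k ℕ.* (2 ℕ.* k ℕ.+ 2 ℕ.* m))) ℤ.* oddProd ν k)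

term₂ : ℕ → ℕ → ℕ → ℚ
term₂ ν m k = (+ ((2 ℕ.* k) C k)) ÷ ((+ (4 ℕ.^ k ℕ.* (2 ℕ.* k ℕ.+ 2 ℕ.* m ℕ.+ 1))) ℤ.* oddProd ν k)

rhs₁ : ℕ → ℕ → ℚ
rhs₁ ν m = (sgn ν ℤ.* + (2 ℕ.^ (2 ℕ.* m ℕ.+ ν ℕ.∸ 1) ℕ.* (m ℕ.∸ 1) ! ℕ.* (m ℕ.+ ν) !))
           ÷ (+ ((2 ℕ.* m ℕ.+ 2 ℕ.* ν) !))

-- rational coefficient of π in the second identity:
-- (-1)^ν (2m)! / (2^{2m+ν+1} (m+ν)! m!)
coef₂ : ℕ → ℕ → ℚ
coef₂ ν m = (sgn ν ℤ.* + ((2 ℕ.* m) !))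
            ÷ (+ (2 ℕ.^ (2 ℕ.* m ℕ.+ ν ℕ.+ 1) ℕ.* (m ℕ.+ ν) ! ℕ.* m !))

-- π as the sum of the Leibniz series: π = Σ_k 4 (-1)^k / (2k+1)
leibnizTerm : ℕ → ℚ
leibnizTerm k = (+ 4 ℤ.* sgn k) ÷ (+ (2 ℕ.* k ℕ.+ 1))

cπPartial : ℚ → ℕ → ℚ
cπPartial c n = c ℚ.* partialSum leibnizTerm n

{-# OPTIONS --safe #-}
-- Write c k = C(2k,k)/4^k and P ν k = (2k−1)(2k−3)⋯(2k−2ν+1). Partial fractions give
--   (a+2ν+1) c k / ((2k+a) P (ν+1) k) = c k / P (ν+1) k − c k / ((2k+a) P ν k),
-- and Σ_k c k / P (ν+1) k telescopes to a null sequence because c k → 0 (c k² ≤ 1/(k+1)).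
-- The right-hand sides obey the same recursion in ν, so only ν = 0 remains. There the telescoping
-- recurrence (a+1) T (a+1) − (a+2) T (a+3) → 0 for T a = Σ_k c k/(2k+a) yields
-- Σ_k c k/(2k+2j+2) = (2j)!!/(2j+1)!! and Σ_k c k/(2k+2m+1) = c m · Σ_k c k/(2k+1).
-- Finally Σ_k c k/(2k+1) = π/2 = 2 · Σ_i (−1)^i/(2i+1): averaging its partial sums with binomial
-- weights gives, by the identity Σ_k C(N,2k) c k = 2^N c N (a WZ pair), the Euler transform
-- Σ_j 2^{−j} (2j)!!/(2j+1)!! of the Leibniz series, and both averaging errors are null.

module Submission where

open import Defs
open import Data.Nat using (ℕ; _≥_)
open import Data.Product using (_×_)

open import Data.Nat as ℕ using (zero; suc; z≤n; s≤s; _^_; _∸_; _⊔_; _!)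
import Data.Nat.Properties as ℕP
open import Data.Nat.Combinatorics using (_C_; nCk+nC[k+1]≡[n+1]C[k+1]; nCk≡nC[n∸k]; k>n⇒nCk≡0; nC1≡n)
open import Data.Nat.Tactic.RingSolver using (solve-∀)
open import Data.Integer as ℤ using (ℤ; +_; -[1+_]; +[1+_])
import Data.Integer.Properties as ℤP
open import Data.Rational as ℚ using (ℚ; mkℚ; 0ℚ; 1ℚ; ½; _+_; _*_; _-_; -_; _/_; _≤_; _<_; ∣_∣)
import Data.Rational.Properties as ℚP
import Data.Rational.Unnormalised as ℚᵘ
import Data.Rational.Unnormalised.Properties as ℚᵘP
open import Data.Rational.Solver using (module +-*-Solver)
open +-*-Solver using (solve; _:+_; _:-_; _:*_; :-_; _:=_; con)
open import Data.Product using (∃; _,_; proj₁; proj₂)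
open import Data.Sum using (inj₁; inj₂)
open import Data.Empty using (⊥-elim)
open import Relation.Nullary using (yes; no)
open import Relation.Binary.PropositionalEquality

-- Naturals and integers inside ℚ

-- Abstract, so that unification and the ring solver treat these values as atoms
-- instead of unfolding the normalising division of ℚ.
abstract
  fromℤ : ℤ → ℚ
  fromℤ z = z / 1

  fromℕ : ℕ → ℚ
  fromℕ n = + n / 1

  -- 1/ℕ 0 = 0 is a junk value; every use below has a nonzero argument.
  1/ℕ : ℕ → ℚ
  1/ℕ zero    = 0ℚ
  1/ℕ (suc n) = + 1 / suc n

  fromℕ≡fromℤ : ∀ n → fromℕ n ≡ fromℤ (+ n)
  fromℕ≡fromℤ n = refl

  fromℕ-0 : fromℕ 0 ≡ 0ℚ
  fromℕ-0 = refl

  fromℕ-1 : fromℕ 1 ≡ 1ℚ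
  fromℕ-1 = refl

  1/ℕ-0 : 1/ℕ 0 ≡ 0ℚ
  1/ℕ-0 = refl

  private
    fromℤ-toℚᵘ : ∀ z → ℚ.toℚᵘ (fromℤ z) ℚᵘ.≃ ℚᵘ.mkℚᵘ z 0
    fromℤ-toℚᵘ z = ℚP.toℚᵘ-fromℚᵘ (ℚᵘ.mkℚᵘ z 0)

  fromℤ-+ : ∀ a b → fromℤ (a ℤ.+ b) ≡ fromℤ a + fromℤ b
  fromℤ-+ a b = ℚP.toℚᵘ-injective (ℚᵘP.≃-trans (fromℤ-toℚᵘ (a ℤ.+ b))
    (ℚᵘP.≃-trans (ℚᵘ.*≡* eq) (ℚᵘP.≃-sym (ℚᵘP.≃-trans (ℚP.toℚᵘ-homo-+ (fromℤ a) (fromℤ b))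
      (ℚᵘP.+-cong (fromℤ-toℚᵘ a) (fromℤ-toℚᵘ b))))))
    where
    eq : (a ℤ.+ b) ℤ.* + 1 ≡ (a ℤ.* + 1 ℤ.+ b ℤ.* + 1) ℤ.* + 1
    eq = trans (ℤP.*-identityʳ _)
      (sym (trans (ℤP.*-identityʳ _) (cong₂ ℤ._+_ (ℤP.*-identityʳ a) (ℤP.*-identityʳ b))))

  fromℤ-* : ∀ a b → fromℤ (a ℤ.* b) ≡ fromℤ a * fromℤ b
  fromℤ-* a b = ℚP.toℚᵘ-injective (ℚᵘP.≃-trans (fromℤ-toℚᵘ (a ℤ.* b))
    (ℚᵘP.≃-trans (ℚᵘ.*≡* refl) (ℚᵘP.≃-sym (ℚᵘP.≃-trans (ℚP.toℚᵘ-homo-* (fromℤ a) (fromℤ b))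
      (ℚᵘP.*-cong (fromℤ-toℚᵘ a) (fromℤ-toℚᵘ b))))))

  fromℤ-neg : ∀ a → fromℤ (ℤ.- a) ≡ - fromℤ a
  fromℤ-neg a = ℚP.toℚᵘ-injective (ℚᵘP.≃-trans (fromℤ-toℚᵘ (ℤ.- a))
    (ℚᵘP.≃-sym (ℚᵘP.≃-trans (ℚP.toℚᵘ-homo‿- (fromℤ a)) (ℚᵘP.-‿cong (fromℤ-toℚᵘ a)))))

  /≡fromℤ*1/ℕ : ∀ z d → z / suc d ≡ fromℤ z * 1/ℕ (suc d)
  /≡fromℤ*1/ℕ z d = ℚP.toℚᵘ-injective (ℚᵘP.≃-trans (ℚP.toℚᵘ-fromℚᵘ (ℚᵘ.mkℚᵘ z d))
    (ℚᵘP.≃-trans (ℚᵘ.*≡* eq) (ℚᵘP.≃-sym (ℚᵘP.≃-trans (ℚP.toℚᵘ-homo-* (fromℤ z) (1/ℕ (suc d)))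
      (ℚᵘP.*-cong (fromℤ-toℚᵘ z) (ℚP.toℚᵘ-fromℚᵘ (ℚᵘ.mkℚᵘ (+ 1) d)))))))
    where
    eq : z ℤ.* + (1 ℕ.* suc d) ≡ (z ℤ.* + 1) ℤ.* + suc d
    eq = cong₂ ℤ._*_ (sym (ℤP.*-identityʳ z)) (cong +_ (ℕP.*-identityˡ (suc d)))

  fromℕ*1/ℕ-suc : ∀ n → fromℕ (suc n) * 1/ℕ (suc n) ≡ 1ℚ
  fromℕ*1/ℕ-suc n = trans (sym (/≡fromℤ*1/ℕ (+ suc n) n))
    (ℚP.toℚᵘ-injective (ℚᵘP.≃-trans (ℚP.toℚᵘ-fromℚᵘ (ℚᵘ.mkℚᵘ (+ suc n) n))
      (ℚᵘ.*≡* (ℤP.*-comm (+ suc n) (+ 1)))))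

  0≤fromℕ : ∀ n → 0ℚ ≤ fromℕ n
  0≤fromℕ n = ℚP.nonNegative⁻¹ _ {{ℚP.normalize-nonNeg n 1}}

  0<fromℕ-suc : ∀ n → 0ℚ < fromℕ (suc n)
  0<fromℕ-suc n = ℚP.positive⁻¹ _ {{ℚP.normalize-pos (suc n) 1}}

  0<1/ℕ-suc : ∀ n → 0ℚ < 1/ℕ (suc n)
  0<1/ℕ-suc n = ℚP.positive⁻¹ _ {{ℚP.normalize-pos 1 (suc n)}}

  0≤1/ℕ : ∀ n → 0ℚ ≤ 1/ℕ n
  0≤1/ℕ zero    = ℚP.≤-refl
  0≤1/ℕ (suc n) = ℚP.<⇒≤ (0<1/ℕ-suc n)

  1/ℕ-antitone : ∀ {m n} → m ℕ.≤ n → 1/ℕ (suc n) ≤ 1/ℕ (suc m)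
  1/ℕ-antitone {m} {n} m≤n = ℚP.toℚᵘ-cancel-≤
    (ℚᵘP.≤-respˡ-≃ (ℚᵘP.≃-sym (ℚP.toℚᵘ-fromℚᵘ (ℚᵘ.mkℚᵘ (+ 1) n)))
      (ℚᵘP.≤-respʳ-≃ (ℚᵘP.≃-sym (ℚP.toℚᵘ-fromℚᵘ (ℚᵘ.mkℚᵘ (+ 1) m)))
        (ℚᵘ.*≤* (ℤP.*-monoˡ-≤-nonNeg (+ 1) (ℤ.+≤+ (s≤s m≤n))))))

  fromℕ-mono-≤ : ∀ {m n} → m ℕ.≤ n → fromℕ m ≤ fromℕ n
  fromℕ-mono-≤ {m} {n} m≤n = ℚP.toℚᵘ-cancel-≤
    (ℚᵘP.≤-respˡ-≃ (ℚᵘP.≃-sym (fromℤ-toℚᵘ (+ m)))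
      (ℚᵘP.≤-respʳ-≃ (ℚᵘP.≃-sym (fromℤ-toℚᵘ (+ n)))
        (ℚᵘ.*≤* (ℤP.*-monoʳ-≤-nonNeg (+ 1) (ℤ.+≤+ m≤n)))))

  ∣p∣≤fromℕ∣↥p∣ : ∀ p → ∣ p ∣ ≤ fromℕ ℤ.∣ ℚ.↥ p ∣
  ∣p∣≤fromℕ∣↥p∣ (mkℚ n d _) = ℚP.toℚᵘ-cancel-≤
    (ℚᵘP.≤-respʳ-≃ (ℚᵘP.≃-sym (fromℤ-toℚᵘ (+ ℤ.∣ n ∣)))
      (ℚᵘ.*≤* (ℤP.*-monoˡ-≤-nonNeg (+ ℤ.∣ n ∣) (ℤ.+≤+ (s≤s z≤n)))))

  1/ℕ-archimedean : ∀ ε → 0ℚ < ε → ∃ λ N → 1/ℕ (suc N) < ε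
  1/ℕ-archimedean (mkℚ +[1+ p ] d _) _ = suc d , ℚP.toℚᵘ-cancel-<
    (ℚᵘP.<-respˡ-≃ (ℚᵘP.≃-sym (ℚP.toℚᵘ-fromℚᵘ (ℚᵘ.mkℚᵘ (+ 1) (suc d))))
      (ℚᵘ.*<* (subst₂ ℤ._<_ (sym (ℤP.*-identityˡ (+ suc d))) (ℤP.pos-* (suc p) (suc (suc d)))
        (ℤ.+<+ (ℕP.<-≤-trans (ℕP.n<1+n (suc d)) (ℕP.m≤n*m (suc (suc d)) (suc p)))))))
  1/ℕ-archimedean (mkℚ (+ zero) d _) (ℚ.*<* (ℤ.+<+ ()))
  1/ℕ-archimedean (mkℚ -[1+ n ] d _) (ℚ.*<* ())

fromℕ-+ : ∀ m n → fromℕ (m ℕ.+ n) ≡ fromℕ m + fromℕ n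
fromℕ-+ m n = begin
  fromℕ (m ℕ.+ n)           ≡⟨ fromℕ≡fromℤ (m ℕ.+ n) ⟩
  fromℤ (+ (m ℕ.+ n))       ≡⟨ cong fromℤ (ℤP.pos-+ m n) ⟩
  fromℤ (+ m ℤ.+ + n)       ≡⟨ fromℤ-+ (+ m) (+ n) ⟩
  fromℤ (+ m) + fromℤ (+ n) ≡⟨ sym (cong₂ _+_ (fromℕ≡fromℤ m) (fromℕ≡fromℤ n)) ⟩
  fromℕ m + fromℕ n         ∎
  where open ≡-Reasoning

fromℕ-* : ∀ m n → fromℕ (m ℕ.* n) ≡ fromℕ m * fromℕ n
fromℕ-* m n = begin
  fromℕ (m ℕ.* n)           ≡⟨ fromℕ≡fromℤ (m ℕ.* n) ⟩
  fromℤ (+ (m ℕ.* n))       ≡⟨ cong fromℤ (ℤP.pos-* m n) ⟩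
  fromℤ (+ m ℤ.* + n)       ≡⟨ fromℤ-* (+ m) (+ n) ⟩
  fromℤ (+ m) * fromℤ (+ n) ≡⟨ sym (cong₂ _*_ (fromℕ≡fromℤ m) (fromℕ≡fromℤ n)) ⟩
  fromℕ m * fromℕ n         ∎
  where open ≡-Reasoning

fromℕ-suc : ∀ n → fromℕ (suc n) ≡ fromℕ n + 1ℚ
fromℕ-suc n = trans (cong fromℕ (ℕP.+-comm 1 n)) (trans (fromℕ-+ n 1) (cong (λ t → fromℕ n + t) fromℕ-1))

fromℕ-2≡1+1 : fromℕ 2 ≡ 1ℚ + 1ℚ
fromℕ-2≡1+1 = trans (fromℕ-suc 1) (cong (_+ 1ℚ) fromℕ-1)

fromℕ-2*½ : fromℕ 2 * ½ ≡ 1ℚ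
fromℕ-2*½ = cong (_* ½) fromℕ-2≡1+1

2*[1+n]≡2+2*n : ∀ n → 2 ℕ.* suc n ≡ suc (suc (2 ℕ.* n))
2*[1+n]≡2+2*n n = cong suc (ℕP.+-suc n (n ℕ.+ 0))

inverse-unique : ∀ {x y z : ℚ} → x * y ≡ 1ℚ → x * z ≡ 1ℚ → y ≡ z
inverse-unique {x} {y} {z} xy≡1 xz≡1 = begin
  y           ≡⟨ sym (ℚP.*-identityʳ y) ⟩
  y * 1ℚ      ≡⟨ cong (y *_) (sym xz≡1) ⟩
  y * (x * z) ≡⟨ solve 3 (λ x y z → y :* (x :* z) := (x :* y) :* z) refl x y z ⟩
  (x * y) * z ≡⟨ cong (_* z) xy≡1 ⟩
  1ℚ * z      ≡⟨ ℚP.*-identityˡ z ⟩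
  z           ∎
  where open ≡-Reasoning

*-solveˡ : ∀ {y r : ℚ} (x x⁻¹ : ℚ) → x⁻¹ * x ≡ 1ℚ → x * y ≡ r → y ≡ x⁻¹ * r
*-solveˡ {y} {r} x x⁻¹ x⁻¹x≡1 xy≡r = begin
  y            ≡⟨ sym (ℚP.*-identityˡ y) ⟩
  1ℚ * y       ≡⟨ cong (_* y) (sym x⁻¹x≡1) ⟩
  x⁻¹ * x * y  ≡⟨ ℚP.*-assoc x⁻¹ x y ⟩
  x⁻¹ * (x * y) ≡⟨ cong (x⁻¹ *_) xy≡r ⟩
  x⁻¹ * r      ∎
  where open ≡-Reasoning

fromℕ*1/ℕ : ∀ n → 0 ℕ.< n → fromℕ n * 1/ℕ n ≡ 1ℚ
fromℕ*1/ℕ (suc n) _ = fromℕ*1/ℕ-suc n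

1/ℕ*fromℕ-suc : ∀ n → 1/ℕ (suc n) * fromℕ (suc n) ≡ 1ℚ
1/ℕ*fromℕ-suc n = trans (ℚP.*-comm (1/ℕ (suc n)) (fromℕ (suc n))) (fromℕ*1/ℕ-suc n)

*-cancelʳ-fromℕ-suc : ∀ {x y : ℚ} n → x * fromℕ (suc n) ≡ y * fromℕ (suc n) → x ≡ y
*-cancelʳ-fromℕ-suc {x} {y} n eq = begin
  x                                 ≡⟨ sym (ℚP.*-identityʳ x) ⟩
  x * 1ℚ                            ≡⟨ cong (x *_) (sym (fromℕ*1/ℕ-suc n)) ⟩
  x * (fromℕ (suc n) * 1/ℕ (suc n)) ≡⟨ sym (ℚP.*-assoc x _ _) ⟩
  x * fromℕ (suc n) * 1/ℕ (suc n)   ≡⟨ cong (_* 1/ℕ (suc n)) eq ⟩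
  y * fromℕ (suc n) * 1/ℕ (suc n)   ≡⟨ ℚP.*-assoc y _ _ ⟩
  y * (fromℕ (suc n) * 1/ℕ (suc n)) ≡⟨ cong (y *_) (fromℕ*1/ℕ-suc n) ⟩
  y * 1ℚ                            ≡⟨ ℚP.*-identityʳ y ⟩
  y                                 ∎
  where open ≡-Reasoning

1/ℕ-* : ∀ m n → 0 ℕ.< m → 0 ℕ.< n → 1/ℕ (m ℕ.* n) ≡ 1/ℕ m * 1/ℕ n
1/ℕ-* m@(suc _) n@(suc _) 0<m 0<n = inverse-unique {x = fromℕ (m ℕ.* n)} (fromℕ*1/ℕ (m ℕ.* n) (s≤s z≤n)) (begin
  fromℕ (m ℕ.* n) * (1/ℕ m * 1/ℕ n)         ≡⟨ cong (_* (1/ℕ m * 1/ℕ n)) (fromℕ-* m n) ⟩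
  fromℕ m * fromℕ n * (1/ℕ m * 1/ℕ n)       ≡⟨ solve 4 (λ a b c d → a :* b :* (c :* d) := (a :* c) :* (b :* d))
                                                 refl (fromℕ m) (fromℕ n) (1/ℕ m) (1/ℕ n) ⟩
  (fromℕ m * 1/ℕ m) * (fromℕ n * 1/ℕ n)     ≡⟨ cong₂ _*_ (fromℕ*1/ℕ m 0<m) (fromℕ*1/ℕ n 0<n) ⟩
  1ℚ                                        ∎)
  where open ≡-Reasoning

2*1/ℕ[2+2n] : ∀ n → fromℕ 2 * 1/ℕ (suc (suc (2 ℕ.* n))) ≡ 1/ℕ (suc n)
2*1/ℕ[2+2n] n = inverse-unique {x = fromℕ (suc n)} (begin
  fromℕ (suc n) * (fromℕ 2 * 1/ℕ 2+2n) ≡⟨ sym (ℚP.*-assoc (fromℕ (suc n)) (fromℕ 2) _) ⟩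
  fromℕ (suc n) * fromℕ 2 * 1/ℕ 2+2n   ≡⟨ cong (_* 1/ℕ 2+2n) (sym (fromℕ-* (suc n) 2)) ⟩
  fromℕ (suc n ℕ.* 2) * 1/ℕ 2+2n       ≡⟨ cong (λ m → fromℕ m * 1/ℕ 2+2n) 2+2n≡[1+n]*2 ⟩
  fromℕ 2+2n * 1/ℕ 2+2n                ≡⟨ fromℕ*1/ℕ-suc (suc (2 ℕ.* n)) ⟩
  1ℚ                                   ∎) (fromℕ*1/ℕ-suc n)
  where
  open ≡-Reasoning
  2+2n = suc (suc (2 ℕ.* n))
  2+2n≡[1+n]*2 : suc n ℕ.* 2 ≡ 2+2n
  2+2n≡[1+n]*2 = trans (ℕP.*-comm (suc n) 2) (2*[1+n]≡2+2*n n)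

1/ℕ[2+2n]≡½*1/ℕ[1+n] : ∀ n → 1/ℕ (suc (suc (2 ℕ.* n))) ≡ ½ * 1/ℕ (suc n)
1/ℕ[2+2n]≡½*1/ℕ[1+n] n = begin
  1/ℕ 2+2n                   ≡⟨ sym (trans (cong (_* 1/ℕ 2+2n) (trans (ℚP.*-comm ½ (fromℕ 2)) fromℕ-2*½))
                                       (ℚP.*-identityˡ _)) ⟩
  ½ * fromℕ 2 * 1/ℕ 2+2n     ≡⟨ ℚP.*-assoc ½ (fromℕ 2) _ ⟩
  ½ * (fromℕ 2 * 1/ℕ 2+2n)   ≡⟨ cong (½ *_) (2*1/ℕ[2+2n] n) ⟩
  ½ * 1/ℕ (suc n)            ∎
  where
  open ≡-Reasoning
  2+2n = suc (suc (2 ℕ.* n))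

1/ℕ-1 : 1/ℕ 1 ≡ 1ℚ
1/ℕ-1 = trans (sym (ℚP.*-identityˡ (1/ℕ 1))) (trans (cong (_* 1/ℕ 1) (sym fromℕ-1)) (fromℕ*1/ℕ-suc 0))

1/ℕ≤1 : ∀ n → 1/ℕ n ≤ 1ℚ
1/ℕ≤1 zero    = subst (_≤ 1ℚ) (sym 1/ℕ-0) (ℚP.<⇒≤ (ℚP.positive⁻¹ 1ℚ))
1/ℕ≤1 (suc n) = ℚP.≤-trans (1/ℕ-antitone {0} {n} z≤n) (ℚP.≤-reflexive 1/ℕ-1)

fraction-cong : ∀ a b a′ b′ → 0 ℕ.< b → 0 ℕ.< b′ → a ℕ.* b′ ≡ a′ ℕ.* b →
                fromℕ a * 1/ℕ b ≡ fromℕ a′ * 1/ℕ b′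
fraction-cong a b a′ b′ 0<b 0<b′ ab′≡a′b = begin
  fromℕ a * 1/ℕ b                          ≡⟨ sym (trans (cong (fromℕ a * 1/ℕ b *_) (fromℕ*1/ℕ b′ 0<b′)) (ℚP.*-identityʳ _)) ⟩
  fromℕ a * 1/ℕ b * (fromℕ b′ * 1/ℕ b′)    ≡⟨ solve 4 (λ a i b j → a :* i :* (b :* j) := (a :* b) :* i :* j)
                                                refl (fromℕ a) (1/ℕ b) (fromℕ b′) (1/ℕ b′) ⟩
  fromℕ a * fromℕ b′ * 1/ℕ b * 1/ℕ b′      ≡⟨ cong (λ t → t * 1/ℕ b * 1/ℕ b′)
                                                (trans (sym (fromℕ-* a b′)) (trans (cong fromℕ ab′≡a′b) (fromℕ-* a′ b))) ⟩
  fromℕ a′ * fromℕ b * 1/ℕ b * 1/ℕ b′      ≡⟨ solve 4 (λ a b i j → a :* b :* i :* j := a :* j :* (b :* i))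
                                                refl (fromℕ a′) (fromℕ b) (1/ℕ b) (1/ℕ b′) ⟩
  fromℕ a′ * 1/ℕ b′ * (fromℕ b * 1/ℕ b)    ≡⟨ trans (cong (fromℕ a′ * 1/ℕ b′ *_) (fromℕ*1/ℕ b 0<b)) (ℚP.*-identityʳ _) ⟩
  fromℕ a′ * 1/ℕ b′                        ∎
  where open ≡-Reasoning

-- Order and finite sums

*-nonneg : ∀ {p q} → 0ℚ ≤ p → 0ℚ ≤ q → 0ℚ ≤ p * q
*-nonneg {p} {q} 0≤p 0≤q =
  ℚP.nonNegative⁻¹ _ {{ℚP.nonNeg*nonNeg⇒nonNeg p {{ℚ.nonNegative 0≤p}} q {{ℚ.nonNegative 0≤q}}}}

*-monoˡ-≤-nonneg : ∀ {p a b} → 0ℚ ≤ p → a ≤ b → p * a ≤ p * b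
*-monoˡ-≤-nonneg {p} 0≤p = ℚP.*-monoˡ-≤-nonNeg p {{ℚ.nonNegative 0≤p}}

*-monoʳ-≤-nonneg : ∀ {p a b} → 0ℚ ≤ p → a ≤ b → a * p ≤ b * p
*-monoʳ-≤-nonneg {p} 0≤p = ℚP.*-monoʳ-≤-nonNeg p {{ℚ.nonNegative 0≤p}}

*-mono-≤-nonneg : ∀ {a b c d} → 0ℚ ≤ b → 0ℚ ≤ c → a ≤ b → c ≤ d → a * c ≤ b * d
*-mono-≤-nonneg 0≤b 0≤c a≤b c≤d = ℚP.≤-trans (*-monoʳ-≤-nonneg 0≤c a≤b) (*-monoˡ-≤-nonneg 0≤b c≤d)

p*q≤p : ∀ {p q} → 0ℚ ≤ p → q ≤ 1ℚ → p * q ≤ p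
p*q≤p {p} 0≤p q≤1 = subst (p * _ ≤_) (ℚP.*-identityʳ p) (*-monoˡ-≤-nonneg 0≤p q≤1)

p≤∣p∣ : ∀ p → p ≤ ∣ p ∣
p≤∣p∣ p with ℚP.≤-total 0ℚ p
... | inj₁ 0≤p = ℚP.≤-reflexive (sym (ℚP.0≤p⇒∣p∣≡p 0≤p))
... | inj₂ p≤0 = ℚP.≤-trans p≤0 (ℚP.0≤∣p∣ p)

0<p*½ : ∀ {p} → 0ℚ < p → 0ℚ < p * ½
0<p*½ {p} 0<p = subst (_< p * ½) (ℚP.*-zeroˡ ½) (ℚP.*-monoˡ-<-pos ½ 0<p)

p*½+p*½≡p : ∀ p → p * ½ + p * ½ ≡ p
p*½+p*½≡p = solve 1 (λ p → p :* con ½ :+ p :* con ½ := p) refl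

0≤½ : 0ℚ ≤ ½
0≤½ = ℚP.<⇒≤ (ℚP.positive⁻¹ ½)

0≤1 : 0ℚ ≤ 1ℚ
0≤1 = ℚP.<⇒≤ (ℚP.positive⁻¹ 1ℚ)

∑ : (ℕ → ℚ) → ℕ → ℚ
∑ = partialSum

∑-cong-< : ∀ {f g : ℕ → ℚ} n → (∀ k → k ℕ.< n → f k ≡ g k) → ∑ f n ≡ ∑ g n
∑-cong-< zero    f≡g = refl
∑-cong-< (suc n) f≡g = cong₂ _+_ (∑-cong-< n (λ k k<n → f≡g k (ℕP.m<n⇒m<1+n k<n))) (f≡g n ℕP.≤-refl)

∑-cong : ∀ {f g : ℕ → ℚ} → (∀ k → f k ≡ g k) → ∀ n → ∑ f n ≡ ∑ g n
∑-cong f≡g n = ∑-cong-< n (λ k _ → f≡g k)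

∑-+ : ∀ (f g : ℕ → ℚ) n → ∑ (λ k → f k + g k) n ≡ ∑ f n + ∑ g n
∑-+ f g zero    = refl
∑-+ f g (suc n) rewrite ∑-+ f g n =
  solve 4 (λ a b c d → (a :+ b) :+ (c :+ d) := (a :+ c) :+ (b :+ d)) refl (∑ f n) (∑ g n) (f n) (g n)

∑-*ˡ : ∀ (q : ℚ) (f : ℕ → ℚ) n → ∑ (λ k → q * f k) n ≡ q * ∑ f n
∑-*ˡ q f zero    = sym (ℚP.*-zeroʳ q)
∑-*ˡ q f (suc n) rewrite ∑-*ˡ q f n = sym (ℚP.*-distribˡ-+ q (∑ f n) (f n))

∑-neg : ∀ (f : ℕ → ℚ) n → ∑ (λ k → - f k) n ≡ - ∑ f n
∑-neg f zero    = refl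
∑-neg f (suc n) rewrite ∑-neg f n = sym (ℚP.neg-distrib-+ (∑ f n) (f n))

∑-sub : ∀ (f g : ℕ → ℚ) n → ∑ (λ k → f k - g k) n ≡ ∑ f n - ∑ g n
∑-sub f g n = trans (∑-+ f (λ k → - g k) n) (cong (λ t → ∑ f n + t) (∑-neg g n))

∑-zero : ∀ n → ∑ (λ _ → 0ℚ) n ≡ 0ℚ
∑-zero zero    = refl
∑-zero (suc n) rewrite ∑-zero n = refl

∑-telescope : ∀ (F : ℕ → ℚ) n → ∑ (λ k → F (suc k) - F k) n ≡ F n - F 0
∑-telescope F zero    = sym (ℚP.+-inverseʳ (F 0))
∑-telescope F (suc n) rewrite ∑-telescope F n =
  solve 3 (λ a b c → (a :- b) :+ (c :- a) := c :- b) refl (F n) (F 0) (F (suc n))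

∑-telescope-0 : ∀ (F : ℕ → ℚ) → F 0 ≡ 0ℚ → ∀ n → ∑ (λ k → F (suc k) - F k) n ≡ F n
∑-telescope-0 F F0≡0 n = trans (∑-telescope F n) (trans (cong (λ t → F n - t) F0≡0) (ℚP.+-identityʳ (F n)))

∑-suc : ∀ (f : ℕ → ℚ) n → ∑ f (suc n) ≡ f 0 + ∑ (λ k → f (suc k)) n
∑-suc f zero    = ℚP.+-comm 0ℚ (f 0)
∑-suc f (suc n) rewrite ∑-suc f n = ℚP.+-assoc (f 0) (∑ (λ k → f (suc k)) n) (f (suc n))

∑-+-split : ∀ (f : ℕ → ℚ) m n → ∑ f (m ℕ.+ n) ≡ ∑ f m + ∑ (λ k → f (m ℕ.+ k)) n
∑-+-split f m zero rewrite ℕP.+-identityʳ m = sym (ℚP.+-identityʳ (∑ f m))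
∑-+-split f m (suc n) rewrite ℕP.+-suc m n | ∑-+-split f m n =
  ℚP.+-assoc (∑ f m) (∑ (λ k → f (m ℕ.+ k)) n) (f (m ℕ.+ n))

∑-reverse : ∀ (f : ℕ → ℚ) n → ∑ f (suc n) ≡ ∑ (λ j → f (n ∸ j)) (suc n)
∑-reverse f zero    = refl
∑-reverse f (suc n) = begin
  ∑ f (suc n) + f (suc n)                          ≡⟨ cong (_+ f (suc n)) (∑-reverse f n) ⟩
  ∑ (λ j → f (n ∸ j)) (suc n) + f (suc n)          ≡⟨ ℚP.+-comm _ (f (suc n)) ⟩
  f (suc n) + ∑ (λ j → f (n ∸ j)) (suc n)          ≡⟨ sym (∑-suc (λ j → f (suc n ∸ j)) (suc n)) ⟩
  ∑ (λ j → f (suc n ∸ j)) (suc (suc n))            ∎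
  where open ≡-Reasoning

∑-comm : ∀ (G : ℕ → ℕ → ℚ) M N → ∑ (λ n → ∑ (λ k → G k n) M) N ≡ ∑ (λ k → ∑ (G k) N) M
∑-comm G M zero    = sym (∑-zero M)
∑-comm G M (suc N) rewrite ∑-comm G M N = sym (∑-+ (λ k → ∑ (G k) N) (λ k → G k N) M)

∑-antidiagonal : ∀ (H : ℕ → ℕ → ℚ) N →
                 ∑ (λ n → ∑ (λ j → H j (n ∸ j)) (suc n)) N ≡ ∑ (λ j → ∑ (H j) (N ∸ j)) N
∑-antidiagonal H zero    = refl
∑-antidiagonal H (suc N) = begin
  ∑ (λ n → ∑ (λ j → H j (n ∸ j)) (suc n)) N + ∑ diagonal (suc N)
    ≡⟨ cong (_+ ∑ diagonal (suc N)) (∑-antidiagonal H N) ⟩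
  ∑ (λ j → ∑ (H j) (N ∸ j)) N + ∑ diagonal (suc N)
    ≡⟨ cong (_+ ∑ diagonal (suc N)) (sym last-row-empty) ⟩
  ∑ (λ j → ∑ (H j) (N ∸ j)) (suc N) + ∑ diagonal (suc N)
    ≡⟨ sym (∑-+ (λ j → ∑ (H j) (N ∸ j)) diagonal (suc N)) ⟩
  ∑ (λ j → ∑ (H j) (N ∸ j) + H j (N ∸ j)) (suc N)
    ≡⟨ ∑-cong-< (suc N) (λ j j≤N → cong (∑ (H j)) (sym (ℕP.+-∸-assoc 1 (ℕP.≤-pred j≤N)))) ⟩
  ∑ (λ j → ∑ (H j) (suc N ∸ j)) (suc N) ∎
  where
  open ≡-Reasoning
  diagonal : ℕ → ℚ
  diagonal j = H j (N ∸ j)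
  last-row-empty : ∑ (λ j → ∑ (H j) (N ∸ j)) (suc N) ≡ ∑ (λ j → ∑ (H j) (N ∸ j)) N
  last-row-empty = trans (cong (λ t → ∑ (λ j → ∑ (H j) (N ∸ j)) N + ∑ (H N) t) (ℕP.n∸n≡0 N)) (ℚP.+-identityʳ _)

∑-mono-≤ : ∀ {f g : ℕ → ℚ} n → (∀ k → k ℕ.< n → f k ≤ g k) → ∑ f n ≤ ∑ g n
∑-mono-≤ zero    f≤g = ℚP.≤-refl
∑-mono-≤ (suc n) f≤g = ℚP.+-mono-≤ (∑-mono-≤ n (λ k k<n → f≤g k (ℕP.m<n⇒m<1+n k<n))) (f≤g n ℕP.≤-refl)

∑-nonneg : ∀ {f : ℕ → ℚ} n → (∀ k → k ℕ.< n → 0ℚ ≤ f k) → 0ℚ ≤ ∑ f n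
∑-nonneg {f} n 0≤f = subst (_≤ ∑ f n) (∑-zero n) (∑-mono-≤ n 0≤f)

-- Null sequences

Null : (ℕ → ℚ) → Set
Null a = ∀ ε → 0ℚ < ε → ∃ λ N → ∀ n → N ℕ.≤ n → ∣ a n ∣ < ε

Null-cong : ∀ {a b : ℕ → ℚ} → (∀ n → a n ≡ b n) → Null a → Null b
Null-cong a≡b a→0 ε 0<ε with a→0 ε 0<ε
... | N , ∣a∣<ε = N , λ n N≤n → subst (λ x → ∣ x ∣ < ε) (a≡b n) (∣a∣<ε n N≤n)

null-zero : Null (λ _ → 0ℚ)
null-zero ε 0<ε = 0 , λ _ _ → 0<ε

null-+ : ∀ {a b : ℕ → ℚ} → Null a → Null b → Null (λ n → a n + b n)
null-+ {a} {b} a→0 b→0 ε 0<ε with a→0 (ε * ½) (0<p*½ 0<ε) | b→0 (ε * ½) (0<p*½ 0<ε)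
... | Na , ∣a∣<ε/2 | Nb , ∣b∣<ε/2 = Na ⊔ Nb , λ n N≤n →
  ℚP.≤-<-trans (ℚP.∣p+q∣≤∣p∣+∣q∣ (a n) (b n))
    (subst (∣ a n ∣ + ∣ b n ∣ <_) (p*½+p*½≡p ε)
      (ℚP.+-mono-< (∣a∣<ε/2 n (ℕP.≤-trans (ℕP.m≤m⊔n Na Nb) N≤n))
                   (∣b∣<ε/2 n (ℕP.≤-trans (ℕP.m≤n⊔m Na Nb) N≤n))))

null-neg : ∀ {a : ℕ → ℚ} → Null a → Null (λ n → - a n)
null-neg {a} a→0 ε 0<ε with a→0 ε 0<ε
... | N , ∣a∣<ε = N , λ n N≤n → subst (_< ε) (sym (ℚP.∣-p∣≡∣p∣ (a n))) (∣a∣<ε n N≤n)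

null-sub : ∀ {a b : ℕ → ℚ} → Null a → Null b → Null (λ n → a n - b n)
null-sub a→0 b→0 = null-+ a→0 (null-neg b→0)

null-dominated : ∀ {a b : ℕ → ℚ} → (∀ n → ∣ b n ∣ ≤ a n) → Null a → Null b
null-dominated {a} ∣b∣≤a a→0 ε 0<ε with a→0 ε 0<ε
... | N , ∣a∣<ε = N , λ n N≤n → ℚP.≤-<-trans (ℚP.≤-trans (∣b∣≤a n) (p≤∣p∣ (a n))) (∣a∣<ε n N≤n)

null-nonneg-dominated : ∀ {a b : ℕ → ℚ} → (∀ n → 0ℚ ≤ b n) → (∀ n → b n ≤ a n) → Null a → Null b
null-nonneg-dominated 0≤b b≤a = null-dominated (λ n → ℚP.≤-trans (ℚP.≤-reflexive (ℚP.0≤p⇒∣p∣≡p (0≤b n))) (b≤a n))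

null-suc⁻ : ∀ {a : ℕ → ℚ} → Null (λ n → a (suc n)) → Null a
null-suc⁻ a′→0 ε 0<ε with a′→0 ε 0<ε
... | N , ∣a′∣<ε = suc N , λ { (suc n) (s≤s N≤n) → ∣a′∣<ε n N≤n }

null-*ˡ : ∀ (q : ℚ) {a : ℕ → ℚ} → Null a → Null (λ n → q * a n)
null-*ˡ q {a} a→0 ε 0<ε with a→0 (ε * 1/ℕ (suc K)) 0<ε/[1+K]
  where
  K = ℤ.∣ ℚ.↥ q ∣
  0<ε/[1+K] : 0ℚ < ε * 1/ℕ (suc K)
  0<ε/[1+K] = subst (_< ε * 1/ℕ (suc K)) (ℚP.*-zeroˡ (1/ℕ (suc K)))
    (ℚP.*-monoˡ-<-pos (1/ℕ (suc K)) {{ℚ.positive (0<1/ℕ-suc K)}} 0<ε)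
... | N , ∣a∣<ε/[1+K] = N , λ n N≤n → begin-strict
  ∣ q * a n ∣                         ≡⟨ ℚP.∣p*q∣≡∣p∣*∣q∣ q (a n) ⟩
  ∣ q ∣ * ∣ a n ∣                     ≤⟨ *-monoʳ-≤-nonneg (ℚP.0≤∣p∣ (a n))
                                          (ℚP.≤-trans (∣p∣≤fromℕ∣↥p∣ q) (fromℕ-mono-≤ (ℕP.n≤1+n K))) ⟩
  fromℕ (suc K) * ∣ a n ∣             <⟨ ℚP.*-monoʳ-<-pos (fromℕ (suc K)) {{ℚ.positive (0<fromℕ-suc K)}} (∣a∣<ε/[1+K] n N≤n) ⟩
  fromℕ (suc K) * (ε * 1/ℕ (suc K))   ≡⟨ solve 3 (λ k e i → k :* (e :* i) := e :* (k :* i)) refl (fromℕ (suc K)) ε (1/ℕ (suc K)) ⟩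
  ε * (fromℕ (suc K) * 1/ℕ (suc K))   ≡⟨ trans (cong (ε *_) (fromℕ*1/ℕ-suc K)) (ℚP.*-identityʳ ε) ⟩
  ε                                   ∎
  where
  open ℚP.≤-Reasoning
  K = ℤ.∣ ℚ.↥ q ∣

null-1/ℕ-suc : Null (λ n → 1/ℕ (suc n))
null-1/ℕ-suc ε 0<ε with 1/ℕ-archimedean ε 0<ε
... | N , 1/[1+N]<ε = N , λ n N≤n →
  ℚP.≤-<-trans (ℚP.≤-reflexive (ℚP.0≤p⇒∣p∣≡p (0≤1/ℕ (suc n)))) (ℚP.≤-<-trans (1/ℕ-antitone N≤n) 1/[1+N]<ε)

-- The sequence c and the series T a

-- c k = C(2k,k) / 4^k, defined through the ratio of consecutive terms (see c*4^k≡C[2k,k]).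
c : ℕ → ℚ
c zero    = 1ℚ
c (suc k) = c k * (fromℕ (suc (2 ℕ.* k)) * 1/ℕ (suc (suc (2 ℕ.* k))))

c-suc : ∀ k → c (suc k) * fromℕ (suc (suc (2 ℕ.* k))) ≡ c k * fromℕ (suc (2 ℕ.* k))
c-suc k = begin
  c k * (fromℕ 1+2k * 1/ℕ 2+2k) * fromℕ 2+2k ≡⟨ solve 4 (λ c a i b → c :* (a :* i) :* b := c :* a :* (b :* i))
                                                  refl (c k) (fromℕ 1+2k) (1/ℕ 2+2k) (fromℕ 2+2k) ⟩
  c k * fromℕ 1+2k * (fromℕ 2+2k * 1/ℕ 2+2k) ≡⟨ cong (c k * fromℕ 1+2k *_) (fromℕ*1/ℕ-suc 1+2k) ⟩
  c k * fromℕ 1+2k * 1ℚ                      ≡⟨ ℚP.*-identityʳ _ ⟩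
  c k * fromℕ 1+2k                           ∎
  where
  open ≡-Reasoning
  1+2k = suc (2 ℕ.* k)
  2+2k = suc 1+2k

c-nonneg : ∀ k → 0ℚ ≤ c k
c-nonneg zero    = 0≤1
c-nonneg (suc k) = *-nonneg (c-nonneg k) (*-nonneg (0≤fromℕ _) (0≤1/ℕ _))

c-suc≤c : ∀ k → c (suc k) ≤ c k
c-suc≤c k = p*q≤p (c-nonneg k) (subst (fromℕ (suc (2 ℕ.* k)) * 1/ℕ (suc (suc (2 ℕ.* k))) ≤_)
  (fromℕ*1/ℕ-suc (suc (2 ℕ.* k))) (*-monoʳ-≤-nonneg (0≤1/ℕ _) (fromℕ-mono-≤ (ℕP.n≤1+n _))))

c≤1 : ∀ k → c k ≤ 1ℚ
c≤1 zero    = ℚP.≤-refl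
c≤1 (suc k) = ℚP.≤-trans (c-suc≤c k) (c≤1 k)

c-c-suc : ∀ k → c k - c (suc k) ≡ c k * 1/ℕ (suc (suc (2 ℕ.* k)))
c-c-suc k = begin
  c k - c k * (fromℕ 1+2k * 1/ℕ 2+2k)                     ≡⟨ cong (λ t → t - c k * (fromℕ 1+2k * 1/ℕ 2+2k))
                                                               (sym (trans (cong (c k *_) (fromℕ*1/ℕ-suc 1+2k))
                                                                           (ℚP.*-identityʳ (c k)))) ⟩
  c k * (fromℕ 2+2k * 1/ℕ 2+2k) - c k * (fromℕ 1+2k * 1/ℕ 2+2k)
                                                           ≡⟨ cong (λ t → c k * (t * 1/ℕ 2+2k) - c k * (fromℕ 1+2k * 1/ℕ 2+2k))
                                                               (fromℕ-suc 1+2k) ⟩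
  c k * ((fromℕ 1+2k + 1ℚ) * 1/ℕ 2+2k) - c k * (fromℕ 1+2k * 1/ℕ 2+2k)
                                                           ≡⟨ solve 3 (λ c a i → c :* ((a :+ con 1ℚ) :* i) :- c :* (a :* i) := c :* i)
                                                               refl (c k) (fromℕ 1+2k) (1/ℕ 2+2k) ⟩
  c k * 1/ℕ 2+2k                                           ∎
  where
  open ≡-Reasoning
  1+2k = suc (2 ℕ.* k)
  2+2k = suc 1+2k

c²*[1+2k]≤1 : ∀ k → c k * c k * fromℕ (suc (2 ℕ.* k)) ≤ 1ℚ
c²*[1+2k]≤1 zero    = ℚP.≤-reflexive (cong (1ℚ * 1ℚ *_) fromℕ-1)
c²*[1+2k]≤1 (suc k) = begin
  c (suc k) * c (suc k) * fromℕ (suc (2 ℕ.* suc k))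
    ≡⟨ cong (λ t → c (suc k) * c (suc k) * fromℕ (suc t)) (2*[1+n]≡2+2*n k) ⟩
  c k * (fromℕ 1+2k * 1/ℕ 2+2k) * (c k * (fromℕ 1+2k * 1/ℕ 2+2k)) * fromℕ 3+2k
    ≡⟨ solve 4 (λ c a i d → c :* (a :* i) :* (c :* (a :* i)) :* d := (c :* c :* a) :* ((a :* d) :* (i :* i)))
         refl (c k) (fromℕ 1+2k) (1/ℕ 2+2k) (fromℕ 3+2k) ⟩
  (c k * c k * fromℕ 1+2k) * ((fromℕ 1+2k * fromℕ 3+2k) * (1/ℕ 2+2k * 1/ℕ 2+2k))
    ≤⟨ *-mono-≤-nonneg 0≤1 (*-nonneg (*-nonneg (0≤fromℕ _) (0≤fromℕ _)) (*-nonneg (0≤1/ℕ _) (0≤1/ℕ _)))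
         (c²*[1+2k]≤1 k) AM-GM ⟩
  1ℚ * 1ℚ
    ≡⟨⟩
  1ℚ ∎
  where
  open ℚP.≤-Reasoning
  1+2k = suc (2 ℕ.* k)
  2+2k = suc 1+2k
  3+2k = suc 2+2k
  [n-1][n+1]≤n² : ∀ m → m ℕ.* suc (suc m) ℕ.≤ suc m ℕ.* suc m
  [n-1][n+1]≤n² m = subst (m ℕ.* suc (suc m) ℕ.≤_) (sym (eq m)) (ℕP.m≤m+n _ 1)
    where
    eq : ∀ m → suc m ℕ.* suc m ≡ m ℕ.* suc (suc m) ℕ.+ 1
    eq = solve-∀
  AM-GM : (fromℕ 1+2k * fromℕ 3+2k) * (1/ℕ 2+2k * 1/ℕ 2+2k) ≤ 1ℚ
  AM-GM = begin
    (fromℕ 1+2k * fromℕ 3+2k) * (1/ℕ 2+2k * 1/ℕ 2+2k)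
      ≡⟨ cong (_* (1/ℕ 2+2k * 1/ℕ 2+2k)) (sym (fromℕ-* 1+2k 3+2k)) ⟩
    fromℕ (1+2k ℕ.* 3+2k) * (1/ℕ 2+2k * 1/ℕ 2+2k)
      ≤⟨ *-monoʳ-≤-nonneg (*-nonneg (0≤1/ℕ _) (0≤1/ℕ _)) (fromℕ-mono-≤ ([n-1][n+1]≤n² 1+2k)) ⟩
    fromℕ (2+2k ℕ.* 2+2k) * (1/ℕ 2+2k * 1/ℕ 2+2k)
      ≡⟨ cong (_* (1/ℕ 2+2k * 1/ℕ 2+2k)) (fromℕ-* 2+2k 2+2k) ⟩
    fromℕ 2+2k * fromℕ 2+2k * (1/ℕ 2+2k * 1/ℕ 2+2k)
      ≡⟨ solve 2 (λ b i → (b :* b) :* (i :* i) := (b :* i) :* (b :* i)) refl (fromℕ 2+2k) (1/ℕ 2+2k) ⟩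
    (fromℕ 2+2k * 1/ℕ 2+2k) * (fromℕ 2+2k * 1/ℕ 2+2k)
      ≡⟨ cong₂ _*_ (fromℕ*1/ℕ-suc 1+2k) (fromℕ*1/ℕ-suc 1+2k) ⟩
    1ℚ ∎

c²≤1/ℕ[1+k] : ∀ k → c k * c k ≤ 1/ℕ (suc k)
c²≤1/ℕ[1+k] k = begin
  c k * c k                                ≡⟨ sym (trans (ℚP.*-assoc (c k * c k) _ _)
                                                (trans (cong (c k * c k *_) (fromℕ*1/ℕ-suc (2 ℕ.* k))) (ℚP.*-identityʳ _))) ⟩
  c k * c k * fromℕ 1+2k * 1/ℕ 1+2k         ≤⟨ *-monoʳ-≤-nonneg (0≤1/ℕ _) (c²*[1+2k]≤1 k) ⟩
  1ℚ * 1/ℕ 1+2k                            ≡⟨ ℚP.*-identityˡ _ ⟩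
  1/ℕ 1+2k                                 ≤⟨ 1/ℕ-antitone (ℕP.m≤m+n k (1 ℕ.* k)) ⟩
  1/ℕ (suc k)                              ∎
  where
  open ℚP.≤-Reasoning
  1+2k = suc (2 ℕ.* k)

-- c k ≥ ε forces ε² ≤ c k ² ≤ 1/(k+1).
c-null : Null c
c-null ε 0<ε with null-1/ℕ-suc (ε * ε) (subst (_< ε * ε) (ℚP.*-zeroˡ ε) (ℚP.*-monoˡ-<-pos ε {{ℚ.positive 0<ε}} 0<ε))
... | N , 1/ℕ<ε² = N , λ n N≤n → subst (_< ε) (sym (ℚP.0≤p⇒∣p∣≡p (c-nonneg n))) (c<ε n N≤n)
  where
  c<ε : ∀ n → N ℕ.≤ n → c n < ε
  c<ε n N≤n with ε ℚP.≤? c n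
  ... | no  ε≰c = ℚP.≰⇒> ε≰c
  ... | yes ε≤c = ⊥-elim (ℚP.<-irrefl refl (ℚP.≤-<-trans (*-mono-≤-nonneg (c-nonneg n) (ℚP.<⇒≤ 0<ε) ε≤c ε≤c)
                    (ℚP.≤-<-trans (c²≤1/ℕ[1+k] n) (ℚP.≤-<-trans (p≤∣p∣ _) (1/ℕ<ε² n N≤n)))))

t : ℕ → ℕ → ℚ
t a k = c k * 1/ℕ (2 ℕ.* k ℕ.+ a)

T : ℕ → ℕ → ℚ
T a = ∑ (t a)

G : ℕ → ℕ → ℚ
G a k = c k * fromℕ (2 ℕ.* k) * 1/ℕ (2 ℕ.* k ℕ.+ a)

G-0 : ∀ a → G a 0 ≡ 0ℚ
G-0 a = trans (cong (λ x → 1ℚ * x * 1/ℕ a) fromℕ-0) (ℚP.*-zeroˡ (1/ℕ a))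

G-nonneg : ∀ a n → 0ℚ ≤ G a n
G-nonneg a n = *-nonneg (*-nonneg (c-nonneg n) (0≤fromℕ _)) (0≤1/ℕ _)

fromℕ*1/ℕ-+suc : ∀ x a → fromℕ (x ℕ.+ suc a) * 1/ℕ (x ℕ.+ suc a) ≡ 1ℚ
fromℕ*1/ℕ-+suc x a rewrite ℕP.+-suc x a = fromℕ*1/ℕ-suc (x ℕ.+ a)

G≤c : ∀ a n → G (suc a) n ≤ c n
G≤c a n = ℚP.≤-trans (ℚP.≤-reflexive (ℚP.*-assoc (c n) _ _)) (p*q≤p (c-nonneg n) 2n/[2n+1+a]≤1)
  where
  2n/[2n+1+a]≤1 : fromℕ (2 ℕ.* n) * 1/ℕ (2 ℕ.* n ℕ.+ suc a) ≤ 1ℚ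
  2n/[2n+1+a]≤1 = subst (fromℕ (2 ℕ.* n) * 1/ℕ (2 ℕ.* n ℕ.+ suc a) ≤_) (fromℕ*1/ℕ-+suc (2 ℕ.* n) a)
    (*-monoʳ-≤-nonneg (0≤1/ℕ _) (fromℕ-mono-≤ (ℕP.m≤m+n (2 ℕ.* n) (suc a))))

null-G : ∀ a → Null (G (suc a))
null-G a = null-nonneg-dominated (G-nonneg (suc a)) (G≤c a) c-null

t-telescoping : ∀ a k → fromℕ (suc a) * t (suc a) k - fromℕ (suc (suc a)) * t (suc (suc (suc a))) k
                      ≡ G (suc a) (suc k) - G (suc a) k
t-telescoping a k = begin
  A * (c k * iX) - fromℕ (suc (suc a)) * (c k * iY)   ≡⟨ cong (λ x → A * (c k * iX) - x * (c k * iY)) (fromℕ-suc (suc a)) ⟩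
  A * (c k * iX) - (A + 1ℚ) * (c k * iY)              ≡⟨ identity (c k) (K+A*iX≡1) (K+A+2*iY≡1) ⟩
  c k * (K + 1ℚ) * iY - c k * K * iX                  ≡⟨ cong (λ x → c k * x * iY - c k * K * iX) (sym (fromℕ-suc (2 ℕ.* k))) ⟩
  c k * fromℕ (suc (2 ℕ.* k)) * iY - c k * K * iX     ≡⟨ cong (λ x → x * iY - c k * K * iX) (sym (c-suc k)) ⟩
  c (suc k) * fromℕ (suc (suc (2 ℕ.* k))) * iY - c k * K * iX
    ≡⟨ cong₂ (λ m n → c (suc k) * fromℕ m * 1/ℕ n - c k * K * iX) (sym (2*[1+n]≡2+2*n k)) (2k+3+a≡2[k+1]+1+a k a) ⟩
  G (suc a) (suc k) - G (suc a) k                     ∎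
  where
  open ≡-Reasoning
  A = fromℕ (suc a)
  K = fromℕ (2 ℕ.* k)
  iX = 1/ℕ (2 ℕ.* k ℕ.+ suc a)
  iY = 1/ℕ (2 ℕ.* k ℕ.+ suc (suc (suc a)))
  K+A*iX≡1 : (K + A) * iX ≡ 1ℚ
  K+A*iX≡1 = trans (cong (_* iX) (sym (fromℕ-+ (2 ℕ.* k) (suc a)))) (fromℕ*1/ℕ-+suc (2 ℕ.* k) a)
  K+A+2*iY≡1 : (K + A + 1ℚ + 1ℚ) * iY ≡ 1ℚ
  K+A+2*iY≡1 = trans (cong (_* iY) (sym (begin
    fromℕ (2 ℕ.* k ℕ.+ suc (suc (suc a)))        ≡⟨ fromℕ-+ (2 ℕ.* k) (suc (suc (suc a))) ⟩
    K + fromℕ (suc (suc (suc a)))                ≡⟨ cong (λ x → K + x) (trans (fromℕ-suc (suc (suc a))) (cong (_+ 1ℚ) (fromℕ-suc (suc a)))) ⟩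
    K + (A + 1ℚ + 1ℚ)                            ≡⟨ solve 3 (λ k a o → k :+ (a :+ o :+ o) := k :+ a :+ o :+ o) refl K A 1ℚ ⟩
    K + A + 1ℚ + 1ℚ                              ∎))) (fromℕ*1/ℕ-+suc (2 ℕ.* k) (suc (suc a)))
  2k+3+a≡2[k+1]+1+a : ∀ k a → 2 ℕ.* k ℕ.+ suc (suc (suc a)) ≡ 2 ℕ.* suc k ℕ.+ suc a
  2k+3+a≡2[k+1]+1+a = solve-∀
  identity : ∀ x → (K + A) * iX ≡ 1ℚ → (K + A + 1ℚ + 1ℚ) * iY ≡ 1ℚ →
             A * (x * iX) - (A + 1ℚ) * (x * iY) ≡ x * (K + 1ℚ) * iY - x * K * iX
  identity x hX hY = begin
    A * (x * iX) - (A + 1ℚ) * (x * iY)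
      ≡⟨ solve 5 (λ x A K iX iY → A :* (x :* iX) :- (A :+ con 1ℚ) :* (x :* iY) :=
            x :* (K :+ con 1ℚ) :* iY :- x :* K :* iX :+ x :* ((K :+ A) :* iX) :- x :* ((K :+ A :+ con 1ℚ :+ con 1ℚ) :* iY))
           refl x A K iX iY ⟩
    x * (K + 1ℚ) * iY - x * K * iX + x * ((K + A) * iX) - x * ((K + A + 1ℚ + 1ℚ) * iY)
      ≡⟨ cong₂ (λ u v → x * (K + 1ℚ) * iY - x * K * iX + x * u - x * v) hX hY ⟩
    x * (K + 1ℚ) * iY - x * K * iX + x * 1ℚ - x * 1ℚ
      ≡⟨ solve 2 (λ r x → r :+ x :* con 1ℚ :- x :* con 1ℚ := r) refl (x * (K + 1ℚ) * iY - x * K * iX) x ⟩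
    x * (K + 1ℚ) * iY - x * K * iX ∎

T-recurrence : ∀ a n → fromℕ (suc a) * T (suc a) n - fromℕ (suc (suc a)) * T (suc (suc (suc a))) n ≡ G (suc a) n
T-recurrence a n = begin
  A * T (suc a) n - B * T (suc (suc (suc a))) n
    ≡⟨ sym (cong₂ _-_ (∑-*ˡ A (t (suc a)) n) (∑-*ˡ B (t (suc (suc (suc a)))) n)) ⟩
  ∑ (λ k → A * t (suc a) k) n - ∑ (λ k → B * t (suc (suc (suc a))) k) n
    ≡⟨ sym (∑-sub _ _ n) ⟩
  ∑ (λ k → A * t (suc a) k - B * t (suc (suc (suc a))) k) n
    ≡⟨ ∑-cong (t-telescoping a) n ⟩
  ∑ (λ k → G (suc a) (suc k) - G (suc a) k) n
    ≡⟨ ∑-telescope-0 (G (suc a)) (G-0 (suc a)) n ⟩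
  G (suc a) n ∎
  where
  open ≡-Reasoning
  A = fromℕ (suc a)
  B = fromℕ (suc (suc a))

T-2 : ∀ n → T 2 n ≡ 1ℚ - c n
T-2 n = begin
  ∑ (t 2) n                               ≡⟨ ∑-cong t2≡ n ⟩
  ∑ (λ k → (- c (suc k)) - (- c k)) n     ≡⟨ ∑-telescope (λ k → - c k) n ⟩
  - c n - - 1ℚ                            ≡⟨ solve 1 (λ x → :- x :- :- con 1ℚ := con 1ℚ :- x) refl (c n) ⟩
  1ℚ - c n                                ∎
  where
  open ≡-Reasoning
  t2≡ : ∀ k → t 2 k ≡ (- c (suc k)) - (- c k)
  t2≡ k = begin
    c k * 1/ℕ (2 ℕ.* k ℕ.+ 2)           ≡⟨ cong (λ m → c k * 1/ℕ m) (ℕP.+-comm (2 ℕ.* k) 2) ⟩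
    c k * 1/ℕ (suc (suc (2 ℕ.* k)))     ≡⟨ sym (c-c-suc k) ⟩
    c k - c (suc k)                     ≡⟨ solve 2 (λ x y → x :- y := :- y :- :- x) refl (c k) (c (suc k)) ⟩
    (- c (suc k)) - (- c k)             ∎

-- β i r = (2i)!! / ((2r+1)(2r+3)⋯(2r+2i+1)) is ((−Δ)^i f) r for f r = 1/(2r+1) (β-difference), and
-- α j = β j 0 = (2j)!!/(2j+1)!! are the terms of the Euler transform of the Leibniz series Σ (−1)^r f r.
β : ℕ → ℕ → ℚ
β zero    r = 1/ℕ (suc (2 ℕ.* r))
β (suc i) r = β i r * fromℕ (suc (suc (2 ℕ.* i))) * 1/ℕ (suc (suc (suc (2 ℕ.* i ℕ.+ 2 ℕ.* r))))

β-suc-r : ∀ i r → β i (suc r) ≡ β i r * fromℕ (suc (2 ℕ.* r)) * 1/ℕ (suc (suc (suc (2 ℕ.* i ℕ.+ 2 ℕ.* r))))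
β-suc-r zero r = begin
  1/ℕ (suc (2 ℕ.* suc r))                                 ≡⟨ cong (λ m → 1/ℕ (suc m)) (2*[1+n]≡2+2*n r) ⟩
  1/ℕ (3+2r)                                              ≡⟨ sym (ℚP.*-identityˡ _) ⟩
  1ℚ * 1/ℕ (3+2r)                                         ≡⟨ cong (_* 1/ℕ (3+2r)) (sym (1/ℕ*fromℕ-suc (2 ℕ.* r))) ⟩
  1/ℕ (suc (2 ℕ.* r)) * fromℕ (suc (2 ℕ.* r)) * 1/ℕ (3+2r) ∎
  where
  open ≡-Reasoning
  3+2r = suc (suc (suc (2 ℕ.* r)))
β-suc-r (suc i) r = begin
  β i (suc r) * E * 1/ℕ (Z i (suc r))                   ≡⟨ cong (λ x → x * E * 1/ℕ (Z i (suc r))) (β-suc-r i r) ⟩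
  β i r * O * 1/ℕ (Z i r) * E * 1/ℕ (Z i (suc r))       ≡⟨ cong (λ m → β i r * O * 1/ℕ (Z i r) * E * 1/ℕ m) (Z-shift i r) ⟩
  β i r * O * 1/ℕ (Z i r) * E * 1/ℕ (Z (suc i) r)       ≡⟨ solve 5 (λ b o i e j → b :* o :* i :* e :* j := b :* e :* i :* o :* j)
                                                            refl (β i r) O (1/ℕ (Z i r)) E (1/ℕ (Z (suc i) r)) ⟩
  β i r * E * 1/ℕ (Z i r) * O * 1/ℕ (Z (suc i) r)       ∎
  where
  open ≡-Reasoning
  Z : ℕ → ℕ → ℕ
  Z i r = suc (suc (suc (2 ℕ.* i ℕ.+ 2 ℕ.* r)))
  Z-shift : ∀ i r → suc (suc (suc (2 ℕ.* i ℕ.+ 2 ℕ.* suc r))) ≡ suc (suc (suc (2 ℕ.* suc i ℕ.+ 2 ℕ.* r)))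
  Z-shift = solve-∀
  E = fromℕ (suc (suc (2 ℕ.* i)))
  O = fromℕ (suc (2 ℕ.* r))

β-difference : ∀ i r → β i r - β i (suc r) ≡ β (suc i) r
β-difference i r = begin
  β i r - β i (suc r)                        ≡⟨ cong (λ x → β i r - x) (β-suc-r i r) ⟩
  β i r - β i r * O * I                      ≡⟨ cong (λ x → x - β i r * O * I)
                                                  (sym (trans (cong (β i r *_) (fromℕ*1/ℕ-suc _)) (ℚP.*-identityʳ (β i r)))) ⟩
  β i r * (fromℕ (Z) * I) - β i r * O * I    ≡⟨ cong (λ x → β i r * (x * I) - β i r * O * I)
                                                  (trans (cong fromℕ (Z≡E+O i r)) (fromℕ-+ _ _)) ⟩
  β i r * ((E + O) * I) - β i r * O * I      ≡⟨ solve 4 (λ b e o i → b :* ((e :+ o) :* i) :- b :* o :* i := b :* e :* i)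
                                                  refl (β i r) E O I ⟩
  β i r * E * I                              ∎
  where
  open ≡-Reasoning
  Z = suc (suc (suc (2 ℕ.* i ℕ.+ 2 ℕ.* r)))
  E = fromℕ (suc (suc (2 ℕ.* i)))
  O = fromℕ (suc (2 ℕ.* r))
  I = 1/ℕ Z
  Z≡E+O : ∀ i r → suc (suc (suc (2 ℕ.* i ℕ.+ 2 ℕ.* r))) ≡ suc (suc (2 ℕ.* i)) ℕ.+ suc (2 ℕ.* r)
  Z≡E+O = solve-∀

β-nonneg : ∀ i r → 0ℚ ≤ β i r
β-nonneg zero    r = 0≤1/ℕ _
β-nonneg (suc i) r = *-nonneg (*-nonneg (β-nonneg i r) (0≤fromℕ _)) (0≤1/ℕ _)

β≤1/ℕ[1+2r] : ∀ i r → β i r ≤ 1/ℕ (suc (2 ℕ.* r))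
β≤1/ℕ[1+2r] zero    r = ℚP.≤-refl
β≤1/ℕ[1+2r] (suc i) r = ℚP.≤-trans (ℚP.≤-reflexive (ℚP.*-assoc (β i r) _ _))
  (ℚP.≤-trans (p*q≤p (β-nonneg i r) E/Z≤1) (β≤1/ℕ[1+2r] i r))
  where
  Z = suc (suc (suc (2 ℕ.* i ℕ.+ 2 ℕ.* r)))
  E/Z≤1 : fromℕ (suc (suc (2 ℕ.* i))) * 1/ℕ Z ≤ 1ℚ
  E/Z≤1 = subst (fromℕ (suc (suc (2 ℕ.* i))) * 1/ℕ Z ≤_) (fromℕ*1/ℕ-suc _)
    (*-monoʳ-≤-nonneg (0≤1/ℕ _) (fromℕ-mono-≤ (s≤s (s≤s (ℕP.≤-trans (ℕP.m≤m+n (2 ℕ.* i) (2 ℕ.* r)) (ℕP.n≤1+n _))))))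

α : ℕ → ℚ
α j = β j 0

α-0 : α 0 ≡ 1ℚ
α-0 = 1/ℕ-1

α-suc : ∀ j → α (suc j) * fromℕ (suc (suc (suc (2 ℕ.* j)))) ≡ α j * fromℕ (suc (suc (2 ℕ.* j)))
α-suc j = begin
  α j * E * 1/ℕ Z * fromℕ (suc (suc (suc (2 ℕ.* j))))   ≡⟨ cong (λ m → α j * E * 1/ℕ Z * fromℕ (suc (suc (suc m))))
                                                             (sym (ℕP.+-identityʳ (2 ℕ.* j))) ⟩
  α j * E * 1/ℕ Z * fromℕ Z                            ≡⟨ ℚP.*-assoc (α j * E) _ _ ⟩
  α j * E * (1/ℕ Z * fromℕ Z)                          ≡⟨ cong (α j * E *_) (1/ℕ*fromℕ-suc _) ⟩
  α j * E * 1ℚ                                         ≡⟨ ℚP.*-identityʳ _ ⟩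
  α j * E                                              ∎
  where
  open ≡-Reasoning
  E = fromℕ (suc (suc (2 ℕ.* j)))
  Z = suc (suc (suc (2 ℕ.* j ℕ.+ 2 ℕ.* 0)))

tail-T[2+2j] : ℕ → ℕ → ℚ
tail-T[2+2j] j n = α j - T (suc (suc (2 ℕ.* j))) n

tail-T[2+2j]-0 : ∀ n → tail-T[2+2j] 0 n ≡ c n
tail-T[2+2j]-0 n = trans (cong₂ _-_ α-0 (T-2 n)) (solve 1 (λ x → con 1ℚ :- (con 1ℚ :- x) := x) refl (c n))

tail-T[2+2j]-suc : ∀ j n → fromℕ (suc (suc (suc (2 ℕ.* j)))) * tail-T[2+2j] (suc j) n
                         ≡ fromℕ (suc (suc (2 ℕ.* j))) * tail-T[2+2j] j n + G (suc (suc (2 ℕ.* j))) n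
tail-T[2+2j]-suc j n = begin
  F * (α (suc j) - T (suc (suc (2 ℕ.* suc j))) n)   ≡⟨ cong (λ m → F * (α (suc j) - T (suc (suc m)) n)) (2*[1+n]≡2+2*n j) ⟩
  F * (α (suc j) - T″)                              ≡⟨ solve 3 (λ f a t → f :* (a :- t) := a :* f :- f :* t) refl F (α (suc j)) T″ ⟩
  α (suc j) * F - F * T″                            ≡⟨ cong (_- F * T″) (α-suc j) ⟩
  α j * E - F * T″                                  ≡⟨ cong (λ x → α j * E - x)
                                                        (solve 3 (λ e t g → g := e :* t :- (e :* t :- g)) refl E T′ (F * T″)) ⟩
  α j * E - (E * T′ - (E * T′ - F * T″))            ≡⟨ cong (λ x → α j * E - (E * T′ - x)) (T-recurrence (suc (2 ℕ.* j)) n) ⟩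
  α j * E - (E * T′ - G′)                           ≡⟨ solve 4 (λ a e t g → a :* e :- (e :* t :- g) := e :* (a :- t) :+ g) refl (α j) E T′ G′ ⟩
  E * tail-T[2+2j] j n + G′                         ∎
  where
  open ≡-Reasoning
  F = fromℕ (suc (suc (suc (2 ℕ.* j))))
  E = fromℕ (suc (suc (2 ℕ.* j)))
  T′ = T (suc (suc (2 ℕ.* j))) n
  T″ = T (suc (suc (suc (suc (2 ℕ.* j))))) n
  G′ = G (suc (suc (2 ℕ.* j))) n

-- The recursion for the tail is a weighted average of tail j and G ≤ c, with weights E/F and 1/F.
0≤tail-T[2+2j]≤c : ∀ j n → 0ℚ ≤ tail-T[2+2j] j n × tail-T[2+2j] j n ≤ c n
0≤tail-T[2+2j]≤c zero n = subst (0ℚ ≤_) (sym (tail-T[2+2j]-0 n)) (c-nonneg n) , ℚP.≤-reflexive (tail-T[2+2j]-0 n)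
0≤tail-T[2+2j]≤c (suc j) n = lower , upper
  where
  F = fromℕ (suc (suc (suc (2 ℕ.* j))))
  E = fromℕ (suc (suc (2 ℕ.* j)))
  instance
    F-positive : ℚ.Positive F
    F-positive = ℚ.positive (0<fromℕ-suc (suc (suc (2 ℕ.* j))))
  IH = 0≤tail-T[2+2j]≤c j n
  lower : 0ℚ ≤ tail-T[2+2j] (suc j) n
  lower = ℚP.*-cancelˡ-≤-pos F (ℚP.≤-trans (ℚP.≤-reflexive (ℚP.*-zeroʳ F))
    (subst (0ℚ ≤_) (sym (tail-T[2+2j]-suc j n))
      (ℚP.≤-trans (ℚP.≤-reflexive (sym (ℚP.+-identityʳ 0ℚ)))
        (ℚP.+-mono-≤ (*-nonneg (0≤fromℕ _) (proj₁ IH)) (G-nonneg _ n)))))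
  upper : tail-T[2+2j] (suc j) n ≤ c n
  upper = ℚP.*-cancelˡ-≤-pos F (subst (_≤ F * c n) (sym (tail-T[2+2j]-suc j n))
    (ℚP.≤-trans (ℚP.+-mono-≤ (*-monoˡ-≤-nonneg (0≤fromℕ _) (proj₂ IH)) (G≤c (suc (2 ℕ.* j)) n))
      (ℚP.≤-reflexive (trans (solve 2 (λ e x → e :* x :+ x := (e :+ con 1ℚ) :* x) refl E (c n))
        (cong (_* c n) (sym (fromℕ-suc (suc (suc (2 ℕ.* j))))))))))

T[2+2j]→α : ∀ j → Null (λ n → T (2 ℕ.* suc j) n - α j)
T[2+2j]→α j = null-dominated ∣T-α∣≤c c-null
  where
  ∣T-α∣≤c : ∀ n → ∣ T (2 ℕ.* suc j) n - α j ∣ ≤ c n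
  ∣T-α∣≤c n = begin
    ∣ T (2 ℕ.* suc j) n - α j ∣                   ≡⟨ cong (λ m → ∣ T m n - α j ∣) (2*[1+n]≡2+2*n j) ⟩
    ∣ T (suc (suc (2 ℕ.* j))) n - α j ∣           ≡⟨ cong ∣_∣ (solve 2 (λ x y → x :- y := :- (y :- x)) refl (T (suc (suc (2 ℕ.* j))) n) (α j)) ⟩
    ∣ - tail-T[2+2j] j n ∣                        ≡⟨ trans (ℚP.∣-p∣≡∣p∣ _) (ℚP.0≤p⇒∣p∣≡p (proj₁ (0≤tail-T[2+2j]≤c j n))) ⟩
    tail-T[2+2j] j n                              ≤⟨ proj₂ (0≤tail-T[2+2j]≤c j n) ⟩
    c n                                           ∎
    where open ℚP.≤-Reasoning

T[1+2m]-c*T1→0 : ∀ m → Null (λ n → T (suc (2 ℕ.* m)) n - c m * T 1 n)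
T[1+2m]-c*T1→0 zero    = Null-cong (λ n → sym (trans (cong (λ x → T 1 n - x) (ℚP.*-identityˡ (T 1 n))) (ℚP.+-inverseʳ (T 1 n)))) null-zero
T[1+2m]-c*T1→0 (suc m) = Null-cong (λ n → sym (by-recurrence n))
  (null-*ˡ I (null-sub (null-*ˡ O (T[1+2m]-c*T1→0 m)) (null-G (2 ℕ.* m))))
  where
  O = fromℕ (suc (2 ℕ.* m))
  E = fromℕ (suc (suc (2 ℕ.* m)))
  I = 1/ℕ (suc (suc (2 ℕ.* m)))
  by-recurrence : ∀ n → T (suc (2 ℕ.* suc m)) n - c (suc m) * T 1 n
                      ≡ I * (O * (T (suc (2 ℕ.* m)) n - c m * T 1 n) - G (suc (2 ℕ.* m)) n)
  by-recurrence n = *-solveˡ E I (1/ℕ*fromℕ-suc (suc (2 ℕ.* m))) (begin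
    E * (T (suc (2 ℕ.* suc m)) n - c (suc m) * T 1 n)
      ≡⟨ cong (λ k → E * (T (suc k) n - c (suc m) * T 1 n)) (2*[1+n]≡2+2*n m) ⟩
    E * (T₃ - c (suc m) * T 1 n)
      ≡⟨ solve 4 (λ e t c x → e :* (t :- c :* x) := e :* t :- (c :* e) :* x) refl E T₃ (c (suc m)) (T 1 n) ⟩
    E * T₃ - (c (suc m) * E) * T 1 n
      ≡⟨ cong (λ x → E * T₃ - x * T 1 n) (c-suc m) ⟩
    E * T₃ - (c m * O) * T 1 n
      ≡⟨ cong (λ x → x - (c m * O) * T 1 n) (solve 3 (λ o t u → u := o :* t :- (o :* t :- u)) refl O T₁ (E * T₃)) ⟩
    O * T₁ - (O * T₁ - E * T₃) - (c m * O) * T 1 n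
      ≡⟨ cong (λ x → O * T₁ - x - (c m * O) * T 1 n) (T-recurrence (2 ℕ.* m) n) ⟩
    O * T₁ - G (suc (2 ℕ.* m)) n - (c m * O) * T 1 n
      ≡⟨ solve 5 (λ o t g c x → o :* t :- g :- (c :* o) :* x := o :* (t :- c :* x) :- g)
           refl O T₁ (G (suc (2 ℕ.* m)) n) (c m) (T 1 n) ⟩
    O * (T₁ - c m * T 1 n) - G (suc (2 ℕ.* m)) n ∎)
    where
    open ≡-Reasoning
    T₃ = T (suc (suc (suc (2 ℕ.* m)))) n
    T₁ = T (suc (2 ℕ.* m)) n

-- Induction on ν

1/ℤ : ℤ → ℚ
1/ℤ (+ n)    = 1/ℕ n
1/ℤ -[1+ n ] = - 1/ℕ (suc n)

fromℤ*1/ℤ : ∀ z → z ≢ + 0 → fromℤ z * 1/ℤ z ≡ 1ℚ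
fromℤ*1/ℤ (+ zero)  z≢0 = ⊥-elim (z≢0 refl)
fromℤ*1/ℤ (+ suc n) _   = trans (cong (_* 1/ℕ (suc n)) (sym (fromℕ≡fromℤ (suc n)))) (fromℕ*1/ℕ-suc n)
fromℤ*1/ℤ -[1+ n ]  _   = begin
  fromℤ (ℤ.- (+ suc n)) * (- 1/ℕ (suc n))     ≡⟨ cong (_* (- 1/ℕ (suc n))) (fromℤ-neg (+ suc n)) ⟩
  - fromℤ (+ suc n) * (- 1/ℕ (suc n))         ≡⟨ cong (λ x → - x * (- 1/ℕ (suc n))) (sym (fromℕ≡fromℤ (suc n))) ⟩
  - fromℕ (suc n) * (- 1/ℕ (suc n))           ≡⟨ solve 2 (λ x y → (:- x) :* (:- y) := x :* y) refl (fromℕ (suc n)) (1/ℕ (suc n)) ⟩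
  fromℕ (suc n) * 1/ℕ (suc n)                 ≡⟨ fromℕ*1/ℕ-suc n ⟩
  1ℚ                                          ∎
  where open ≡-Reasoning

∣1/ℤ∣≤1 : ∀ z → ∣ 1/ℤ z ∣ ≤ 1ℚ
∣1/ℤ∣≤1 (+ n)    = ℚP.≤-trans (ℚP.≤-reflexive (ℚP.0≤p⇒∣p∣≡p (0≤1/ℕ n))) (1/ℕ≤1 n)
∣1/ℤ∣≤1 -[1+ n ] = ℚP.≤-trans (ℚP.≤-reflexive (trans (ℚP.∣-p∣≡∣p∣ _) (ℚP.0≤p⇒∣p∣≡p (0≤1/ℕ (suc n))))) (1/ℕ≤1 (suc n))

-- oddProd (suc ν) k = oddProd ν k ℤ.* oddFactor ν k holds by definition.
oddFactor : ℕ → ℕ → ℤ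
oddFactor ν k = + (2 ℕ.* k ℕ.+ 1) ℤ.- + (2 ℕ.* suc ν)

oddFactor≢0 : ∀ ν k → oddFactor ν k ≢ + 0
oddFactor≢0 ν k eq = ℕP.even≢odd (suc ν) k
  (sym (trans (ℕP.+-comm 1 (2 ℕ.* k)) (ℤP.+-injective (ℤP.i-j≡0⇒i≡j _ _ eq))))

oddProd≢0 : ∀ ν k → oddProd ν k ≢ + 0
oddProd≢0 zero    k ()
oddProd≢0 (suc ν) k eq with ℤP.i*j≡0⇒i≡0∨j≡0 (oddProd ν k) eq
... | inj₁ P≡0 = oddProd≢0 ν k P≡0
... | inj₂ Q≡0 = oddFactor≢0 ν k Q≡0

P : ℕ → ℕ → ℚ
P ν k = fromℤ (oddProd ν k)

P⁻¹ : ℕ → ℕ → ℚ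
P⁻¹ ν k = 1/ℤ (oddProd ν k)

Q : ℕ → ℕ → ℚ
Q ν k = fromℕ (suc (2 ℕ.* k)) - fromℕ (2 ℕ.* suc ν)

Q⁻¹ : ℕ → ℕ → ℚ
Q⁻¹ ν k = 1/ℤ (oddFactor ν k)

fromℤ-oddFactor : ∀ ν k → fromℤ (oddFactor ν k) ≡ Q ν k
fromℤ-oddFactor ν k = trans (fromℤ-+ (+ (2 ℕ.* k ℕ.+ 1)) (ℤ.- + (2 ℕ.* suc ν)))
  (cong₂ _+_ (trans (sym (fromℕ≡fromℤ _)) (cong fromℕ (ℕP.+-comm (2 ℕ.* k) 1)))
             (trans (fromℤ-neg _) (cong -_ (sym (fromℕ≡fromℤ _)))))

Q*Q⁻¹≡1 : ∀ ν k → Q ν k * Q⁻¹ ν k ≡ 1ℚ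
Q*Q⁻¹≡1 ν k = trans (cong (_* Q⁻¹ ν k) (sym (fromℤ-oddFactor ν k))) (fromℤ*1/ℤ (oddFactor ν k) (oddFactor≢0 ν k))

P*P⁻¹≡1 : ∀ ν k → P ν k * P⁻¹ ν k ≡ 1ℚ
P*P⁻¹≡1 ν k = fromℤ*1/ℤ (oddProd ν k) (oddProd≢0 ν k)

P-0 : ∀ k → P 0 k ≡ 1ℚ
P-0 k = trans (sym (fromℕ≡fromℤ 1)) fromℕ-1

P⁻¹-0 : ∀ k → P⁻¹ 0 k ≡ 1ℚ
P⁻¹-0 k = inverse-unique {x = P 0 k} (P*P⁻¹≡1 0 k) (trans (cong (_* 1ℚ) (P-0 k)) (ℚP.*-identityˡ 1ℚ))

P-suc : ∀ ν k → P (suc ν) k ≡ P ν k * Q ν k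
P-suc ν k = trans (fromℤ-* (oddProd ν k) (oddFactor ν k)) (cong (P ν k *_) (fromℤ-oddFactor ν k))

*-inverse : ∀ {x x⁻¹ y y⁻¹} → x * x⁻¹ ≡ 1ℚ → y * y⁻¹ ≡ 1ℚ → (x * y) * (x⁻¹ * y⁻¹) ≡ 1ℚ
*-inverse {x} {x⁻¹} {y} {y⁻¹} xx⁻¹≡1 yy⁻¹≡1 = begin
  (x * y) * (x⁻¹ * y⁻¹)     ≡⟨ solve 4 (λ x y a b → (x :* y) :* (a :* b) := (x :* a) :* (y :* b)) refl x y x⁻¹ y⁻¹ ⟩
  (x * x⁻¹) * (y * y⁻¹)     ≡⟨ cong₂ _*_ xx⁻¹≡1 yy⁻¹≡1 ⟩
  1ℚ                        ∎
  where open ≡-Reasoning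

P⁻¹-suc : ∀ ν k → P⁻¹ (suc ν) k ≡ P⁻¹ ν k * Q⁻¹ ν k
P⁻¹-suc ν k = inverse-unique {x = P (suc ν) k} (P*P⁻¹≡1 (suc ν) k)
  (trans (cong (_* (P⁻¹ ν k * Q⁻¹ ν k)) (P-suc ν k)) (*-inverse {P ν k} {P⁻¹ ν k} {Q ν k} {Q⁻¹ ν k} (P*P⁻¹≡1 ν k) (Q*Q⁻¹≡1 ν k)))

Q≡2k-[1+2ν] : ∀ ν k → Q ν k ≡ fromℕ (2 ℕ.* k) - fromℕ (suc (2 ℕ.* ν))
Q≡2k-[1+2ν] ν k = begin
  fromℕ (suc (2 ℕ.* k)) - fromℕ (2 ℕ.* suc ν)              ≡⟨ cong₂ (λ x m → x - fromℕ m) (fromℕ-suc (2 ℕ.* k)) (2*[1+n]≡2+2*n ν) ⟩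
  fromℕ (2 ℕ.* k) + 1ℚ - fromℕ (suc (suc (2 ℕ.* ν)))       ≡⟨ cong (λ x → fromℕ (2 ℕ.* k) + 1ℚ - x) (fromℕ-suc (suc (2 ℕ.* ν))) ⟩
  fromℕ (2 ℕ.* k) + 1ℚ - (fromℕ (suc (2 ℕ.* ν)) + 1ℚ)      ≡⟨ solve 2 (λ x y → x :+ con 1ℚ :- (y :+ con 1ℚ) := x :- y)
                                                               refl (fromℕ (2 ℕ.* k)) (fromℕ (suc (2 ℕ.* ν))) ⟩
  fromℕ (2 ℕ.* k) - fromℕ (suc (2 ℕ.* ν))                  ∎
  where open ≡-Reasoning

Q-suc-suc : ∀ ν k → Q (suc ν) (suc k) ≡ Q ν k
Q-suc-suc ν k = begin
  Q (suc ν) (suc k)                                          ≡⟨ Q≡2k-[1+2ν] (suc ν) (suc k) ⟩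
  fromℕ (2 ℕ.* suc k) - fromℕ (suc (2 ℕ.* suc ν))            ≡⟨ cong₂ (λ m n → fromℕ m - fromℕ (suc n)) (2*[1+n]≡2+2*n k) (2*[1+n]≡2+2*n ν) ⟩
  fromℕ (suc (suc K)) - fromℕ (suc (suc (suc V)))            ≡⟨ cong₂ _-_ (trans (fromℕ-suc (suc K)) (cong (_+ 1ℚ) (fromℕ-suc K)))
                                                                         (trans (fromℕ-suc (suc (suc V))) (cong (_+ 1ℚ) (fromℕ-suc (suc V)))) ⟩
  fromℕ K + 1ℚ + 1ℚ - (fromℕ (suc V) + 1ℚ + 1ℚ)              ≡⟨ solve 2 (λ x y → x :+ con 1ℚ :+ con 1ℚ :- (y :+ con 1ℚ :+ con 1ℚ) := x :- y)
                                                                  refl (fromℕ K) (fromℕ (suc V)) ⟩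
  fromℕ K - fromℕ (suc V)                                    ≡⟨ sym (Q≡2k-[1+2ν] ν k) ⟩
  Q ν k                                                      ∎
  where
  open ≡-Reasoning
  K = 2 ℕ.* k
  V = 2 ℕ.* ν

Q-0-suc : ∀ k → Q 0 (suc k) ≡ fromℕ (suc (2 ℕ.* k))
Q-0-suc k = begin
  Q 0 (suc k)                                  ≡⟨ Q≡2k-[1+2ν] 0 (suc k) ⟩
  fromℕ (2 ℕ.* suc k) - fromℕ 1                ≡⟨ cong₂ (λ m x → fromℕ m - x) (2*[1+n]≡2+2*n k) fromℕ-1 ⟩
  fromℕ (suc (suc (2 ℕ.* k))) - 1ℚ             ≡⟨ cong (_- 1ℚ) (fromℕ-suc (suc (2 ℕ.* k))) ⟩
  fromℕ (suc (2 ℕ.* k)) + 1ℚ - 1ℚ              ≡⟨ solve 1 (λ x → x :+ con 1ℚ :- con 1ℚ := x) refl (fromℕ (suc (2 ℕ.* k))) ⟩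
  fromℕ (suc (2 ℕ.* k))                        ∎
  where open ≡-Reasoning

P-suc-suc : ∀ ν k → P (suc ν) (suc k) ≡ fromℕ (suc (2 ℕ.* k)) * P ν k
P-suc-suc zero k = begin
  P 1 (suc k)                          ≡⟨ P-suc 0 (suc k) ⟩
  P 0 (suc k) * Q 0 (suc k)            ≡⟨ cong₂ _*_ (P-0 (suc k)) (Q-0-suc k) ⟩
  1ℚ * fromℕ (suc (2 ℕ.* k))           ≡⟨ ℚP.*-comm 1ℚ (fromℕ (suc (2 ℕ.* k))) ⟩
  fromℕ (suc (2 ℕ.* k)) * 1ℚ           ≡⟨ cong (fromℕ (suc (2 ℕ.* k)) *_) (sym (P-0 k)) ⟩
  fromℕ (suc (2 ℕ.* k)) * P 0 k        ∎
  where open ≡-Reasoning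
P-suc-suc (suc ν) k = begin
  P (suc (suc ν)) (suc k)                         ≡⟨ P-suc (suc ν) (suc k) ⟩
  P (suc ν) (suc k) * Q (suc ν) (suc k)           ≡⟨ cong₂ _*_ (P-suc-suc ν k) (Q-suc-suc ν k) ⟩
  fromℕ (suc (2 ℕ.* k)) * P ν k * Q ν k           ≡⟨ ℚP.*-assoc (fromℕ (suc (2 ℕ.* k))) (P ν k) (Q ν k) ⟩
  fromℕ (suc (2 ℕ.* k)) * (P ν k * Q ν k)         ≡⟨ cong (fromℕ (suc (2 ℕ.* k)) *_) (sym (P-suc ν k)) ⟩
  fromℕ (suc (2 ℕ.* k)) * P (suc ν) k             ∎
  where open ≡-Reasoning

P⁻¹-suc-suc : ∀ ν k → P⁻¹ (suc ν) (suc k) ≡ 1/ℕ (suc (2 ℕ.* k)) * P⁻¹ ν k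
P⁻¹-suc-suc ν k = inverse-unique {x = P (suc ν) (suc k)} (P*P⁻¹≡1 (suc ν) (suc k))
  (trans (cong (_* (1/ℕ (suc (2 ℕ.* k)) * P⁻¹ ν k)) (P-suc-suc ν k))
    (*-inverse {fromℕ (suc (2 ℕ.* k))} {1/ℕ (suc (2 ℕ.* k))} {P ν k} {P⁻¹ ν k} (fromℕ*1/ℕ-suc (2 ℕ.* k)) (P*P⁻¹≡1 ν k)))

u : ℕ → ℕ → ℚ
u ν k = c k * P⁻¹ ν k

-- A closed form for the partial sums of u (suc ν): U ν n = Σ_{k<n} u (suc ν) k.
U : ℕ → ℕ → ℚ
U ν k = - (fromℕ (2 ℕ.* k) * c k * 1/ℕ (suc (2 ℕ.* ν)) * P⁻¹ (suc ν) k)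

U-suc : ∀ ν k → U ν (suc k) ≡ - (c k * 1/ℕ (suc (2 ℕ.* ν)) * P⁻¹ ν k)
U-suc ν k = cong -_ (begin
  fromℕ (2 ℕ.* suc k) * c (suc k) * iV * P⁻¹ (suc ν) (suc k)
    ≡⟨ cong₂ (λ m x → fromℕ m * c (suc k) * iV * x) (2*[1+n]≡2+2*n k) (P⁻¹-suc-suc ν k) ⟩
  fromℕ (suc (suc (2 ℕ.* k))) * c (suc k) * iV * (1/ℕ (suc (2 ℕ.* k)) * P⁻¹ ν k)
    ≡⟨ cong (λ x → x * iV * (1/ℕ (suc (2 ℕ.* k)) * P⁻¹ ν k)) (trans (ℚP.*-comm _ (c (suc k))) (c-suc k)) ⟩
  c k * fromℕ (suc (2 ℕ.* k)) * iV * (1/ℕ (suc (2 ℕ.* k)) * P⁻¹ ν k)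
    ≡⟨ solve 5 (λ c a v i p → c :* a :* v :* (i :* p) := c :* v :* p :* (a :* i))
         refl (c k) (fromℕ (suc (2 ℕ.* k))) iV (1/ℕ (suc (2 ℕ.* k))) (P⁻¹ ν k) ⟩
  c k * iV * P⁻¹ ν k * (fromℕ (suc (2 ℕ.* k)) * 1/ℕ (suc (2 ℕ.* k)))
    ≡⟨ trans (cong (c k * iV * P⁻¹ ν k *_) (fromℕ*1/ℕ-suc (2 ℕ.* k))) (ℚP.*-identityʳ _) ⟩
  c k * iV * P⁻¹ ν k ∎)
  where
  open ≡-Reasoning
  iV = 1/ℕ (suc (2 ℕ.* ν))

U-0 : ∀ ν → U ν 0 ≡ 0ℚ
U-0 ν = trans (cong (λ x → - (x * 1ℚ * 1/ℕ (suc (2 ℕ.* ν)) * P⁻¹ (suc ν) 0)) fromℕ-0)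
  (cong -_ (solve 2 (λ a b → con 0ℚ :* con 1ℚ :* a :* b := con 0ℚ) refl (1/ℕ (suc (2 ℕ.* ν))) (P⁻¹ (suc ν) 0)))

u-telescoping : ∀ ν k → u (suc ν) k ≡ U ν (suc k) - U ν k
u-telescoping ν k = sym (begin
  U ν (suc k) - U ν k
    ≡⟨ cong (_- U ν k) (U-suc ν k) ⟩
  - (c k * iV * P⁻¹ ν k) - - (K * c k * iV * P⁻¹ (suc ν) k)
    ≡⟨ cong (λ x → - (c k * iV * P⁻¹ ν k) - - (K * c k * iV * x)) (P⁻¹-suc ν k) ⟩
  - (c k * iV * P⁻¹ ν k) - - (K * c k * iV * (P⁻¹ ν k * Q⁻¹ ν k))
    ≡⟨ identity (c k) (P⁻¹ ν k) (Q*Q⁻¹≡1 ν k) (fromℕ*1/ℕ-suc (2 ℕ.* ν)) (Q≡2k-[1+2ν] ν k) ⟩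
  c k * (P⁻¹ ν k * Q⁻¹ ν k)
    ≡⟨ cong (c k *_) (sym (P⁻¹-suc ν k)) ⟩
  u (suc ν) k ∎)
  where
  open ≡-Reasoning
  K = fromℕ (2 ℕ.* k)
  V = fromℕ (suc (2 ℕ.* ν))
  iV = 1/ℕ (suc (2 ℕ.* ν))
  q = Q ν k
  q⁻¹ = Q⁻¹ ν k
  identity : ∀ x p → q * q⁻¹ ≡ 1ℚ → V * iV ≡ 1ℚ → q ≡ K - V →
             - (x * iV * p) - - (K * x * iV * (p * q⁻¹)) ≡ x * (p * q⁻¹)
  identity x p qq⁻¹≡1 ViV≡1 q≡K-V = begin
    - (x * iV * p) - - (K * x * iV * (p * q⁻¹))
      ≡⟨ solve 7 (λ x p q q⁻¹ V iV K → :- (x :* iV :* p) :- :- (K :* x :* iV :* (p :* q⁻¹)) :=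
            x :* p :* q⁻¹ :* (V :* iV) :+ x :* iV :* p :* ((K :- V :- q) :* q⁻¹) :+ x :* iV :* p :* (q :* q⁻¹) :- x :* iV :* p)
           refl x p q q⁻¹ V iV K ⟩
    x * p * q⁻¹ * (V * iV) + x * iV * p * ((K - V - q) * q⁻¹) + x * iV * p * (q * q⁻¹) - x * iV * p
      ≡⟨ cong₂ (λ a b → x * p * q⁻¹ * a + x * iV * p * ((K - V - q) * q⁻¹) + x * iV * p * b - x * iV * p) ViV≡1 qq⁻¹≡1 ⟩
    x * p * q⁻¹ * 1ℚ + x * iV * p * ((K - V - q) * q⁻¹) + x * iV * p * 1ℚ - x * iV * p
      ≡⟨ cong (λ y → x * p * q⁻¹ * 1ℚ + x * iV * p * ((K - V - y) * q⁻¹) + x * iV * p * 1ℚ - x * iV * p) q≡K-V ⟩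
    x * p * q⁻¹ * 1ℚ + x * iV * p * ((K - V - (K - V)) * q⁻¹) + x * iV * p * 1ℚ - x * iV * p
      ≡⟨ solve 5 (λ x p q⁻¹ iV W → x :* p :* q⁻¹ :* con 1ℚ :+ x :* iV :* p :* ((W :- W) :* q⁻¹) :+ x :* iV :* p :* con 1ℚ :- x :* iV :* p
                                   := x :* (p :* q⁻¹))
           refl x p q⁻¹ iV (K - V) ⟩
    x * (p * q⁻¹) ∎

null-∑u : ∀ ν → Null (∑ (u (suc ν)))
null-∑u ν = Null-cong (λ n → sym (∑u≡U n)) (null-suc⁻ (null-dominated ∣U-suc∣≤c c-null))
  where
  iV = 1/ℕ (suc (2 ℕ.* ν))
  ∑u≡U : ∀ n → ∑ (u (suc ν)) n ≡ U ν n
  ∑u≡U n = trans (∑-cong (u-telescoping ν) n) (∑-telescope-0 (U ν) (U-0 ν) n)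
  ∣U-suc∣≤c : ∀ n → ∣ U ν (suc n) ∣ ≤ c n
  ∣U-suc∣≤c n = begin
    ∣ U ν (suc n) ∣                      ≡⟨ cong ∣_∣ (U-suc ν n) ⟩
    ∣ - (c n * iV * P⁻¹ ν n) ∣           ≡⟨ trans (ℚP.∣-p∣≡∣p∣ _) (trans (ℚP.∣p*q∣≡∣p∣*∣q∣ (c n * iV) (P⁻¹ ν n))
                                              (cong (_* ∣ P⁻¹ ν n ∣) (ℚP.0≤p⇒∣p∣≡p (*-nonneg (c-nonneg n) (0≤1/ℕ _))))) ⟩
    c n * iV * ∣ P⁻¹ ν n ∣               ≤⟨ p*q≤p (*-nonneg (c-nonneg n) (0≤1/ℕ _)) (∣1/ℤ∣≤1 (oddProd ν n)) ⟩
    c n * iV                             ≤⟨ p*q≤p (c-nonneg n) (1/ℕ≤1 _) ⟩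
    c n                                  ∎
    where open ℚP.≤-Reasoning

t/P : ℕ → ℕ → ℕ → ℚ
t/P ν a k = c k * 1/ℕ (2 ℕ.* k ℕ.+ a) * P⁻¹ ν k

t/P-0 : ∀ a k → t/P 0 a k ≡ t a k
t/P-0 a k = trans (cong (c k * 1/ℕ (2 ℕ.* k ℕ.+ a) *_) (P⁻¹-0 k)) (ℚP.*-identityʳ _)

-- Partial fractions: (a + 2ν + 1) / ((2k + a)(2k − 2ν − 1)) = 1/(2k − 2ν − 1) − 1/(2k + a).
t/P-suc : ∀ a ν k → fromℕ (suc a ℕ.+ suc (2 ℕ.* ν)) * t/P (suc ν) (suc a) k ≡ u (suc ν) k - t/P ν (suc a) k
t/P-suc a ν k = begin
  fromℕ (suc a ℕ.+ suc (2 ℕ.* ν)) * (c k * iA * P⁻¹ (suc ν) k)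
    ≡⟨ cong₂ (λ x y → x * (c k * iA * y)) A-V≡ (P⁻¹-suc ν k) ⟩
  (A - Q ν k) * (c k * iA * (P⁻¹ ν k * Q⁻¹ ν k))
    ≡⟨ solve 6 (λ c A iA q iq p → (A :- q) :* (c :* iA :* (p :* iq)) := c :* (p :* iq) :* (A :* iA) :- c :* iA :* p :* (q :* iq))
         refl (c k) A iA (Q ν k) (Q⁻¹ ν k) (P⁻¹ ν k) ⟩
  c k * (P⁻¹ ν k * Q⁻¹ ν k) * (A * iA) - c k * iA * P⁻¹ ν k * (Q ν k * Q⁻¹ ν k)
    ≡⟨ cong₂ (λ x y → c k * (P⁻¹ ν k * Q⁻¹ ν k) * x - c k * iA * P⁻¹ ν k * y) (fromℕ*1/ℕ-+suc (2 ℕ.* k) a) (Q*Q⁻¹≡1 ν k) ⟩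
  c k * (P⁻¹ ν k * Q⁻¹ ν k) * 1ℚ - c k * iA * P⁻¹ ν k * 1ℚ
    ≡⟨ cong₂ _-_ (ℚP.*-identityʳ (c k * (P⁻¹ ν k * Q⁻¹ ν k))) (ℚP.*-identityʳ (c k * iA * P⁻¹ ν k)) ⟩
  c k * (P⁻¹ ν k * Q⁻¹ ν k) - c k * iA * P⁻¹ ν k
    ≡⟨ cong (λ x → c k * x - c k * iA * P⁻¹ ν k) (sym (P⁻¹-suc ν k)) ⟩
  u (suc ν) k - t/P ν (suc a) k ∎
  where
  open ≡-Reasoning
  A = fromℕ (2 ℕ.* k ℕ.+ suc a)
  iA = 1/ℕ (2 ℕ.* k ℕ.+ suc a)
  A-V≡ : fromℕ (suc a ℕ.+ suc (2 ℕ.* ν)) ≡ A - Q ν k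
  A-V≡ = begin
    fromℕ (suc a ℕ.+ suc (2 ℕ.* ν))                                 ≡⟨ fromℕ-+ (suc a) _ ⟩
    fromℕ (suc a) + fromℕ (suc (2 ℕ.* ν))                           ≡⟨ solve 3 (λ a v k → a :+ v := (k :+ a) :- (k :- v))
                                                                        refl (fromℕ (suc a)) (fromℕ (suc (2 ℕ.* ν))) (fromℕ (2 ℕ.* k)) ⟩
    (fromℕ (2 ℕ.* k) + fromℕ (suc a)) - (fromℕ (2 ℕ.* k) - fromℕ (suc (2 ℕ.* ν)))
                                                                    ≡⟨ cong₂ _-_ (sym (fromℕ-+ (2 ℕ.* k) (suc a))) (sym (Q≡2k-[1+2ν] ν k)) ⟩
    A - Q ν k                                                       ∎

-- L ν are the limits; they obey the recursion of the series (t/P-suc) with the null sums ∑ u dropped.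
∑t/P-L→0 : ∀ a (L : ℕ → ℕ → ℚ) → Null (λ n → T (suc a) n - L 0 n) →
           (∀ ν n → fromℕ (suc a ℕ.+ suc (2 ℕ.* ν)) * L (suc ν) n ≡ - L ν n) →
           ∀ ν → Null (λ n → ∑ (t/P ν (suc a)) n - L ν n)
∑t/P-L→0 a L base L-suc zero    = Null-cong (λ n → cong (_- L 0 n) (sym (∑-cong (t/P-0 (suc a)) n))) base
∑t/P-L→0 a L base L-suc (suc ν) = Null-cong (λ n → sym (by-recurrence n))
  (null-*ˡ S⁻¹ (null-sub (null-∑u ν) (∑t/P-L→0 a L base L-suc ν)))
  where
  S = fromℕ (suc a ℕ.+ suc (2 ℕ.* ν))
  S⁻¹ = 1/ℕ (suc a ℕ.+ suc (2 ℕ.* ν))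
  by-recurrence : ∀ n → ∑ (t/P (suc ν) (suc a)) n - L (suc ν) n ≡ S⁻¹ * (∑ (u (suc ν)) n - (∑ (t/P ν (suc a)) n - L ν n))
  by-recurrence n = *-solveˡ S S⁻¹ (1/ℕ*fromℕ-suc (a ℕ.+ suc (2 ℕ.* ν))) (begin
    S * (∑ (t/P (suc ν) (suc a)) n - L (suc ν) n)
      ≡⟨ solve 3 (λ s x l → s :* (x :- l) := s :* x :- s :* l) refl S (∑ (t/P (suc ν) (suc a)) n) (L (suc ν) n) ⟩
    S * ∑ (t/P (suc ν) (suc a)) n - S * L (suc ν) n
      ≡⟨ cong₂ _-_ (trans (sym (∑-*ˡ S (t/P (suc ν) (suc a)) n)) (trans (∑-cong (t/P-suc a ν) n) (∑-sub (u (suc ν)) (t/P ν (suc a)) n)))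
                   (L-suc ν n) ⟩
    ∑ (u (suc ν)) n - ∑ (t/P ν (suc a)) n - - L ν n
      ≡⟨ solve 3 (λ x y l → x :- y :- :- l := x :- (y :- l)) refl (∑ (u (suc ν)) n) (∑ (t/P ν (suc a)) n) (L ν n) ⟩
    ∑ (u (suc ν)) n - (∑ (t/P ν (suc a)) n - L ν n) ∎)
    where open ≡-Reasoning

-- The Euler transform of the Leibniz series

½^ : ℕ → ℚ
½^ zero    = 1ℚ
½^ (suc n) = ½^ n * ½

½^-nonneg : ∀ n → 0ℚ ≤ ½^ n
½^-nonneg zero    = 0≤1
½^-nonneg (suc n) = *-nonneg (½^-nonneg n) 0≤½

sgnℚ : ℕ → ℚ
sgnℚ zero    = 1ℚ
sgnℚ (suc n) = - sgnℚ n

leibniz : ℕ → ℚ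
leibniz = ∑ (λ i → sgnℚ i * 1/ℕ (suc (2 ℕ.* i)))

euler : ℕ → ℚ
euler = ∑ (λ j → ½^ j * α j)

-- The error of the Euler transform: euler N − 2 leibniz N = − D 0 N (euler-2leibniz≡-D).
D : ℕ → ℕ → ℚ
D r zero    = 0ℚ
D r (suc N) = ½^ N * β N r - D (suc r) N

D+D-suc : ∀ N r → D r N + D (suc r) N ≡ fromℕ 2 * ½^ N * β N r - fromℕ 2 * sgnℚ N * 1/ℕ (suc (2 ℕ.* N ℕ.+ 2 ℕ.* r))
D+D-suc zero r = sym (solve 2 (λ t i → t :* con 1ℚ :* i :- t :* con 1ℚ :* i := con 0ℚ) refl (fromℕ 2) (1/ℕ (suc (2 ℕ.* r))))
D+D-suc (suc N) r = begin
  (h * b - X) + (h * b′ - Y)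
    ≡⟨ solve 5 (λ h b b′ X Y → (h :* b :- X) :+ (h :* b′ :- Y) := h :* b :+ h :* b′ :- (X :+ Y)) refl h b b′ X Y ⟩
  h * b + h * b′ - (X + Y)
    ≡⟨ cong (λ y → h * b + h * b′ - y) (D+D-suc N (suc r)) ⟩
  h * b + h * b′ - (two * h * b′ - two * s * i′)
    ≡⟨ cong (λ x → h * b + h * b′ - (x * h * b′ - x * s * i′)) fromℕ-2≡1+1 ⟩
  h * b + h * b′ - ((1ℚ + 1ℚ) * h * b′ - (1ℚ + 1ℚ) * s * i′)
    ≡⟨ solve 5 (λ h b b′ s i → h :* b :+ h :* b′ :- ((con 1ℚ :+ con 1ℚ) :* h :* b′ :- (con 1ℚ :+ con 1ℚ) :* s :* i)
                             := (con 1ℚ :+ con 1ℚ) :* (h :* con ½) :* (b :- b′) :- (con 1ℚ :+ con 1ℚ) :* (:- s) :* i)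
         refl h b b′ s i′ ⟩
  (1ℚ + 1ℚ) * (h * ½) * (b - b′) - (1ℚ + 1ℚ) * (- s) * i′
    ≡⟨ cong₂ (λ x y → x * (h * ½) * y - x * (- s) * i′) (sym fromℕ-2≡1+1) (β-difference N r) ⟩
  two * ½^ (suc N) * β (suc N) r - two * sgnℚ (suc N) * i′
    ≡⟨ cong (λ m → two * ½^ (suc N) * β (suc N) r - two * sgnℚ (suc N) * 1/ℕ (suc m)) (2N+2[1+r]≡2[1+N]+2r N r) ⟩
  two * ½^ (suc N) * β (suc N) r - two * sgnℚ (suc N) * 1/ℕ (suc (2 ℕ.* suc N ℕ.+ 2 ℕ.* r)) ∎
  where
  open ≡-Reasoning
  two = fromℕ 2
  h = ½^ N
  b = β N r
  b′ = β N (suc r)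
  X = D (suc r) N
  Y = D (suc (suc r)) N
  s = sgnℚ N
  i′ = 1/ℕ (suc (2 ℕ.* N ℕ.+ 2 ℕ.* suc r))
  2N+2[1+r]≡2[1+N]+2r : ∀ N r → 2 ℕ.* N ℕ.+ 2 ℕ.* suc r ≡ 2 ℕ.* suc N ℕ.+ 2 ℕ.* r
  2N+2[1+r]≡2[1+N]+2r = solve-∀

euler-2leibniz≡-D : ∀ N → euler N - fromℕ 2 * leibniz N ≡ - D 0 N
euler-2leibniz≡-D zero    = solve 1 (λ t → con 0ℚ :- t :* con 0ℚ := :- con 0ℚ) refl (fromℕ 2)
euler-2leibniz≡-D (suc N) = begin
  (euler N + h * a) - two * (leibniz N + s * i)
    ≡⟨ solve 6 (λ E h a t L x → E :+ h :* a :- t :* (L :+ x) := (E :- t :* L) :+ h :* a :- t :* x) refl (euler N) h a two (leibniz N) (s * i) ⟩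
  (euler N - two * leibniz N) + h * a - two * (s * i)
    ≡⟨ cong₂ (λ x y → x + h * a - y) (euler-2leibniz≡-D N) 2si≡2ha-[D₀+D₁] ⟩
  - D₀ + h * a - (two * h * a - (D₀ + D₁))
    ≡⟨ cong (λ x → - D₀ + h * a - (x * h * a - (D₀ + D₁))) fromℕ-2≡1+1 ⟩
  - D₀ + h * a - ((1ℚ + 1ℚ) * h * a - (D₀ + D₁))
    ≡⟨ solve 4 (λ h a D₀ D₁ → :- D₀ :+ h :* a :- ((con 1ℚ :+ con 1ℚ) :* h :* a :- (D₀ :+ D₁)) := :- (h :* a :- D₁)) refl h a D₀ D₁ ⟩
  - (h * a - D₁) ∎
  where
  open ≡-Reasoning
  two = fromℕ 2
  h = ½^ N
  a = α N
  s = sgnℚ N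
  i = 1/ℕ (suc (2 ℕ.* N))
  D₀ = D 0 N
  D₁ = D 1 N
  2si≡2ha-[D₀+D₁] : two * (s * i) ≡ two * h * a - (D₀ + D₁)
  2si≡2ha-[D₀+D₁] = begin
    two * (s * i)                                 ≡⟨ solve 4 (λ t s i x → t :* (s :* i) := x :- (x :- t :* s :* i)) refl two s i (two * h * a) ⟩
    two * h * a - (two * h * a - two * s * i)     ≡⟨ cong (λ m → two * h * a - (two * h * a - two * s * 1/ℕ (suc m))) (sym (ℕP.+-identityʳ (2 ℕ.* N))) ⟩
    two * h * a - (two * h * a - two * s * 1/ℕ (suc (2 ℕ.* N ℕ.+ 0)))
                                                  ≡⟨ cong (λ x → two * h * a - x) (sym (D+D-suc N 0)) ⟩
    two * h * a - (D₀ + D₁)                       ∎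

Dbound : ℕ → ℕ → ℚ
Dbound r zero    = 0ℚ
Dbound r (suc N) = ½^ N * 1/ℕ (suc (2 ℕ.* r)) + Dbound (suc r) N

∣D∣≤Dbound : ∀ N r → ∣ D r N ∣ ≤ Dbound r N
∣D∣≤Dbound zero    r = ℚP.≤-refl
∣D∣≤Dbound (suc N) r = ℚP.≤-trans (ℚP.∣p-q∣≤∣p∣+∣q∣ (½^ N * β N r) (D (suc r) N))
  (ℚP.+-mono-≤ (ℚP.≤-trans (ℚP.≤-reflexive (ℚP.0≤p⇒∣p∣≡p (*-nonneg (½^-nonneg N) (β-nonneg N r))))
                           (*-monoˡ-≤-nonneg (½^-nonneg N) (β≤1/ℕ[1+2r] N r)))
               (∣D∣≤Dbound N (suc r)))

∑[j+1]½^j : ℕ → ℚ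
∑[j+1]½^j zero    = 0ℚ
∑[j+1]½^j (suc N) = ∑[j+1]½^j N + fromℕ (suc N) * ½^ N

Dbound*[N+r]≤∑[j+1]½^j : ∀ N r → Dbound r N * fromℕ (N ℕ.+ r) ≤ ∑[j+1]½^j N
Dbound*[N+r]≤∑[j+1]½^j zero    r = ℚP.≤-reflexive (ℚP.*-zeroˡ (fromℕ r))
Dbound*[N+r]≤∑[j+1]½^j (suc N) r = begin
  (h * i + Dbound (suc r) N) * fromℕ (suc N ℕ.+ r)
    ≡⟨ solve 4 (λ h i B x → (h :* i :+ B) :* x := h :* (i :* x) :+ B :* x) refl h i (Dbound (suc r) N) (fromℕ (suc N ℕ.+ r)) ⟩
  h * (i * fromℕ (suc N ℕ.+ r)) + Dbound (suc r) N * fromℕ (suc N ℕ.+ r)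
    ≡⟨ cong (λ m → h * (i * fromℕ (suc N ℕ.+ r)) + Dbound (suc r) N * fromℕ m) (sym (ℕP.+-suc N r)) ⟩
  h * (i * fromℕ (suc N ℕ.+ r)) + Dbound (suc r) N * fromℕ (N ℕ.+ suc r)
    ≤⟨ ℚP.+-mono-≤ (*-monoˡ-≤-nonneg (½^-nonneg N) [1+N+r]/[1+2r]≤1+N) (Dbound*[N+r]≤∑[j+1]½^j N (suc r)) ⟩
  h * fromℕ (suc N) + ∑[j+1]½^j N
    ≡⟨ solve 3 (λ h n w → h :* n :+ w := w :+ n :* h) refl h (fromℕ (suc N)) (∑[j+1]½^j N) ⟩
  ∑[j+1]½^j (suc N) ∎
  where
  open ℚP.≤-Reasoning
  h = ½^ N
  i = 1/ℕ (suc (2 ℕ.* r))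
  1+N+r≤[1+N][1+2r] : ∀ N r → suc N ℕ.+ r ℕ.≤ suc N ℕ.* suc (2 ℕ.* r)
  1+N+r≤[1+N][1+2r] N r = subst (suc N ℕ.+ r ℕ.≤_) (sym (eq N r)) (ℕP.m≤m+n (suc N ℕ.+ r) _)
    where
    eq : ∀ N r → suc N ℕ.* suc (2 ℕ.* r) ≡ (suc N ℕ.+ r) ℕ.+ (r ℕ.+ N ℕ.* (2 ℕ.* r))
    eq = solve-∀
  [1+N+r]/[1+2r]≤1+N : i * fromℕ (suc N ℕ.+ r) ≤ fromℕ (suc N)
  [1+N+r]/[1+2r]≤1+N = begin
    i * fromℕ (suc N ℕ.+ r)                          ≤⟨ *-monoˡ-≤-nonneg (0≤1/ℕ _) (fromℕ-mono-≤ (1+N+r≤[1+N][1+2r] N r)) ⟩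
    i * fromℕ (suc N ℕ.* suc (2 ℕ.* r))              ≡⟨ cong (i *_) (fromℕ-* (suc N) (suc (2 ℕ.* r))) ⟩
    i * (fromℕ (suc N) * fromℕ (suc (2 ℕ.* r)))      ≡⟨ solve 3 (λ i a b → i :* (a :* b) := a :* (b :* i)) refl i (fromℕ (suc N)) (fromℕ (suc (2 ℕ.* r))) ⟩
    fromℕ (suc N) * (fromℕ (suc (2 ℕ.* r)) * i)      ≡⟨ trans (cong (fromℕ (suc N) *_) (fromℕ*1/ℕ-suc (2 ℕ.* r))) (ℚP.*-identityʳ _) ⟩
    fromℕ (suc N)                                    ∎

∑[j+1]½^j+2[N+2]½^N≡4 : ∀ N → ∑[j+1]½^j N + fromℕ 2 * fromℕ (suc (suc N)) * ½^ N ≡ fromℕ 4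
∑[j+1]½^j+2[N+2]½^N≡4 zero    = trans (ℚP.+-identityˡ _) (trans (ℚP.*-identityʳ _) (sym (fromℕ-* 2 2)))
∑[j+1]½^j+2[N+2]½^N≡4 (suc N) = begin
  W + fromℕ (suc N) * h + fromℕ 2 * fromℕ (suc (suc (suc N))) * (h * ½)
    ≡⟨ cong₂ (λ x y → W + x * h + fromℕ 2 * y * (h * ½)) (fromℕ-suc N)
         (trans (fromℕ-suc _) (cong (_+ 1ℚ) (trans (fromℕ-suc _) (cong (_+ 1ℚ) (fromℕ-suc N))))) ⟩
  W + (n + 1ℚ) * h + fromℕ 2 * (n + 1ℚ + 1ℚ + 1ℚ) * (h * ½)
    ≡⟨ cong (λ x → W + (n + 1ℚ) * h + x * (n + 1ℚ + 1ℚ + 1ℚ) * (h * ½)) fromℕ-2≡1+1 ⟩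
  W + (n + 1ℚ) * h + (1ℚ + 1ℚ) * (n + 1ℚ + 1ℚ + 1ℚ) * (h * ½)
    ≡⟨ solve 3 (λ w n h → w :+ (n :+ con 1ℚ) :* h :+ (con 1ℚ :+ con 1ℚ) :* (n :+ con 1ℚ :+ con 1ℚ :+ con 1ℚ) :* (h :* con ½)
                        := w :+ (con 1ℚ :+ con 1ℚ) :* (n :+ con 1ℚ :+ con 1ℚ) :* h) refl W n h ⟩
  W + (1ℚ + 1ℚ) * (n + 1ℚ + 1ℚ) * h
    ≡⟨ cong₂ (λ x y → W + x * y * h) (sym fromℕ-2≡1+1) (sym (trans (fromℕ-suc _) (cong (_+ 1ℚ) (fromℕ-suc N)))) ⟩
  W + fromℕ 2 * fromℕ (suc (suc N)) * h
    ≡⟨ ∑[j+1]½^j+2[N+2]½^N≡4 N ⟩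
  fromℕ 4 ∎
  where
  open ≡-Reasoning
  W = ∑[j+1]½^j N
  h = ½^ N
  n = fromℕ N

∑[j+1]½^j≤4 : ∀ N → ∑[j+1]½^j N ≤ fromℕ 4
∑[j+1]½^j≤4 N = subst (∑[j+1]½^j N ≤_) (∑[j+1]½^j+2[N+2]½^N≡4 N)
  (subst (_≤ ∑[j+1]½^j N + fromℕ 2 * fromℕ (suc (suc N)) * ½^ N) (ℚP.+-identityʳ (∑[j+1]½^j N))
    (ℚP.+-monoʳ-≤ (∑[j+1]½^j N) (*-nonneg (*-nonneg (0≤fromℕ 2) (0≤fromℕ _)) (½^-nonneg N))))

Dbound≤4/[N+1] : ∀ N → Dbound 0 (suc N) ≤ fromℕ 4 * 1/ℕ (suc N)
Dbound≤4/[N+1] N = begin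
  Dbound 0 (suc N)                                ≡⟨ sym (trans (ℚP.*-assoc (Dbound 0 (suc N)) _ _)
                                                       (trans (cong (Dbound 0 (suc N) *_) (fromℕ*1/ℕ-suc N)) (ℚP.*-identityʳ _))) ⟩
  Dbound 0 (suc N) * fromℕ (suc N) * 1/ℕ (suc N)     ≡⟨ cong (λ m → Dbound 0 (suc N) * fromℕ m * 1/ℕ (suc N)) (sym (ℕP.+-identityʳ (suc N))) ⟩
  Dbound 0 (suc N) * fromℕ (suc N ℕ.+ 0) * 1/ℕ (suc N) ≤⟨ *-monoʳ-≤-nonneg (0≤1/ℕ _)
                                                          (ℚP.≤-trans (Dbound*[N+r]≤∑[j+1]½^j (suc N) 0) (∑[j+1]½^j≤4 (suc N))) ⟩
  fromℕ 4 * 1/ℕ (suc N)                           ∎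
  where open ℚP.≤-Reasoning

euler-2leibniz→0 : Null (λ N → euler N - fromℕ 2 * leibniz N)
euler-2leibniz→0 = Null-cong (λ N → sym (euler-2leibniz≡-D N))
  (null-neg (null-suc⁻ (null-dominated (λ N → ℚP.≤-trans (∣D∣≤Dbound (suc N) 0) (Dbound≤4/[N+1] N))
                                       (null-*ˡ (fromℕ 4) null-1/ℕ-suc))))

-- Binomial identities

[1+k]*nC[1+k]+k*nCk≡n*nCk : ∀ n k → suc k ℕ.* (n C suc k) ℕ.+ k ℕ.* (n C k) ≡ n ℕ.* (n C k)
[1+k]*nC[1+k]+k*nCk≡n*nCk zero    zero    = refl
[1+k]*nC[1+k]+k*nCk≡n*nCk zero    (suc k) rewrite k>n⇒nCk≡0 {0} {suc (suc k)} (s≤s z≤n) | k>n⇒nCk≡0 {0} {suc k} (s≤s z≤n) =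
  cong₂ ℕ._+_ (ℕP.*-zeroʳ (suc (suc k))) (ℕP.*-zeroʳ (suc k))
[1+k]*nC[1+k]+k*nCk≡n*nCk (suc n) zero    rewrite nC1≡n (suc n) = unit-laws n
  where
  unit-laws : ∀ n → 1 ℕ.* suc n ℕ.+ 0 ≡ suc n ℕ.* 1
  unit-laws = solve-∀
[1+k]*nC[1+k]+k*nCk≡n*nCk (suc n) (suc k)
  rewrite sym (nCk+nC[k+1]≡[n+1]C[k+1] n (suc k)) | sym (nCk+nC[k+1]≡[n+1]C[k+1] n k) = begin
  (2 ℕ.+ k) ℕ.* (y ℕ.+ z) ℕ.+ suc k ℕ.* (x ℕ.+ y)
    ≡⟨ regroup₁ k x y z ⟩
  ((2 ℕ.+ k) ℕ.* z ℕ.+ suc k ℕ.* y) ℕ.+ ((2 ℕ.+ k) ℕ.* y ℕ.+ suc k ℕ.* x)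
    ≡⟨ cong (ℕ._+ ((2 ℕ.+ k) ℕ.* y ℕ.+ suc k ℕ.* x)) ([1+k]*nC[1+k]+k*nCk≡n*nCk n (suc k)) ⟩
  n ℕ.* y ℕ.+ ((2 ℕ.+ k) ℕ.* y ℕ.+ suc k ℕ.* x)
    ≡⟨ regroup₂ n k x y ⟩
  (suc k ℕ.* y ℕ.+ k ℕ.* x) ℕ.+ n ℕ.* y ℕ.+ x ℕ.+ y
    ≡⟨ cong (λ m → m ℕ.+ n ℕ.* y ℕ.+ x ℕ.+ y) ([1+k]*nC[1+k]+k*nCk≡n*nCk n k) ⟩
  n ℕ.* x ℕ.+ n ℕ.* y ℕ.+ x ℕ.+ y
    ≡⟨ regroup₃ n x y ⟩
  suc n ℕ.* (x ℕ.+ y) ∎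
  where
  open ≡-Reasoning
  x = n C k
  y = n C suc k
  z = n C suc (suc k)
  regroup₁ : ∀ k x y z → (2 ℕ.+ k) ℕ.* (y ℕ.+ z) ℕ.+ suc k ℕ.* (x ℕ.+ y)
                       ≡ ((2 ℕ.+ k) ℕ.* z ℕ.+ suc k ℕ.* y) ℕ.+ ((2 ℕ.+ k) ℕ.* y ℕ.+ suc k ℕ.* x)
  regroup₁ = solve-∀
  regroup₂ : ∀ n k x y → n ℕ.* y ℕ.+ ((2 ℕ.+ k) ℕ.* y ℕ.+ suc k ℕ.* x) ≡ (suc k ℕ.* y ℕ.+ k ℕ.* x) ℕ.+ n ℕ.* y ℕ.+ x ℕ.+ y
  regroup₂ = solve-∀
  regroup₃ : ∀ n x y → n ℕ.* x ℕ.+ n ℕ.* y ℕ.+ x ℕ.+ y ≡ suc n ℕ.* (x ℕ.+ y)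
  regroup₃ = solve-∀

[1+k]*[1+n]C[1+k]≡[1+n]*nCk : ∀ n k → suc k ℕ.* (suc n C suc k) ≡ suc n ℕ.* (n C k)
[1+k]*[1+n]C[1+k]≡[1+n]*nCk n k = begin
  suc k ℕ.* (suc n C suc k)                    ≡⟨ cong (suc k ℕ.*_) (sym (nCk+nC[k+1]≡[n+1]C[k+1] n k)) ⟩
  suc k ℕ.* (x ℕ.+ y)                          ≡⟨ regroup k x y ⟩
  x ℕ.+ (suc k ℕ.* y ℕ.+ k ℕ.* x)              ≡⟨ cong (x ℕ.+_) ([1+k]*nC[1+k]+k*nCk≡n*nCk n k) ⟩
  x ℕ.+ n ℕ.* x                                ∎
  where
  open ≡-Reasoning
  x = n C k
  y = n C suc k
  regroup : ∀ k x y → suc k ℕ.* (x ℕ.+ y) ≡ x ℕ.+ (suc k ℕ.* y ℕ.+ k ℕ.* x)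
  regroup = solve-∀

C≤ : ℕ → ℕ → ℕ
C≤ N zero    = 1
C≤ N (suc r) = C≤ N r ℕ.+ N C suc r

C≤-0 : ∀ r → C≤ 0 r ≡ 1
C≤-0 zero    = refl
C≤-0 (suc r) rewrite k>n⇒nCk≡0 {0} {suc r} (s≤s z≤n) = trans (ℕP.+-identityʳ (C≤ 0 r)) (C≤-0 r)

C≤-suc : ∀ N r → C≤ (suc N) (suc r) ≡ C≤ N (suc r) ℕ.+ C≤ N r
C≤-suc N zero    = cong suc (trans (sym (nCk+nC[k+1]≡[n+1]C[k+1] N 0)) (ℕP.+-comm 1 (N C 1)))
C≤-suc N (suc r) = begin
  C≤ (suc N) (suc r) ℕ.+ suc N C suc (suc r)
    ≡⟨ cong₂ ℕ._+_ (C≤-suc N r) (sym (nCk+nC[k+1]≡[n+1]C[k+1] N (suc r))) ⟩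
  (C≤ N (suc r) ℕ.+ C≤ N r) ℕ.+ (N C suc r ℕ.+ N C suc (suc r))
    ≡⟨ regroup (C≤ N (suc r)) (C≤ N r) (N C suc r) (N C suc (suc r)) ⟩
  (C≤ N (suc r) ℕ.+ N C suc (suc r)) ℕ.+ (C≤ N r ℕ.+ N C suc r) ∎
  where
  open ≡-Reasoning
  regroup : ∀ a b x y → (a ℕ.+ b) ℕ.+ (x ℕ.+ y) ≡ (a ℕ.+ y) ℕ.+ (b ℕ.+ x)
  regroup = solve-∀

NCr+C≤[1+N]r≡2*C≤Nr : ∀ N r → N C r ℕ.+ C≤ (suc N) r ≡ 2 ℕ.* C≤ N r
NCr+C≤[1+N]r≡2*C≤Nr N zero    = refl
NCr+C≤[1+N]r≡2*C≤Nr N (suc r) = begin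
  N C suc r ℕ.+ C≤ (suc N) (suc r)               ≡⟨ cong (N C suc r ℕ.+_) (C≤-suc N r) ⟩
  N C suc r ℕ.+ (C≤ N (suc r) ℕ.+ C≤ N r)         ≡⟨ regroup (N C suc r) (C≤ N r) ⟩
  2 ℕ.* C≤ N (suc r)                             ∎
  where
  open ≡-Reasoning
  regroup : ∀ x a → x ℕ.+ ((a ℕ.+ x) ℕ.+ a) ≡ 2 ℕ.* (a ℕ.+ x)
  regroup = solve-∀

2^N*C≤≤2^r*3^N : ∀ N r → 2 ^ N ℕ.* C≤ N r ℕ.≤ 2 ^ r ℕ.* 3 ^ N
2^N*C≤≤2^r*3^N zero    r = subst (ℕ._≤ 2 ^ r ℕ.* 1) (sym (cong (1 ℕ.*_) (C≤-0 r))) (ℕP.*-monoˡ-≤ 1 (ℕP.m^n>0 2 r))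
2^N*C≤≤2^r*3^N (suc N) zero    = subst₂ ℕ._≤_ (sym (ℕP.*-identityʳ _)) (sym (ℕP.*-identityˡ _)) (ℕP.^-monoˡ-≤ (suc N) (s≤s (s≤s z≤n)))
2^N*C≤≤2^r*3^N (suc N) (suc r) = begin
  2 ℕ.* 2 ^ N ℕ.* C≤ (suc N) (suc r)                       ≡⟨ cong (2 ℕ.* 2 ^ N ℕ.*_) (C≤-suc N r) ⟩
  2 ℕ.* 2 ^ N ℕ.* (C≤ N (suc r) ℕ.+ C≤ N r)                 ≡⟨ distrib (2 ^ N) (C≤ N (suc r)) (C≤ N r) ⟩
  2 ℕ.* (2 ^ N ℕ.* C≤ N (suc r)) ℕ.+ 2 ℕ.* (2 ^ N ℕ.* C≤ N r)
    ≤⟨ ℕP.+-mono-≤ (ℕP.*-monoʳ-≤ 2 (2^N*C≤≤2^r*3^N N (suc r))) (ℕP.*-monoʳ-≤ 2 (2^N*C≤≤2^r*3^N N r)) ⟩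
  2 ℕ.* (2 ℕ.* 2 ^ r ℕ.* 3 ^ N) ℕ.+ 2 ℕ.* (2 ^ r ℕ.* 3 ^ N) ≡⟨ collect (2 ^ r) (3 ^ N) ⟩
  2 ℕ.* 2 ^ r ℕ.* (3 ℕ.* 3 ^ N)                             ∎
  where
  open ℕP.≤-Reasoning
  distrib : ∀ p a b → 2 ℕ.* p ℕ.* (a ℕ.+ b) ≡ 2 ℕ.* (p ℕ.* a) ℕ.+ 2 ℕ.* (p ℕ.* b)
  distrib = solve-∀
  collect : ∀ p q → 2 ℕ.* (2 ℕ.* p ℕ.* q) ℕ.+ 2 ℕ.* (p ℕ.* q) ≡ 2 ℕ.* p ℕ.* (3 ℕ.* q)
  collect = solve-∀

[N+3]*3^N≤3*4^N : ∀ N → (N ℕ.+ 3) ℕ.* 3 ^ N ℕ.≤ 3 ℕ.* 4 ^ N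
[N+3]*3^N≤3*4^N zero    = ℕP.≤-refl
[N+3]*3^N≤3*4^N (suc N) = begin
  (suc N ℕ.+ 3) ℕ.* (3 ℕ.* 3 ^ N)                ≡⟨ expand N (3 ^ N) ⟩
  3 ℕ.* ((N ℕ.+ 3) ℕ.* 3 ^ N) ℕ.+ 3 ℕ.* 3 ^ N     ≤⟨ ℕP.+-mono-≤ (ℕP.*-monoʳ-≤ 3 ([N+3]*3^N≤3*4^N N))
                                                                (ℕP.*-monoʳ-≤ 3 (ℕP.^-monoˡ-≤ N (s≤s (s≤s (s≤s z≤n))))) ⟩
  3 ℕ.* (3 ℕ.* 4 ^ N) ℕ.+ 3 ℕ.* 4 ^ N             ≡⟨ collect (4 ^ N) ⟩
  3 ℕ.* (4 ℕ.* 4 ^ N)                            ∎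
  where
  open ℕP.≤-Reasoning
  expand : ∀ n p → (suc n ℕ.+ 3) ℕ.* (3 ℕ.* p) ≡ 3 ℕ.* ((n ℕ.+ 3) ℕ.* p) ℕ.+ 3 ℕ.* p
  expand = solve-∀
  collect : ∀ p → 3 ℕ.* (3 ℕ.* p) ℕ.+ 3 ℕ.* p ≡ 3 ℕ.* (4 ℕ.* p)
  collect = solve-∀

4^N≡2^N*2^N : ∀ N → 4 ^ N ≡ 2 ^ N ℕ.* 2 ^ N
4^N≡2^N*2^N zero    = refl
4^N≡2^N*2^N (suc N) = trans (cong (4 ℕ.*_) (4^N≡2^N*2^N N)) (regroup (2 ^ N))
  where
  regroup : ∀ p → 4 ℕ.* (p ℕ.* p) ≡ (2 ℕ.* p) ℕ.* (2 ℕ.* p)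
  regroup = solve-∀

-- Hence C≤ N r / 2^N = O(2^r / N): the binomial prefix sums are a vanishing fraction of 2^N.
C≤*[N+3]≤3*2^r*2^N : ∀ N r → C≤ N r ℕ.* (N ℕ.+ 3) ℕ.≤ 3 ℕ.* 2 ^ r ℕ.* 2 ^ N
C≤*[N+3]≤3*2^r*2^N N r = ℕP.*-cancelˡ-≤ (2 ^ N) {{ℕP.m^n≢0 2 N}} (begin
  2 ^ N ℕ.* (C≤ N r ℕ.* (N ℕ.+ 3))          ≡⟨ sym (ℕP.*-assoc (2 ^ N) (C≤ N r) (N ℕ.+ 3)) ⟩
  2 ^ N ℕ.* C≤ N r ℕ.* (N ℕ.+ 3)            ≤⟨ ℕP.*-monoˡ-≤ (N ℕ.+ 3) (2^N*C≤≤2^r*3^N N r) ⟩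
  2 ^ r ℕ.* 3 ^ N ℕ.* (N ℕ.+ 3)             ≡⟨ ℕP.*-assoc (2 ^ r) (3 ^ N) (N ℕ.+ 3) ⟩
  2 ^ r ℕ.* (3 ^ N ℕ.* (N ℕ.+ 3))           ≡⟨ cong (2 ^ r ℕ.*_) (ℕP.*-comm (3 ^ N) (N ℕ.+ 3)) ⟩
  2 ^ r ℕ.* ((N ℕ.+ 3) ℕ.* 3 ^ N)           ≤⟨ ℕP.*-monoʳ-≤ (2 ^ r) ([N+3]*3^N≤3*4^N N) ⟩
  2 ^ r ℕ.* (3 ℕ.* 4 ^ N)                   ≡⟨ cong (λ m → 2 ^ r ℕ.* (3 ℕ.* m)) (4^N≡2^N*2^N N) ⟩
  2 ^ r ℕ.* (3 ℕ.* (2 ^ N ℕ.* 2 ^ N))       ≡⟨ regroup (2 ^ r) (2 ^ N) ⟩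
  2 ^ N ℕ.* (3 ℕ.* 2 ^ r ℕ.* 2 ^ N)         ∎)
  where
  open ℕP.≤-Reasoning
  regroup : ∀ a b → a ℕ.* (3 ℕ.* (b ℕ.* b)) ≡ b ℕ.* (3 ℕ.* a ℕ.* b)
  regroup = solve-∀

Cℚ : ℕ → ℕ → ℚ
Cℚ n k = fromℕ (n C k)

Cℚ-pascal : ∀ n k → Cℚ (suc n) (suc k) ≡ Cℚ n k + Cℚ n (suc k)
Cℚ-pascal n k = trans (cong fromℕ (sym (nCk+nC[k+1]≡[n+1]C[k+1] n k))) (fromℕ-+ (n C k) (n C suc k))

Cℚ-above : ∀ n k → n ℕ.< k → Cℚ n k ≡ 0ℚ
Cℚ-above n k n<k = trans (cong fromℕ (k>n⇒nCk≡0 n<k)) fromℕ-0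

2^ℚ : ℕ → ℚ
2^ℚ n = fromℕ (2 ^ n)

½^*2^ℚ≡1 : ∀ n → ½^ n * 2^ℚ n ≡ 1ℚ
½^*2^ℚ≡1 zero    = trans (ℚP.*-identityˡ _) fromℕ-1
½^*2^ℚ≡1 (suc n) = begin
  ½^ n * ½ * fromℕ (2 ℕ.* 2 ^ n)          ≡⟨ cong (½^ n * ½ *_) (fromℕ-* 2 (2 ^ n)) ⟩
  ½^ n * ½ * (fromℕ 2 * 2^ℚ n)            ≡⟨ solve 3 (λ h t p → h :* con ½ :* (t :* p) := (h :* p) :* (t :* con ½)) refl (½^ n) (fromℕ 2) (2^ℚ n) ⟩
  (½^ n * 2^ℚ n) * (fromℕ 2 * ½)          ≡⟨ cong₂ _*_ (½^*2^ℚ≡1 n) fromℕ-2*½ ⟩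
  1ℚ                                      ∎
  where open ≡-Reasoning

½^-+ : ∀ m n → ½^ (m ℕ.+ n) ≡ ½^ m * ½^ n
½^-+ zero    n = sym (ℚP.*-identityˡ (½^ n))
½^-+ (suc m) n = trans (cong (_* ½) (½^-+ m n)) (solve 2 (λ x y → x :* y :* con ½ := x :* con ½ :* y) refl (½^ m) (½^ n))

-- The summands with 2k > N vanish, so σ N is the full sum Σ_k C(N,2k) C(2k,k)/4^k.
σ : ℕ → ℚ
σ N = ∑ (λ k → c k * Cℚ N (2 ℕ.* k)) (suc N)

-- Wilf–Zeilberger certificate for the summands c k · C(N,2k) of σ N.
σ-certificate : ℕ → ℕ → ℚ
σ-certificate M zero    = 0ℚ
σ-certificate M (suc k) = - (fromℕ (suc M) * c k * Cℚ M (2 ℕ.* k))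

fromℕ-2+n : ∀ n → fromℕ (suc (suc n)) ≡ fromℕ n + 1ℚ + 1ℚ
fromℕ-2+n n = trans (fromℕ-suc (suc n)) (cong (_+ 1ℚ) (fromℕ-suc n))

fromℕ-3+2n : ∀ n → fromℕ (suc (suc (suc (2 ℕ.* n)))) ≡ fromℕ n + fromℕ n + 1ℚ + 1ℚ + 1ℚ
fromℕ-3+2n n = trans (fromℕ-suc (suc (suc (2 ℕ.* n))))
  (cong (_+ 1ℚ) (trans (fromℕ-2+n (2 ℕ.* n)) (cong (λ x → x + 1ℚ + 1ℚ)
    (trans (cong fromℕ (cong (n ℕ.+_) (ℕP.+-identityʳ n))) (fromℕ-+ n n)))))

σ-summand-recurrence : ∀ M k → fromℕ (suc (suc M)) * (c k * Cℚ (suc (suc M)) (2 ℕ.* k))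
                               - fromℕ (suc (suc (suc (2 ℕ.* M)))) * (c k * Cℚ (suc M) (2 ℕ.* k))
                             ≡ σ-certificate M (suc k) - σ-certificate M k
σ-summand-recurrence M zero = begin
  fromℕ (suc (suc M)) * (1ℚ * Cℚ (suc (suc M)) 0) - fromℕ (suc (suc (suc (2 ℕ.* M)))) * (1ℚ * Cℚ (suc M) 0)
    ≡⟨ cong₂ (λ x y → x * (1ℚ * fromℕ 1) - y * (1ℚ * fromℕ 1)) (fromℕ-2+n M) (fromℕ-3+2n M) ⟩
  (m + 1ℚ + 1ℚ) * (1ℚ * fromℕ 1) - (m + m + 1ℚ + 1ℚ + 1ℚ) * (1ℚ * fromℕ 1)
    ≡⟨ cong (λ x → (m + 1ℚ + 1ℚ) * (1ℚ * x) - (m + m + 1ℚ + 1ℚ + 1ℚ) * (1ℚ * x)) fromℕ-1 ⟩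
  (m + 1ℚ + 1ℚ) * (1ℚ * 1ℚ) - (m + m + 1ℚ + 1ℚ + 1ℚ) * (1ℚ * 1ℚ)
    ≡⟨ solve 1 (λ m → (m :+ con 1ℚ :+ con 1ℚ) :* (con 1ℚ :* con 1ℚ) :- (m :+ m :+ con 1ℚ :+ con 1ℚ :+ con 1ℚ) :* (con 1ℚ :* con 1ℚ)
                    := :- ((m :+ con 1ℚ) :* con 1ℚ :* con 1ℚ) :- con 0ℚ) refl m ⟩
  - ((m + 1ℚ) * 1ℚ * 1ℚ) - 0ℚ
    ≡⟨ cong₂ (λ x y → - (x * 1ℚ * y) - 0ℚ) (sym (fromℕ-suc M)) (sym fromℕ-1) ⟩
  σ-certificate M 1 - σ-certificate M 0 ∎
  where
  open ≡-Reasoning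
  m = fromℕ M
σ-summand-recurrence M (suc j) = *-cancelʳ-fromℕ-suc (suc (2 ℕ.* j)) (begin
  (fromℕ (suc (suc M)) * (c′ * Cℚ (suc (suc M)) (2 ℕ.* suc j)) - fromℕ (suc (suc (suc (2 ℕ.* M)))) * (c′ * Cℚ (suc M) (2 ℕ.* suc j))) * E
    ≡⟨ cong₂ (λ u v → (u * (c′ * Cℚ (suc (suc M)) v) - v′ * (c′ * Cℚ (suc M) v)) * E) (fromℕ-2+n M) (2*[1+n]≡2+2*n j) ⟩
  ((m + 1ℚ + 1ℚ) * (c′ * Cℚ (suc (suc M)) (suc (suc (2 ℕ.* j)))) - v′ * (c′ * Cℚ (suc M) (suc (suc (2 ℕ.* j))))) * E
    ≡⟨ cong₂ (λ u v → ((m + 1ℚ + 1ℚ) * (c′ * u) - v′ * (c′ * v)) * E)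
         (trans (Cℚ-pascal (suc M) (suc (2 ℕ.* j))) (cong₂ _+_ (Cℚ-pascal M (2 ℕ.* j)) (Cℚ-pascal M (suc (2 ℕ.* j)))))
         (Cℚ-pascal M (suc (2 ℕ.* j))) ⟩
  ((m + 1ℚ + 1ℚ) * (c′ * ((X + Y) + (Y + Z))) - v′ * (c′ * (Y + Z))) * E
    ≡⟨ cong₂ (λ u v → ((m + 1ℚ + 1ℚ) * (c′ * ((X + Y) + (Y + Z))) - u * (c′ * (Y + Z))) * v) (fromℕ-3+2n M) (fromℕ-2+n (2 ℕ.* j)) ⟩
  ((m + 1ℚ + 1ℚ) * (c′ * ((X + Y) + (Y + Z))) - (m + m + 1ℚ + 1ℚ + 1ℚ) * (c′ * (Y + Z))) * (2j + 1ℚ + 1ℚ)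
    ≡⟨ identity (c j) c′ X Y Z m 2j c-step absorption ⟩
  (- ((m + 1ℚ) * c′ * Z) - - ((m + 1ℚ) * c j * X)) * (2j + 1ℚ + 1ℚ)
    ≡⟨ cong₂ (λ u v → (- (u * c′ * v) - - (u * c j * X)) * (2j + 1ℚ + 1ℚ)) (sym (fromℕ-suc M)) (cong (Cℚ M) (sym (2*[1+n]≡2+2*n j))) ⟩
  (σ-certificate M (suc (suc j)) - σ-certificate M (suc j)) * (2j + 1ℚ + 1ℚ)
    ≡⟨ cong ((σ-certificate M (suc (suc j)) - σ-certificate M (suc j)) *_) (sym (fromℕ-2+n (2 ℕ.* j))) ⟩
  (σ-certificate M (suc (suc j)) - σ-certificate M (suc j)) * E ∎)
  where
  open ≡-Reasoning
  m = fromℕ M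
  c′ = c (suc j)
  v′ = fromℕ (suc (suc (suc (2 ℕ.* M))))
  X = Cℚ M (2 ℕ.* j)
  Y = Cℚ M (suc (2 ℕ.* j))
  Z = Cℚ M (suc (suc (2 ℕ.* j)))
  2j = fromℕ (2 ℕ.* j)
  E = fromℕ (suc (suc (2 ℕ.* j)))
  c-step : c′ * (2j + 1ℚ + 1ℚ) ≡ c j * (2j + 1ℚ)
  c-step = trans (cong (c′ *_) (sym (fromℕ-2+n (2 ℕ.* j)))) (trans (c-suc j) (cong (c j *_) (fromℕ-suc (2 ℕ.* j))))
  absorption : (2j + 1ℚ) * Y + 2j * X ≡ m * X
  absorption = trans (cong₂ _+_ (trans (cong (_* Y) (sym (fromℕ-suc (2 ℕ.* j)))) (sym (fromℕ-* _ _))) (sym (fromℕ-* _ _)))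
    (trans (sym (fromℕ-+ _ _)) (trans (cong fromℕ ([1+k]*nC[1+k]+k*nCk≡n*nCk M (2 ℕ.* j))) (fromℕ-* M (M C (2 ℕ.* j)))))
  identity : ∀ (c c′ X Y Z m J : ℚ) → c′ * (J + 1ℚ + 1ℚ) ≡ c * (J + 1ℚ) → (J + 1ℚ) * Y + J * X ≡ m * X →
    ((m + 1ℚ + 1ℚ) * (c′ * ((X + Y) + (Y + Z))) - (m + m + 1ℚ + 1ℚ + 1ℚ) * (c′ * (Y + Z))) * (J + 1ℚ + 1ℚ)
    ≡ (- ((m + 1ℚ) * c′ * Z) - - ((m + 1ℚ) * c * X)) * (J + 1ℚ + 1ℚ)
  identity c c′ X Y Z m J c-step absorption = begin
    ((m + 1ℚ + 1ℚ) * (c′ * ((X + Y) + (Y + Z))) - (m + m + 1ℚ + 1ℚ + 1ℚ) * (c′ * (Y + Z))) * (J + 1ℚ + 1ℚ)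
      ≡⟨ solve 7 (λ c c′ X Y Z m J →
            ((m :+ con 1ℚ :+ con 1ℚ) :* (c′ :* ((X :+ Y) :+ (Y :+ Z))) :- (m :+ m :+ con 1ℚ :+ con 1ℚ :+ con 1ℚ) :* (c′ :* (Y :+ Z))) :* (J :+ con 1ℚ :+ con 1ℚ)
            := (:- ((m :+ con 1ℚ) :* c′ :* Z) :- :- ((m :+ con 1ℚ) :* c :* X)) :* (J :+ con 1ℚ :+ con 1ℚ)
               :+ (c′ :* (J :+ con 1ℚ :+ con 1ℚ) :- c :* (J :+ con 1ℚ)) :* ((m :+ con 1ℚ :+ con 1ℚ) :* X :+ Y)
               :+ c :* ((J :+ con 1ℚ) :* Y :+ J :* X :- m :* X)) refl c c′ X Y Z m J ⟩
    R + (c′ * (J + 1ℚ + 1ℚ) - c * (J + 1ℚ)) * W + c * ((J + 1ℚ) * Y + J * X - m * X)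
      ≡⟨ cong₂ (λ u v → R + (u - c * (J + 1ℚ)) * W + c * (v - m * X)) c-step absorption ⟩
    R + (c * (J + 1ℚ) - c * (J + 1ℚ)) * W + c * (m * X - m * X)
      ≡⟨ solve 5 (λ R a W b x → R :+ (a :- a) :* W :+ x :* (b :- b) := R) refl R (c * (J + 1ℚ)) W (m * X) c ⟩
    R ∎
    where
    R = (- ((m + 1ℚ) * c′ * Z) - - ((m + 1ℚ) * c * X)) * (J + 1ℚ + 1ℚ)
    W = (m + 1ℚ + 1ℚ) * X + Y

σ-recurrence : ∀ M → fromℕ (suc (suc M)) * σ (suc (suc M)) ≡ fromℕ (suc (suc (suc (2 ℕ.* M)))) * σ (suc M)
σ-recurrence M = begin
  A * σ (suc (suc M))                         ≡⟨ solve 2 (λ x y → x := (x :- y) :+ y) refl (A * σ (suc (suc M))) (B * ∑F) ⟩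
  (A * σ (suc (suc M)) - B * ∑F) + B * ∑F     ≡⟨ cong₂ _+_ telescoped (cong (B *_) extended) ⟩
  0ℚ + B * σ (suc M)                          ≡⟨ ℚP.+-identityˡ _ ⟩
  B * σ (suc M)                               ∎
  where
  open ≡-Reasoning
  A = fromℕ (suc (suc M))
  B = fromℕ (suc (suc (suc (2 ℕ.* M))))
  F : ℕ → ℕ → ℚ
  F N k = c k * Cℚ N (2 ℕ.* k)
  ∑F = ∑ (F (suc M)) (suc (suc (suc M)))
  M<2[2+M] : ∀ M → M ℕ.< 2 ℕ.* suc (suc M)
  M<2[2+M] M = ℕP.<-≤-trans (ℕP.n<1+n M) (ℕP.≤-trans (ℕP.n≤1+n (suc M)) (ℕP.m≤m+n (suc (suc M)) _))
  extended : ∑F ≡ σ (suc M)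
  extended = trans (cong (λ x → σ (suc M) + x)
    (trans (cong (c (suc (suc M)) *_) (Cℚ-above (suc M) _ (ℕP.<-≤-trans (ℕP.n<1+n (suc M)) (ℕP.m≤m+n (suc (suc M)) _))))
           (ℚP.*-zeroʳ (c (suc (suc M)))))) (ℚP.+-identityʳ (σ (suc M)))
  telescoped : A * σ (suc (suc M)) - B * ∑F ≡ 0ℚ
  telescoped = begin
    A * σ (suc (suc M)) - B * ∑F
      ≡⟨ sym (cong₂ _-_ (∑-*ˡ A (F (suc (suc M))) (suc (suc (suc M)))) (∑-*ˡ B (F (suc M)) (suc (suc (suc M))))) ⟩
    ∑ (λ k → A * F (suc (suc M)) k) (suc (suc (suc M))) - ∑ (λ k → B * F (suc M) k) (suc (suc (suc M)))
      ≡⟨ sym (∑-sub _ _ (suc (suc (suc M)))) ⟩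
    ∑ (λ k → A * F (suc (suc M)) k - B * F (suc M) k) (suc (suc (suc M)))
      ≡⟨ ∑-cong (σ-summand-recurrence M) (suc (suc (suc M))) ⟩
    ∑ (λ k → σ-certificate M (suc k) - σ-certificate M k) (suc (suc (suc M)))
      ≡⟨ ∑-telescope-0 (σ-certificate M) refl (suc (suc (suc M))) ⟩
    - (fromℕ (suc M) * c (suc (suc M)) * Cℚ M (2 ℕ.* suc (suc M)))
      ≡⟨ cong (λ x → - (fromℕ (suc M) * c (suc (suc M)) * x)) (Cℚ-above M _ (M<2[2+M] M)) ⟩
    - (fromℕ (suc M) * c (suc (suc M)) * 0ℚ)
      ≡⟨ solve 2 (λ a b → :- (a :* b :* con 0ℚ) := con 0ℚ) refl (fromℕ (suc M)) (c (suc (suc M))) ⟩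
    0ℚ ∎

σ≡2^N*c : ∀ N → σ N ≡ 2^ℚ N * c N
σ≡2^N*c zero = trans (ℚP.+-identityˡ (1ℚ * fromℕ 1)) (trans (ℚP.*-identityˡ (fromℕ 1)) (sym (ℚP.*-identityʳ (fromℕ 1))))
σ≡2^N*c (suc zero) = begin
  0ℚ + 1ℚ * Cℚ 1 0 + c 1 * Cℚ 1 2        ≡⟨ cong₂ (λ x y → 0ℚ + 1ℚ * x + c 1 * y) fromℕ-1 fromℕ-0 ⟩
  0ℚ + 1ℚ * 1ℚ + c 1 * 0ℚ                ≡⟨ solve 1 (λ x → con 0ℚ :+ con 1ℚ :* con 1ℚ :+ x :* con 0ℚ := con 1ℚ) refl (c 1) ⟩
  1ℚ                                     ≡⟨ sym (fromℕ*1/ℕ-suc 1) ⟩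
  fromℕ 2 * 1/ℕ 2                        ≡⟨ cong (fromℕ 2 *_) (sym (trans (cong (_* 1/ℕ 2) fromℕ-1) (ℚP.*-identityˡ (1/ℕ 2)))) ⟩
  fromℕ 2 * (fromℕ 1 * 1/ℕ 2)            ≡⟨ cong (fromℕ 2 *_) (sym (ℚP.*-identityˡ _)) ⟩
  2^ℚ 1 * c 1                            ∎
  where open ≡-Reasoning
σ≡2^N*c (suc (suc M)) = *-cancelʳ-fromℕ-suc (suc M) (begin
  σ (suc (suc M)) * fromℕ (suc (suc M))                       ≡⟨ ℚP.*-comm (σ (suc (suc M))) (fromℕ (suc (suc M))) ⟩
  fromℕ (suc (suc M)) * σ (suc (suc M))                       ≡⟨ σ-recurrence M ⟩
  B * σ (suc M)                                               ≡⟨ cong (B *_) (σ≡2^N*c (suc M)) ⟩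
  B * (2^ℚ (suc M) * c (suc M))                               ≡⟨ solve 3 (λ b p c → b :* (p :* c) := p :* (c :* b)) refl B (2^ℚ (suc M)) (c (suc M)) ⟩
  2^ℚ (suc M) * (c (suc M) * B)                               ≡⟨ cong (λ m → 2^ℚ (suc M) * (c (suc M) * fromℕ (suc m))) (sym (2*[1+n]≡2+2*n M)) ⟩
  2^ℚ (suc M) * (c (suc M) * fromℕ (suc (2 ℕ.* suc M)))       ≡⟨ cong (2^ℚ (suc M) *_) (sym (c-suc (suc M))) ⟩
  2^ℚ (suc M) * (c (suc (suc M)) * fromℕ (suc (suc (2 ℕ.* suc M))))
                                                              ≡⟨ cong (λ m → 2^ℚ (suc M) * (c (suc (suc M)) * fromℕ m)) (sym (2*[1+n]≡2+2*n (suc M))) ⟩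
  2^ℚ (suc M) * (c (suc (suc M)) * fromℕ (2 ℕ.* suc (suc M))) ≡⟨ cong (λ x → 2^ℚ (suc M) * (c (suc (suc M)) * x)) (fromℕ-* 2 (suc (suc M))) ⟩
  2^ℚ (suc M) * (c (suc (suc M)) * (fromℕ 2 * fromℕ (suc (suc M))))
                                                              ≡⟨ solve 4 (λ p c t a → p :* (c :* (t :* a)) := t :* p :* c :* a)
                                                                   refl (2^ℚ (suc M)) (c (suc (suc M))) (fromℕ 2) (fromℕ (suc (suc M))) ⟩
  fromℕ 2 * 2^ℚ (suc M) * c (suc (suc M)) * fromℕ (suc (suc M))
                                                              ≡⟨ cong (λ x → x * c (suc (suc M)) * fromℕ (suc (suc M))) (sym (fromℕ-* 2 (2 ^ suc M))) ⟩
  2^ℚ (suc (suc M)) * c (suc (suc M)) * fromℕ (suc (suc M))   ∎)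
  where
  open ≡-Reasoning
  B = fromℕ (suc (suc (suc (2 ℕ.* M))))

∑c*C[1+n,1+2k]≡∑2^k*c : ∀ n → ∑ (λ k → c k * Cℚ (suc n) (suc (2 ℕ.* k))) (suc n) ≡ ∑ (λ k → 2^ℚ k * c k) (suc n)
∑c*C[1+n,1+2k]≡∑2^k*c zero = cong (λ x → 0ℚ + x) (trans (cong (1ℚ *_) fromℕ-1) (sym (cong (_* 1ℚ) fromℕ-1)))
∑c*C[1+n,1+2k]≡∑2^k*c (suc n) = begin
  ∑ (λ k → c k * Cℚ (suc (suc n)) (suc (2 ℕ.* k))) (suc (suc n))
    ≡⟨ ∑-cong (λ k → trans (cong (c k *_) (Cℚ-pascal (suc n) (2 ℕ.* k))) (ℚP.*-distribˡ-+ (c k) _ _)) (suc (suc n)) ⟩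
  ∑ (λ k → c k * Cℚ (suc n) (2 ℕ.* k) + c k * Cℚ (suc n) (suc (2 ℕ.* k))) (suc (suc n))
    ≡⟨ ∑-+ (λ k → c k * Cℚ (suc n) (2 ℕ.* k)) (λ k → c k * Cℚ (suc n) (suc (2 ℕ.* k))) (suc (suc n)) ⟩
  σ (suc n) + (∑ odd (suc n) + c (suc n) * Cℚ (suc n) (suc (2 ℕ.* suc n)))
    ≡⟨ cong₂ (λ x y → x + (y + c (suc n) * Cℚ (suc n) (suc (2 ℕ.* suc n)))) (σ≡2^N*c (suc n)) (∑c*C[1+n,1+2k]≡∑2^k*c n) ⟩
  2^ℚ (suc n) * c (suc n) + (∑ (λ k → 2^ℚ k * c k) (suc n) + c (suc n) * Cℚ (suc n) (suc (2 ℕ.* suc n)))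
    ≡⟨ cong (λ x → 2^ℚ (suc n) * c (suc n) + (∑ (λ k → 2^ℚ k * c k) (suc n) + c (suc n) * x))
         (Cℚ-above (suc n) _ (s≤s (s≤s (ℕP.m≤m+n n _)))) ⟩
  2^ℚ (suc n) * c (suc n) + (∑ (λ k → 2^ℚ k * c k) (suc n) + c (suc n) * 0ℚ)
    ≡⟨ solve 3 (λ a s x → a :+ (s :+ x :* con 0ℚ) := s :+ a) refl (2^ℚ (suc n) * c (suc n)) (∑ (λ k → 2^ℚ k * c k) (suc n)) (c (suc n)) ⟩
  ∑ (λ k → 2^ℚ k * c k) (suc (suc n)) ∎
  where
  open ≡-Reasoning
  odd : ℕ → ℚ
  odd k = c k * Cℚ (suc n) (suc (2 ℕ.* k))

-- Σ_k c k/(2k+1) = π/2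

b : ℕ → ℚ
b k = c k * 1/ℕ (suc (2 ℕ.* k))

b-nonneg : ∀ k → 0ℚ ≤ b k
b-nonneg k = *-nonneg (c-nonneg k) (0≤1/ℕ _)

b≤2[c-c-suc] : ∀ k → b k ≤ fromℕ 2 * (c k - c (suc k))
b≤2[c-c-suc] k = begin
  c k * 1/ℕ (suc (2 ℕ.* k))                      ≤⟨ *-monoˡ-≤-nonneg (c-nonneg k) (1/ℕ-antitone (ℕP.m≤m+n k (1 ℕ.* k))) ⟩
  c k * 1/ℕ (suc k)                              ≡⟨ cong (c k *_) (sym (2*1/ℕ[2+2n] k)) ⟩
  c k * (fromℕ 2 * 1/ℕ (suc (suc (2 ℕ.* k))))     ≡⟨ solve 3 (λ c t i → c :* (t :* i) := t :* (c :* i)) refl (c k) (fromℕ 2) _ ⟩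
  fromℕ 2 * (c k * 1/ℕ (suc (suc (2 ℕ.* k))))     ≡⟨ cong (fromℕ 2 *_) (sym (c-c-suc k)) ⟩
  fromℕ 2 * (c k - c (suc k))                    ∎
  where open ℚP.≤-Reasoning

∑b-tail≤2c : ∀ K n → ∑ (λ j → b (K ℕ.+ j)) n ≤ fromℕ 2 * c K
∑b-tail≤2c K n = ℚP.≤-trans (telescoped n) (*-monoˡ-≤-nonneg (0≤fromℕ 2)
  (subst (c K - c (K ℕ.+ n) ≤_) (ℚP.+-identityʳ (c K)) (ℚP.+-monoʳ-≤ (c K) (ℚP.neg-antimono-≤ (c-nonneg (K ℕ.+ n))))))
  where
  telescoped : ∀ n → ∑ (λ j → b (K ℕ.+ j)) n ≤ fromℕ 2 * (c K - c (K ℕ.+ n))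
  telescoped zero = ℚP.≤-reflexive (sym (trans (cong (λ m → fromℕ 2 * (c K - c m)) (ℕP.+-identityʳ K))
    (trans (cong (fromℕ 2 *_) (ℚP.+-inverseʳ (c K))) (ℚP.*-zeroʳ (fromℕ 2)))))
  telescoped (suc n) = ℚP.≤-trans (ℚP.+-mono-≤ (telescoped n) (b≤2[c-c-suc] (K ℕ.+ n)))
    (ℚP.≤-reflexive (trans (solve 4 (λ t x y z → t :* (x :- y) :+ t :* (y :- z) := t :* (x :- z)) refl (fromℕ 2) (c K) (c (K ℕ.+ n)) (c (suc (K ℕ.+ n))))
      (cong (λ m → fromℕ 2 * (c K - c m)) (sym (ℕP.+-suc K n)))))

∑b≤2 : ∀ n → ∑ b n ≤ fromℕ 2
∑b≤2 n = ℚP.≤-trans (∑b-tail≤2c 0 n) (ℚP.≤-reflexive (ℚP.*-identityʳ (fromℕ 2)))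

-- The Euler-transformed series Σ_k b k · ρ (2k) N, where the weight ρ (2k) N → 1 is the
-- probability that a fair coin first shows its (2k+1)-th head within N tosses.
w : ℕ → ℕ → ℚ
w k n = b k * Cℚ n (2 ℕ.* k) * ½^ (suc n)

smoothed : ℕ → ℚ
smoothed = ∑ (λ n → ∑ (λ k → w k n) (suc n))

H : ℕ → ℕ → ℚ
H j k = ½^ j * t (suc (suc (2 ℕ.* j))) k

b*C[n,2k]≡c*C[1+n,1+2k]/[1+n] : ∀ n k → b k * Cℚ n (2 ℕ.* k) ≡ c k * Cℚ (suc n) (suc (2 ℕ.* k)) * 1/ℕ (suc n)
b*C[n,2k]≡c*C[1+n,1+2k]/[1+n] n k = begin
  c k * i * Cℚ n (2 ℕ.* k)
    ≡⟨ sym (trans (cong (c k * i * Cℚ n (2 ℕ.* k) *_) (fromℕ*1/ℕ-suc n)) (ℚP.*-identityʳ _)) ⟩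
  c k * i * Cℚ n (2 ℕ.* k) * (fromℕ (suc n) * 1/ℕ (suc n))
    ≡⟨ solve 5 (λ c i x m j → c :* i :* x :* (m :* j) := c :* i :* (m :* x) :* j) refl (c k) i (Cℚ n (2 ℕ.* k)) (fromℕ (suc n)) (1/ℕ (suc n)) ⟩
  c k * i * (fromℕ (suc n) * Cℚ n (2 ℕ.* k)) * 1/ℕ (suc n)
    ≡⟨ cong (λ x → c k * i * x * 1/ℕ (suc n)) absorption ⟩
  c k * i * (fromℕ (suc (2 ℕ.* k)) * Cℚ (suc n) (suc (2 ℕ.* k))) * 1/ℕ (suc n)
    ≡⟨ solve 5 (λ c i o y j → c :* i :* (o :* y) :* j := c :* y :* j :* (o :* i)) refl (c k) i (fromℕ (suc (2 ℕ.* k))) (Cℚ (suc n) (suc (2 ℕ.* k))) (1/ℕ (suc n)) ⟩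
  c k * Cℚ (suc n) (suc (2 ℕ.* k)) * 1/ℕ (suc n) * (fromℕ (suc (2 ℕ.* k)) * i)
    ≡⟨ trans (cong (c k * Cℚ (suc n) (suc (2 ℕ.* k)) * 1/ℕ (suc n) *_) (fromℕ*1/ℕ-suc (2 ℕ.* k))) (ℚP.*-identityʳ _) ⟩
  c k * Cℚ (suc n) (suc (2 ℕ.* k)) * 1/ℕ (suc n) ∎
  where
  open ≡-Reasoning
  i = 1/ℕ (suc (2 ℕ.* k))
  absorption : fromℕ (suc n) * Cℚ n (2 ℕ.* k) ≡ fromℕ (suc (2 ℕ.* k)) * Cℚ (suc n) (suc (2 ℕ.* k))
  absorption = trans (sym (fromℕ-* (suc n) _))
    (trans (cong fromℕ (sym ([1+k]*[1+n]C[1+k]≡[1+n]*nCk n (2 ℕ.* k)))) (fromℕ-* (suc (2 ℕ.* k)) _))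

½^[1+j+d]/[1+j+d]*2^d*c≡H : ∀ j d → ½^ (suc (j ℕ.+ d)) * 1/ℕ (suc (j ℕ.+ d)) * (2^ℚ d * c d) ≡ H j d
½^[1+j+d]/[1+j+d]*2^d*c≡H j d = begin
  ½^ (j ℕ.+ d) * ½ * 1/ℕ (suc (j ℕ.+ d)) * (2^ℚ d * c d)
    ≡⟨ cong (λ x → x * ½ * 1/ℕ (suc (j ℕ.+ d)) * (2^ℚ d * c d)) (½^-+ j d) ⟩
  ½^ j * ½^ d * ½ * 1/ℕ (suc (j ℕ.+ d)) * (2^ℚ d * c d)
    ≡⟨ solve 6 (λ a e h i p c → a :* e :* h :* i :* (p :* c) := a :* (c :* (h :* i)) :* (e :* p)) refl (½^ j) (½^ d) ½ (1/ℕ (suc (j ℕ.+ d))) (2^ℚ d) (c d) ⟩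
  ½^ j * (c d * (½ * 1/ℕ (suc (j ℕ.+ d)))) * (½^ d * 2^ℚ d)
    ≡⟨ cong₂ (λ x y → ½^ j * (c d * x) * y) (sym (1/ℕ[2+2n]≡½*1/ℕ[1+n] (j ℕ.+ d))) (½^*2^ℚ≡1 d) ⟩
  ½^ j * (c d * 1/ℕ (suc (suc (2 ℕ.* (j ℕ.+ d))))) * 1ℚ
    ≡⟨ ℚP.*-identityʳ _ ⟩
  ½^ j * (c d * 1/ℕ (suc (suc (2 ℕ.* (j ℕ.+ d)))))
    ≡⟨ cong (λ m → ½^ j * (c d * 1/ℕ m)) (reorder j d) ⟩
  H j d ∎
  where
  open ≡-Reasoning
  reorder : ∀ j d → suc (suc (2 ℕ.* (j ℕ.+ d))) ≡ 2 ℕ.* d ℕ.+ suc (suc (2 ℕ.* j))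
  reorder = solve-∀

∑w≡∑H-antidiagonal : ∀ n → ∑ (λ k → w k n) (suc n) ≡ ∑ (λ j → H j (n ∸ j)) (suc n)
∑w≡∑H-antidiagonal n = begin
  ∑ (λ k → w k n) (suc n)
    ≡⟨ ∑-cong (λ k → trans (cong (_* ½^ (suc n)) (b*C[n,2k]≡c*C[1+n,1+2k]/[1+n] n k))
                  (solve 4 (λ c y i h → c :* y :* i :* h := h :* i :* (c :* y)) refl (c k) (Cℚ (suc n) (suc (2 ℕ.* k))) (1/ℕ (suc n)) (½^ (suc n)))) (suc n) ⟩
  ∑ (λ k → κ * (c k * Cℚ (suc n) (suc (2 ℕ.* k)))) (suc n)
    ≡⟨ ∑-*ˡ κ _ (suc n) ⟩
  κ * ∑ (λ k → c k * Cℚ (suc n) (suc (2 ℕ.* k))) (suc n)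
    ≡⟨ cong (κ *_) (∑c*C[1+n,1+2k]≡∑2^k*c n) ⟩
  κ * ∑ (λ k → 2^ℚ k * c k) (suc n)
    ≡⟨ sym (∑-*ˡ κ _ (suc n)) ⟩
  ∑ (λ k → κ * (2^ℚ k * c k)) (suc n)
    ≡⟨ ∑-reverse (λ k → κ * (2^ℚ k * c k)) n ⟩
  ∑ (λ j → κ * (2^ℚ (n ∸ j) * c (n ∸ j))) (suc n)
    ≡⟨ ∑-cong-< (suc n) (λ j j≤n → subst (λ m → ½^ (suc m) * 1/ℕ (suc m) * (2^ℚ (n ∸ j) * c (n ∸ j)) ≡ H j (n ∸ j))
                                       (ℕP.m+[n∸m]≡n (ℕP.≤-pred j≤n)) (½^[1+j+d]/[1+j+d]*2^d*c≡H j (n ∸ j))) ⟩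
  ∑ (λ j → H j (n ∸ j)) (suc n) ∎
  where
  open ≡-Reasoning
  κ = ½^ (suc n) * 1/ℕ (suc n)

R : ℕ → ℚ
R N = ∑ (λ j → ½^ j * tail-T[2+2j] j (N ∸ j)) N

V : ℕ → ℚ
V N = ∑ (λ j → ½^ j * c (N ∸ j)) N

smoothed≡euler-R : ∀ N → smoothed N ≡ euler N - R N
smoothed≡euler-R N = begin
  smoothed N
    ≡⟨ ∑-cong ∑w≡∑H-antidiagonal N ⟩
  ∑ (λ n → ∑ (λ j → H j (n ∸ j)) (suc n)) N
    ≡⟨ ∑-antidiagonal H N ⟩
  ∑ (λ j → ∑ (H j) (N ∸ j)) N
    ≡⟨ ∑-cong (λ j → trans (∑-*ˡ (½^ j) (t (suc (suc (2 ℕ.* j)))) (N ∸ j))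
                  (cong (½^ j *_) (solve 2 (λ a t → t := a :- (a :- t)) refl (α j) (T (suc (suc (2 ℕ.* j))) (N ∸ j))))) N ⟩
  ∑ (λ j → ½^ j * (α j - tail-T[2+2j] j (N ∸ j))) N
    ≡⟨ ∑-cong (λ j → solve 3 (λ h a e → h :* (a :- e) := h :* a :- h :* e) refl (½^ j) (α j) (tail-T[2+2j] j (N ∸ j))) N ⟩
  ∑ (λ j → ½^ j * α j - ½^ j * tail-T[2+2j] j (N ∸ j)) N
    ≡⟨ ∑-sub (λ j → ½^ j * α j) (λ j → ½^ j * tail-T[2+2j] j (N ∸ j)) N ⟩
  euler N - R N ∎
  where open ≡-Reasoning

V-suc : ∀ N → V (suc N) ≡ c (suc N) + ½ * V N
V-suc N = begin
  ∑ (λ j → ½^ j * c (suc N ∸ j)) (suc N)              ≡⟨ ∑-suc (λ j → ½^ j * c (suc N ∸ j)) N ⟩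
  1ℚ * c (suc N) + ∑ (λ j → ½^ j * ½ * c (N ∸ j)) N    ≡⟨ cong₂ _+_ (ℚP.*-identityˡ (c (suc N)))
                                                            (∑-cong (λ j → solve 3 (λ h a x → h :* a :* x := a :* (h :* x)) refl (½^ j) ½ (c (N ∸ j))) N) ⟩
  c (suc N) + ∑ (λ j → ½ * (½^ j * c (N ∸ j))) N       ≡⟨ cong (λ x → c (suc N) + x) (∑-*ˡ ½ (λ j → ½^ j * c (N ∸ j)) N) ⟩
  c (suc N) + ½ * V N                                 ∎
  where open ≡-Reasoning

V-nonneg : ∀ N → 0ℚ ≤ V N
V-nonneg N = ∑-nonneg N (λ j _ → *-nonneg (½^-nonneg j) (c-nonneg (N ∸ j)))

V≤2 : ∀ N → V N ≤ fromℕ 2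
V≤2 zero    = 0≤fromℕ 2
V≤2 (suc N) = begin
  V (suc N)                 ≡⟨ V-suc N ⟩
  c (suc N) + ½ * V N       ≤⟨ ℚP.+-mono-≤ (c≤1 (suc N)) (*-monoˡ-≤-nonneg 0≤½ (V≤2 N)) ⟩
  1ℚ + ½ * fromℕ 2          ≡⟨ cong (λ x → 1ℚ + x) (trans (ℚP.*-comm ½ (fromℕ 2)) fromℕ-2*½) ⟩
  1ℚ + 1ℚ                   ≡⟨ sym fromℕ-2≡1+1 ⟩
  fromℕ 2                   ∎
  where open ℚP.≤-Reasoning

V-bound : ∀ δ M → 0ℚ ≤ δ → (∀ n → M ℕ.≤ n → c n ≤ δ) → ∀ s → V (s ℕ.+ M) ≤ fromℕ 2 * δ + fromℕ 2 * ½^ s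
V-bound δ M 0≤δ c≤δ zero = ℚP.≤-trans (V≤2 M) (ℚP.≤-trans (ℚP.≤-reflexive (sym (ℚP.+-identityˡ (fromℕ 2))))
  (ℚP.+-mono-≤ (*-nonneg (0≤fromℕ 2) 0≤δ) (ℚP.≤-reflexive (sym (ℚP.*-identityʳ (fromℕ 2))))))
V-bound δ M 0≤δ c≤δ (suc s) = begin
  V (suc (s ℕ.+ M))                                   ≡⟨ V-suc (s ℕ.+ M) ⟩
  c (suc (s ℕ.+ M)) + ½ * V (s ℕ.+ M)                 ≤⟨ ℚP.+-mono-≤ (c≤δ _ (ℕP.m≤n⇒m≤1+n (ℕP.m≤n+m M s)))
                                                                     (*-monoˡ-≤-nonneg 0≤½ (V-bound δ M 0≤δ c≤δ s)) ⟩
  δ + ½ * (fromℕ 2 * δ + fromℕ 2 * ½^ s)              ≡⟨ cong (λ x → δ + ½ * (x * δ + x * ½^ s)) fromℕ-2≡1+1 ⟩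
  δ + ½ * ((1ℚ + 1ℚ) * δ + (1ℚ + 1ℚ) * ½^ s)          ≡⟨ solve 2 (λ d h → d :+ con ½ :* ((con 1ℚ :+ con 1ℚ) :* d :+ (con 1ℚ :+ con 1ℚ) :* h)
                                                                   := (con 1ℚ :+ con 1ℚ) :* d :+ (con 1ℚ :+ con 1ℚ) :* (h :* con ½)) refl δ (½^ s) ⟩
  (1ℚ + 1ℚ) * δ + (1ℚ + 1ℚ) * (½^ s * ½)              ≡⟨ cong (λ x → x * δ + x * (½^ s * ½)) (sym fromℕ-2≡1+1) ⟩
  fromℕ 2 * δ + fromℕ 2 * ½^ (suc s)                  ∎
  where open ℚP.≤-Reasoning

[1+n]½^n≤1 : ∀ n → fromℕ (suc n) * ½^ n ≤ 1ℚ
[1+n]½^n≤1 zero    = ℚP.≤-reflexive (trans (cong (_* 1ℚ) fromℕ-1) refl)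
[1+n]½^n≤1 (suc n) = begin
  fromℕ (suc (suc n)) * (½^ n * ½)                ≡⟨ cong (_* (½^ n * ½)) (fromℕ-suc (suc n)) ⟩
  (fromℕ (suc n) + 1ℚ) * (½^ n * ½)               ≤⟨ *-monoʳ-≤-nonneg (*-nonneg (½^-nonneg n) 0≤½)
                                                      (ℚP.+-monoʳ-≤ (fromℕ (suc n)) (subst (_≤ fromℕ (suc n)) fromℕ-1 (fromℕ-mono-≤ (s≤s z≤n)))) ⟩
  (fromℕ (suc n) + fromℕ (suc n)) * (½^ n * ½)    ≡⟨ solve 2 (λ n h → (n :+ n) :* (h :* con ½) := n :* h) refl (fromℕ (suc n)) (½^ n) ⟩
  fromℕ (suc n) * ½^ n                            ≤⟨ [1+n]½^n≤1 n ⟩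
  1ℚ                                              ∎
  where open ℚP.≤-Reasoning

null-½^ : Null ½^
null-½^ = null-nonneg-dominated ½^-nonneg ½^≤1/[1+n] null-1/ℕ-suc
  where
  ½^≤1/[1+n] : ∀ n → ½^ n ≤ 1/ℕ (suc n)
  ½^≤1/[1+n] n = begin
    ½^ n                                    ≡⟨ sym (trans (solve 3 (λ n h i → n :* h :* i := h :* (n :* i)) refl (fromℕ (suc n)) (½^ n) (1/ℕ (suc n)))
                                                 (trans (cong (½^ n *_) (fromℕ*1/ℕ-suc n)) (ℚP.*-identityʳ _))) ⟩
    fromℕ (suc n) * ½^ n * 1/ℕ (suc n)      ≤⟨ *-monoʳ-≤-nonneg (0≤1/ℕ (suc n)) ([1+n]½^n≤1 n) ⟩
    1ℚ * 1/ℕ (suc n)                        ≡⟨ ℚP.*-identityˡ _ ⟩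
    1/ℕ (suc n)                             ∎
    where open ℚP.≤-Reasoning

abstract
  ε/4 : ℚ → ℚ
  ε/4 ε = ε * ½ * ½

  0<ε/4 : ∀ {ε} → 0ℚ < ε → 0ℚ < ε/4 ε
  0<ε/4 0<ε = 0<p*½ (0<p*½ 0<ε)

  2*ε/4+2*ε/4≡ε : ∀ ε → fromℕ 2 * ε/4 ε + fromℕ 2 * ε/4 ε ≡ ε
  2*ε/4+2*ε/4≡ε ε = trans (cong (λ x → x * (ε * ½ * ½) + x * (ε * ½ * ½)) fromℕ-2≡1+1)
    (solve 1 (λ e → (con 1ℚ :+ con 1ℚ) :* (e :* con ½ :* con ½) :+ (con 1ℚ :+ con 1ℚ) :* (e :* con ½ :* con ½) := e) refl ε)

0<2 : 0ℚ < fromℕ 2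
0<2 = 0<fromℕ-suc 1

-- The convolution of the summable ½^ with the null sequence c is null.
null-V : Null V
null-V ε 0<ε = split (c-null δ 0<δ) (null-½^ δ 0<δ)
  where
  δ = ε/4 ε
  0<δ = 0<ε/4 0<ε
  split : (∃ λ M → ∀ n → M ℕ.≤ n → ∣ c n ∣ < δ) → (∃ λ K → ∀ n → K ℕ.≤ n → ∣ ½^ n ∣ < δ) →
          ∃ λ N → ∀ n → N ℕ.≤ n → ∣ V n ∣ < ε
  split (M , c<δ) (K , ½^<δ) = K ℕ.+ M , λ n K+M≤n → begin-strict
    ∣ V n ∣                                      ≡⟨ ℚP.0≤p⇒∣p∣≡p (V-nonneg n) ⟩
    V n                                          ≡⟨ cong V (sym (ℕP.m∸n+n≡m (M≤n n K+M≤n))) ⟩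
    V ((n ∸ M) ℕ.+ M)                            ≤⟨ V-bound δ M (ℚP.<⇒≤ 0<δ) c≤δ (n ∸ M) ⟩
    fromℕ 2 * δ + fromℕ 2 * ½^ (n ∸ M)           <⟨ ℚP.+-monoʳ-< (fromℕ 2 * δ) (ℚP.*-monoʳ-<-pos (fromℕ 2) {{ℚ.positive 0<2}}
                                                        (subst (_< δ) (ℚP.0≤p⇒∣p∣≡p (½^-nonneg (n ∸ M))) (½^<δ (n ∸ M) (K≤n∸M n K+M≤n)))) ⟩
    fromℕ 2 * δ + fromℕ 2 * δ                    ≡⟨ 2*ε/4+2*ε/4≡ε ε ⟩
    ε                                            ∎
    where
    open ℚP.≤-Reasoning
    c≤δ : ∀ m → M ℕ.≤ m → c m ≤ δ
    c≤δ m M≤m = ℚP.<⇒≤ (subst (_< δ) (ℚP.0≤p⇒∣p∣≡p (c-nonneg m)) (c<δ m M≤m))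
    M≤n : ∀ n → K ℕ.+ M ℕ.≤ n → M ℕ.≤ n
    M≤n n K+M≤n = ℕP.≤-trans (ℕP.m≤n+m M K) K+M≤n
    K≤n∸M : ∀ n → K ℕ.+ M ℕ.≤ n → K ℕ.≤ n ∸ M
    K≤n∸M n K+M≤n = subst (ℕ._≤ n ∸ M) (ℕP.m+n∸n≡m K M) (ℕP.∸-monoˡ-≤ M K+M≤n)

smoothed-euler→0 : Null (λ N → smoothed N - euler N)
smoothed-euler→0 = Null-cong (λ N → sym (trans (cong (_- euler N) (smoothed≡euler-R N)) (solve 2 (λ e r → e :- r :- e := :- r) refl (euler N) (R N))))
  (null-neg (null-nonneg-dominated R-nonneg R≤V null-V))
  where
  R-nonneg : ∀ N → 0ℚ ≤ R N
  R-nonneg N = ∑-nonneg N (λ j _ → *-nonneg (½^-nonneg j) (proj₁ (0≤tail-T[2+2j]≤c j (N ∸ j))))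
  R≤V : ∀ N → R N ≤ V N
  R≤V N = ∑-mono-≤ N (λ j _ → *-monoˡ-≤-nonneg (½^-nonneg j) (proj₂ (0≤tail-T[2+2j]≤c j (N ∸ j))))

ρ : ℕ → ℕ → ℚ
ρ r = ∑ (λ n → Cℚ n r * ½^ (suc n))

τ : ℕ → ℕ → ℚ
τ r N = ½^ N * fromℕ (C≤ N r)

-- The two tails of the binomial distribution: P(fewer than r+1 heads in N tosses) = τ r N.
ρ+τ≡1 : ∀ r N → ρ r N + τ r N ≡ 1ℚ
ρ+τ≡1 r zero    = trans (ℚP.+-identityˡ _) (trans (ℚP.*-identityˡ _) (trans (cong fromℕ (C≤-0 r)) fromℕ-1))
ρ+τ≡1 r (suc N) = begin
  (ρ r N + Cℚ N r * (½^ N * ½)) + ½^ N * ½ * fromℕ (C≤ (suc N) r)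
    ≡⟨ solve 5 (λ p x h h2 a → (p :+ x :* (h :* h2)) :+ h :* h2 :* a := p :+ h :* h2 :* (x :+ a)) refl (ρ r N) (Cℚ N r) (½^ N) ½ (fromℕ (C≤ (suc N) r)) ⟩
  ρ r N + ½^ N * ½ * (Cℚ N r + fromℕ (C≤ (suc N) r))
    ≡⟨ cong (λ x → ρ r N + ½^ N * ½ * x) (trans (sym (fromℕ-+ _ _)) (trans (cong fromℕ (NCr+C≤[1+N]r≡2*C≤Nr N r)) (fromℕ-* 2 (C≤ N r)))) ⟩
  ρ r N + ½^ N * ½ * (fromℕ 2 * fromℕ (C≤ N r))
    ≡⟨ cong (λ x → ρ r N + x) (trans (solve 4 (λ h h2 t a → h :* h2 :* (t :* a) := h :* a :* (t :* h2)) refl (½^ N) ½ (fromℕ 2) (fromℕ (C≤ N r)))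
                                   (trans (cong (½^ N * fromℕ (C≤ N r) *_) fromℕ-2*½) (ℚP.*-identityʳ _))) ⟩
  ρ r N + τ r N
    ≡⟨ ρ+τ≡1 r N ⟩
  1ℚ ∎
  where open ≡-Reasoning

τ-nonneg : ∀ r N → 0ℚ ≤ τ r N
τ-nonneg r N = *-nonneg (½^-nonneg N) (0≤fromℕ _)

τ≤1 : ∀ r N → τ r N ≤ 1ℚ
τ≤1 r N = subst (τ r N ≤_) (trans (ℚP.+-comm (τ r N) (ρ r N)) (ρ+τ≡1 r N))
  (subst (_≤ τ r N + ρ r N) (ℚP.+-identityʳ (τ r N))
    (ℚP.+-monoʳ-≤ (τ r N) (∑-nonneg N (λ n _ → *-nonneg (0≤fromℕ _) (½^-nonneg (suc n))))))

τ≤3*2^r/[1+N] : ∀ r N → τ r N ≤ fromℕ (3 ℕ.* 2 ^ r) * 1/ℕ (suc N)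
τ≤3*2^r/[1+N] r N = begin
  τ r N
    ≡⟨ sym (trans (ℚP.*-assoc (τ r N) _ _) (trans (cong (τ r N *_) (fromℕ*1/ℕ-suc (suc (suc N)))) (ℚP.*-identityʳ _))) ⟩
  τ r N * fromℕ (3 ℕ.+ N) * 1/ℕ (3 ℕ.+ N)
    ≡⟨ cong (λ m → τ r N * fromℕ m * 1/ℕ (3 ℕ.+ N)) (ℕP.+-comm 3 N) ⟩
  ½^ N * fromℕ (C≤ N r) * fromℕ (N ℕ.+ 3) * 1/ℕ (3 ℕ.+ N)
    ≡⟨ cong (_* 1/ℕ (3 ℕ.+ N)) (trans (ℚP.*-assoc (½^ N) _ _) (cong (½^ N *_) (sym (fromℕ-* _ _)))) ⟩
  ½^ N * fromℕ (C≤ N r ℕ.* (N ℕ.+ 3)) * 1/ℕ (3 ℕ.+ N)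
    ≤⟨ *-monoʳ-≤-nonneg (0≤1/ℕ _) (*-monoˡ-≤-nonneg (½^-nonneg N) (fromℕ-mono-≤ (C≤*[N+3]≤3*2^r*2^N N r))) ⟩
  ½^ N * fromℕ (3 ℕ.* 2 ^ r ℕ.* 2 ^ N) * 1/ℕ (3 ℕ.+ N)
    ≡⟨ cong (λ x → ½^ N * x * 1/ℕ (3 ℕ.+ N)) (fromℕ-* _ _) ⟩
  ½^ N * (fromℕ (3 ℕ.* 2 ^ r) * 2^ℚ N) * 1/ℕ (3 ℕ.+ N)
    ≡⟨ cong (_* 1/ℕ (3 ℕ.+ N)) (trans (solve 3 (λ h a p → h :* (a :* p) := a :* (h :* p)) refl (½^ N) (fromℕ (3 ℕ.* 2 ^ r)) (2^ℚ N))
                                     (trans (cong (fromℕ (3 ℕ.* 2 ^ r) *_) (½^*2^ℚ≡1 N)) (ℚP.*-identityʳ (fromℕ (3 ℕ.* 2 ^ r))))) ⟩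
  fromℕ (3 ℕ.* 2 ^ r) * 1/ℕ (3 ℕ.+ N)
    ≤⟨ *-monoˡ-≤-nonneg (0≤fromℕ _) (1/ℕ-antitone (ℕP.≤-trans (ℕP.n≤1+n N) (ℕP.n≤1+n (suc N)))) ⟩
  fromℕ (3 ℕ.* 2 ^ r) * 1/ℕ (suc N) ∎
  where open ℚP.≤-Reasoning

∑w-extend : ∀ N n → n ℕ.< N → ∑ (λ k → w k n) (suc n) ≡ ∑ (λ k → w k n) N
∑w-extend N n n<N = sym (begin
  ∑ (λ k → w k n) N
    ≡⟨ cong (∑ (λ k → w k n)) (sym (ℕP.m+[n∸m]≡n n<N)) ⟩
  ∑ (λ k → w k n) (suc n ℕ.+ (N ∸ suc n))
    ≡⟨ ∑-+-split (λ k → w k n) (suc n) (N ∸ suc n) ⟩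
  ∑ (λ k → w k n) (suc n) + ∑ (λ i → w (suc n ℕ.+ i) n) (N ∸ suc n)
    ≡⟨ cong (λ x → ∑ (λ k → w k n) (suc n) + x) (trans (∑-cong w-vanishes (N ∸ suc n)) (∑-zero (N ∸ suc n))) ⟩
  ∑ (λ k → w k n) (suc n) + 0ℚ
    ≡⟨ ℚP.+-identityʳ _ ⟩
  ∑ (λ k → w k n) (suc n) ∎)
  where
  open ≡-Reasoning
  w-vanishes : ∀ i → w (suc n ℕ.+ i) n ≡ 0ℚ
  w-vanishes i = trans (cong (λ x → b (suc n ℕ.+ i) * x * ½^ (suc n)) (Cℚ-above n _ n<2[1+n+i]))
    (solve 2 (λ x y → x :* con 0ℚ :* y := con 0ℚ) refl (b (suc n ℕ.+ i)) (½^ (suc n)))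
    where
    n<2[1+n+i] : n ℕ.< 2 ℕ.* (suc n ℕ.+ i)
    n<2[1+n+i] = ℕP.<-≤-trans (ℕP.n<1+n n) (ℕP.≤-trans (ℕP.m≤m+n (suc n) i) (ℕP.m≤m+n (suc n ℕ.+ i) _))

∑b-smoothed≡∑b*τ : ∀ N → ∑ b N - smoothed N ≡ ∑ (λ k → b k * τ (2 ℕ.* k) N) N
∑b-smoothed≡∑b*τ N = begin
  ∑ b N - smoothed N
    ≡⟨ cong (λ x → ∑ b N - x) smoothed≡∑b*ρ ⟩
  ∑ b N - ∑ (λ k → b k * ρ (2 ℕ.* k) N) N
    ≡⟨ sym (∑-sub b (λ k → b k * ρ (2 ℕ.* k) N) N) ⟩
  ∑ (λ k → b k - b k * ρ (2 ℕ.* k) N) N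
    ≡⟨ ∑-cong (λ k → 1-ρ≡τ (b k) (ρ+τ≡1 (2 ℕ.* k) N)) N ⟩
  ∑ (λ k → b k * τ (2 ℕ.* k) N) N ∎
  where
  open ≡-Reasoning
  smoothed≡∑b*ρ : smoothed N ≡ ∑ (λ k → b k * ρ (2 ℕ.* k) N) N
  smoothed≡∑b*ρ = begin
    ∑ (λ n → ∑ (λ k → w k n) (suc n)) N    ≡⟨ ∑-cong-< N (∑w-extend N) ⟩
    ∑ (λ n → ∑ (λ k → w k n) N) N          ≡⟨ ∑-comm w N N ⟩
    ∑ (λ k → ∑ (w k) N) N                  ≡⟨ ∑-cong (λ k → trans (∑-cong (λ n → ℚP.*-assoc (b k) (Cℚ n (2 ℕ.* k)) (½^ (suc n))) N)
                                                                  (∑-*ˡ (b k) (λ n → Cℚ n (2 ℕ.* k) * ½^ (suc n)) N)) N ⟩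
    ∑ (λ k → b k * ρ (2 ℕ.* k) N) N        ∎
  1-ρ≡τ : ∀ x {p q} → p + q ≡ 1ℚ → x - x * p ≡ x * q
  1-ρ≡τ x {p} {q} p+q≡1 = begin
    x - x * p              ≡⟨ solve 2 (λ x p → x :- x :* p := x :* con 1ℚ :- x :* p) refl x p ⟩
    x * 1ℚ - x * p         ≡⟨ cong (λ y → x * y - x * p) (sym p+q≡1) ⟩
    x * (p + q) - x * p    ≡⟨ solve 3 (λ x p q → x :* (p :+ q) :- x :* p := x :* q) refl x p q ⟩
    x * q                  ∎

-- Split at K: the first K weights τ (2k) N are O(4^K / N), the remaining terms are at most 2 c K.
∑b-smoothed≤ : ∀ K N → K ℕ.≤ N → ∑ b N - smoothed N ≤ fromℕ 2 * (fromℕ (3 ℕ.* 2 ^ (2 ℕ.* K)) * 1/ℕ (suc N)) + fromℕ 2 * c K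
∑b-smoothed≤ K N K≤N = begin
  ∑ b N - smoothed N                              ≡⟨ ∑b-smoothed≡∑b*τ N ⟩
  ∑ f N                                           ≡⟨ cong (∑ f) (sym (ℕP.m+[n∸m]≡n K≤N)) ⟩
  ∑ f (K ℕ.+ (N ∸ K))                             ≡⟨ ∑-+-split f K (N ∸ K) ⟩
  ∑ f K + ∑ (λ i → f (K ℕ.+ i)) (N ∸ K)           ≤⟨ ℚP.+-mono-≤ head tail ⟩
  fromℕ 2 * bound + fromℕ 2 * c K                 ∎
  where
  open ℚP.≤-Reasoning
  f : ℕ → ℚ
  f k = b k * τ (2 ℕ.* k) N
  bound = fromℕ (3 ℕ.* 2 ^ (2 ℕ.* K)) * 1/ℕ (suc N)
  head : ∑ f K ≤ fromℕ 2 * bound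
  head = begin
    ∑ f K             ≤⟨ ∑-mono-≤ K (λ k k<K → *-monoˡ-≤-nonneg (b-nonneg k) (ℚP.≤-trans (τ≤3*2^r/[1+N] (2 ℕ.* k) N)
                            (*-monoʳ-≤-nonneg (0≤1/ℕ _) (fromℕ-mono-≤ (ℕP.*-monoʳ-≤ 3 (ℕP.^-monoʳ-≤ 2 (ℕP.*-monoʳ-≤ 2 (ℕP.<⇒≤ k<K)))))))) ⟩
    ∑ (λ k → b k * bound) K ≡⟨ trans (∑-cong (λ k → ℚP.*-comm (b k) bound) K) (∑-*ˡ bound b K) ⟩
    bound * ∑ b K     ≤⟨ *-monoˡ-≤-nonneg (*-nonneg (0≤fromℕ _) (0≤1/ℕ _)) (∑b≤2 K) ⟩
    bound * fromℕ 2   ≡⟨ ℚP.*-comm bound (fromℕ 2) ⟩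
    fromℕ 2 * bound   ∎
  tail : ∑ (λ i → f (K ℕ.+ i)) (N ∸ K) ≤ fromℕ 2 * c K
  tail = ℚP.≤-trans (∑-mono-≤ (N ∸ K) (λ i _ → p*q≤p (b-nonneg (K ℕ.+ i)) (τ≤1 (2 ℕ.* (K ℕ.+ i)) N))) (∑b-tail≤2c K (N ∸ K))

∑b-smoothed→0 : Null (λ N → ∑ b N - smoothed N)
∑b-smoothed→0 ε 0<ε = split (c-null δ 0<δ)
  where
  δ = ε/4 ε
  0<δ = 0<ε/4 0<ε
  0≤∑b-smoothed : ∀ N → 0ℚ ≤ ∑ b N - smoothed N
  0≤∑b-smoothed N = subst (0ℚ ≤_) (sym (∑b-smoothed≡∑b*τ N)) (∑-nonneg N (λ k _ → *-nonneg (b-nonneg k) (τ-nonneg (2 ℕ.* k) N)))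
  split : (∃ λ K → ∀ n → K ℕ.≤ n → ∣ c n ∣ < δ) → ∃ λ N → ∀ n → N ℕ.≤ n → ∣ ∑ b n - smoothed n ∣ < ε
  split (K , c<δ) = K ⊔ N₁ , λ n K⊔N₁≤n → begin-strict
    ∣ ∑ b n - smoothed n ∣                 ≡⟨ ℚP.0≤p⇒∣p∣≡p (0≤∑b-smoothed n) ⟩
    ∑ b n - smoothed n                     ≤⟨ ∑b-smoothed≤ K n (ℕP.≤-trans (ℕP.m≤m⊔n K N₁) K⊔N₁≤n) ⟩
    fromℕ 2 * bound n + fromℕ 2 * c K      <⟨ ℚP.+-mono-≤-< (ℚP.<⇒≤ (head<2δ n (ℕP.≤-trans (ℕP.m≤n⊔m K N₁) K⊔N₁≤n)))
                                                (ℚP.*-monoʳ-<-pos (fromℕ 2) {{ℚ.positive 0<2}} (subst (_< δ) (ℚP.0≤p⇒∣p∣≡p (c-nonneg K)) (c<δ K ℕP.≤-refl))) ⟩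
    fromℕ 2 * δ + fromℕ 2 * δ              ≡⟨ 2*ε/4+2*ε/4≡ε ε ⟩
    ε                                      ∎
    where
    open ℚP.≤-Reasoning
    bound : ℕ → ℚ
    bound n = fromℕ (3 ℕ.* 2 ^ (2 ℕ.* K)) * 1/ℕ (suc n)
    head→0 : Null (λ n → fromℕ 2 * bound n)
    head→0 = null-*ˡ (fromℕ 2) (null-*ˡ (fromℕ (3 ℕ.* 2 ^ (2 ℕ.* K))) null-1/ℕ-suc)
    0<2δ : 0ℚ < fromℕ 2 * δ
    0<2δ = subst (_< fromℕ 2 * δ) (ℚP.*-zeroʳ (fromℕ 2)) (ℚP.*-monoʳ-<-pos (fromℕ 2) {{ℚ.positive 0<2}} 0<δ)
    N₁ = proj₁ (head→0 (fromℕ 2 * δ) 0<2δ)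
    head<2δ : ∀ n → N₁ ℕ.≤ n → fromℕ 2 * bound n < fromℕ 2 * δ
    head<2δ n N₁≤n = ℚP.≤-<-trans (p≤∣p∣ _) (proj₂ (head→0 (fromℕ 2 * δ) 0<2δ) n N₁≤n)

T1-2leibniz→0 : Null (λ N → T 1 N - fromℕ 2 * leibniz N)
T1-2leibniz→0 = Null-cong (λ N → trans (chain N) (cong (_- fromℕ 2 * leibniz N) (∑b≡T1 N)))
  (null-+ ∑b-smoothed→0 (null-+ smoothed-euler→0 euler-2leibniz→0))
  where
  chain : ∀ N → (∑ b N - smoothed N) + ((smoothed N - euler N) + (euler N - fromℕ 2 * leibniz N)) ≡ ∑ b N - fromℕ 2 * leibniz N
  chain N = solve 4 (λ b s e l → (b :- s) :+ ((s :- e) :+ (e :- l)) := b :- l) refl (∑ b N) (smoothed N) (euler N) (fromℕ 2 * leibniz N)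
  ∑b≡T1 : ∀ N → ∑ b N ≡ T 1 N
  ∑b≡T1 = ∑-cong (λ k → cong (λ m → c k * 1/ℕ m) (ℕP.+-comm 1 (2 ℕ.* k)))

-- The terms and right-hand sides in closed form

÷≡fromℤ*1/ℤ : ∀ n d → n ÷ d ≡ fromℤ n * 1/ℤ d
÷≡fromℤ*1/ℤ n (+ zero)  = sym (trans (cong (fromℤ n *_) 1/ℕ-0) (ℚP.*-zeroʳ (fromℤ n)))
÷≡fromℤ*1/ℤ n (+ suc d) = /≡fromℤ*1/ℕ n d
÷≡fromℤ*1/ℤ n -[1+ d ]  = trans (/≡fromℤ*1/ℕ (ℤ.- n) d) (trans (cong (_* 1/ℕ (suc d)) (fromℤ-neg n))
  (solve 2 (λ x y → (:- x) :* y := x :* (:- y)) refl (fromℤ n) (1/ℕ (suc d))))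

fromℤ-sgn : ∀ ν → fromℤ (sgn ν) ≡ sgnℚ ν
fromℤ-sgn zero    = trans (sym (fromℕ≡fromℤ 1)) fromℕ-1
fromℤ-sgn (suc ν) = trans (fromℤ-neg (sgn ν)) (cong -_ (fromℤ-sgn ν))

sgn*n÷d≡sgnℚ*n/d : ∀ ν n d → (sgn ν ℤ.* + n) ÷ (+ d) ≡ sgnℚ ν * (fromℕ n * 1/ℕ d)
sgn*n÷d≡sgnℚ*n/d ν n d = begin
  (sgn ν ℤ.* + n) ÷ (+ d)                   ≡⟨ ÷≡fromℤ*1/ℤ (sgn ν ℤ.* + n) (+ d) ⟩
  fromℤ (sgn ν ℤ.* + n) * 1/ℕ d             ≡⟨ cong (_* 1/ℕ d) (trans (fromℤ-* (sgn ν) (+ n)) (cong₂ _*_ (fromℤ-sgn ν) (sym (fromℕ≡fromℤ n)))) ⟩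
  sgnℚ ν * fromℕ n * 1/ℕ d                  ≡⟨ ℚP.*-assoc (sgnℚ ν) (fromℕ n) (1/ℕ d) ⟩
  sgnℚ ν * (fromℕ n * 1/ℕ d)                ∎
  where open ≡-Reasoning

0<n! : ∀ n → 0 ℕ.< n !
0<n! n = ℕ.>-nonZero⁻¹ (n !) {{ℕP._!≢0 n}}

0<* : ∀ {x y} → 0 ℕ.< x → 0 ℕ.< y → 0 ℕ.< x ℕ.* y
0<* {suc _} {suc _} _ _ = s≤s z≤n

sgn-fraction-step : ∀ ν n d n′ d′ s → 0 ℕ.< d → 0 ℕ.< d′ → s ℕ.* n ℕ.* d′ ≡ n′ ℕ.* d →
                    fromℕ s * (- sgnℚ ν * (fromℕ n * 1/ℕ d)) ≡ - (sgnℚ ν * (fromℕ n′ * 1/ℕ d′))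
sgn-fraction-step ν n d n′ d′ s 0<d 0<d′ eq = begin
  fromℕ s * (- sgnℚ ν * (fromℕ n * 1/ℕ d))          ≡⟨ solve 4 (λ s g n i → s :* (:- g :* (n :* i)) := :- (g :* ((s :* n) :* i)))
                                                         refl (fromℕ s) (sgnℚ ν) (fromℕ n) (1/ℕ d) ⟩
  - (sgnℚ ν * (fromℕ s * fromℕ n * 1/ℕ d))          ≡⟨ cong (λ x → - (sgnℚ ν * (x * 1/ℕ d))) (sym (fromℕ-* s n)) ⟩
  - (sgnℚ ν * (fromℕ (s ℕ.* n) * 1/ℕ d))            ≡⟨ cong (λ x → - (sgnℚ ν * x)) (fraction-cong (s ℕ.* n) d n′ d′ 0<d 0<d′ eq) ⟩
  - (sgnℚ ν * (fromℕ n′ * 1/ℕ d′))                  ∎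
  where open ≡-Reasoning

rhs₁-num : ℕ → ℕ → ℕ
rhs₁-num ν m = 2 ^ (2 ℕ.* m ℕ.+ ν ∸ 1) ℕ.* (m ∸ 1) ! ℕ.* (m ℕ.+ ν) !

rhs₁-den : ℕ → ℕ → ℕ
rhs₁-den ν m = (2 ℕ.* m ℕ.+ 2 ℕ.* ν) !

rhs₁≡ : ∀ ν m → rhs₁ ν m ≡ sgnℚ ν * (fromℕ (rhs₁-num ν m) * 1/ℕ (rhs₁-den ν m))
rhs₁≡ ν m = sgn*n÷d≡sgnℚ*n/d ν (rhs₁-num ν m) (rhs₁-den ν m)

rhs₁-recurrence : ∀ m′ ν → fromℕ (suc (suc (2 ℕ.* m′)) ℕ.+ suc (2 ℕ.* ν)) * rhs₁ (suc ν) (suc m′) ≡ - rhs₁ ν (suc m′)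
rhs₁-recurrence m′ ν = begin
  fromℕ s * rhs₁ (suc ν) (suc m′)
    ≡⟨ cong (fromℕ s *_) (rhs₁≡ (suc ν) (suc m′)) ⟩
  fromℕ s * (- sgnℚ ν * (fromℕ (rhs₁-num (suc ν) (suc m′)) * 1/ℕ (rhs₁-den (suc ν) (suc m′))))
    ≡⟨ sgn-fraction-step ν _ _ _ _ s (0<n! (2 ℕ.* suc m′ ℕ.+ 2 ℕ.* suc ν)) (0<n! (2 ℕ.* suc m′ ℕ.+ 2 ℕ.* ν)) factorials ⟩
  - (sgnℚ ν * (fromℕ (rhs₁-num ν (suc m′)) * 1/ℕ (rhs₁-den ν (suc m′))))
    ≡⟨ cong -_ (sym (rhs₁≡ ν (suc m′))) ⟩
  - rhs₁ ν (suc m′) ∎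
  where
  open ≡-Reasoning
  s = suc (suc (2 ℕ.* m′)) ℕ.+ suc (2 ℕ.* ν)
  A = 2 ℕ.* suc m′ ℕ.+ 2 ℕ.* ν
  p = 2 ^ suc (2 ℕ.* m′ ℕ.+ ν)
  exp₀ : 2 ℕ.* suc m′ ℕ.+ ν ∸ 1 ≡ suc (2 ℕ.* m′ ℕ.+ ν)
  exp₀ = cong (λ x → x ℕ.+ ν ∸ 1) (2*[1+n]≡2+2*n m′)
  exp₁ : 2 ℕ.* suc m′ ℕ.+ suc ν ∸ 1 ≡ suc (suc (2 ℕ.* m′ ℕ.+ ν))
  exp₁ = trans (cong (λ x → x ℕ.+ suc ν ∸ 1) (2*[1+n]≡2+2*n m′)) (cong suc (ℕP.+-suc (2 ℕ.* m′) ν))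
  fact₁ : (suc m′ ℕ.+ suc ν) ! ≡ suc (suc m′ ℕ.+ ν) ℕ.* (suc m′ ℕ.+ ν) !
  fact₁ = cong _! (ℕP.+-suc (suc m′) ν)
  den₁ : rhs₁-den (suc ν) (suc m′) ≡ suc (suc A) ℕ.* (suc A ℕ.* A !)
  den₁ = cong _! (trans (cong (2 ℕ.* suc m′ ℕ.+_) (2*[1+n]≡2+2*n ν))
    (trans (ℕP.+-suc (2 ℕ.* suc m′) _) (cong suc (ℕP.+-suc (2 ℕ.* suc m′) _))))
  algebra : ∀ m ν p f₁ f₂ x → (suc (suc (2 ℕ.* m)) ℕ.+ suc (2 ℕ.* ν)) ℕ.* ((2 ℕ.* p) ℕ.* f₁ ℕ.* (suc (suc m ℕ.+ ν) ℕ.* f₂)) ℕ.* x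
                             ≡ (p ℕ.* f₁ ℕ.* f₂) ℕ.* (suc (suc (2 ℕ.* suc m ℕ.+ 2 ℕ.* ν)) ℕ.* (suc (2 ℕ.* suc m ℕ.+ 2 ℕ.* ν) ℕ.* x))
  algebra = solve-∀
  factorials : s ℕ.* rhs₁-num (suc ν) (suc m′) ℕ.* rhs₁-den ν (suc m′) ≡ rhs₁-num ν (suc m′) ℕ.* rhs₁-den (suc ν) (suc m′)
  factorials = begin
    s ℕ.* (2 ^ (2 ℕ.* suc m′ ℕ.+ suc ν ∸ 1) ℕ.* m′ ! ℕ.* (suc m′ ℕ.+ suc ν) !) ℕ.* A !
      ≡⟨ cong₂ (λ u v → s ℕ.* (2 ^ u ℕ.* m′ ! ℕ.* v) ℕ.* A !) exp₁ fact₁ ⟩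
    s ℕ.* ((2 ℕ.* p) ℕ.* m′ ! ℕ.* (suc (suc m′ ℕ.+ ν) ℕ.* (suc m′ ℕ.+ ν) !)) ℕ.* A !
      ≡⟨ algebra m′ ν p (m′ !) ((suc m′ ℕ.+ ν) !) (A !) ⟩
    (p ℕ.* m′ ! ℕ.* (suc m′ ℕ.+ ν) !) ℕ.* (suc (suc A) ℕ.* (suc A ℕ.* A !))
      ≡⟨ cong₂ (λ u v → (2 ^ u ℕ.* m′ ! ℕ.* (suc m′ ℕ.+ ν) !) ℕ.* v) (sym exp₀) (sym den₁) ⟩
    rhs₁-num ν (suc m′) ℕ.* rhs₁-den (suc ν) (suc m′) ∎

rhs₁-0-suc : ∀ j → rhs₁ 0 (suc (suc j)) * fromℕ (suc (suc (suc (2 ℕ.* j)))) ≡ rhs₁ 0 (suc j) * fromℕ (suc (suc (2 ℕ.* j)))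
rhs₁-0-suc j = begin
  rhs₁ 0 (suc (suc j)) * fromℕ t₃
    ≡⟨ cong (_* fromℕ t₃) (trans (rhs₁≡ 0 (suc (suc j))) (ℚP.*-identityˡ (fromℕ n₁ * 1/ℕ d₁))) ⟩
  fromℕ n₁ * 1/ℕ d₁ * fromℕ t₃
    ≡⟨ trans (solve 3 (λ a b c → a :* b :* c := (a :* c) :* b) refl (fromℕ n₁) (1/ℕ d₁) (fromℕ t₃)) (cong (_* 1/ℕ d₁) (sym (fromℕ-* n₁ t₃))) ⟩
  fromℕ (n₁ ℕ.* t₃) * 1/ℕ d₁
    ≡⟨ fraction-cong (n₁ ℕ.* t₃) d₁ (n₀ ℕ.* t₂) d₀ (0<n! (2 ℕ.* suc (suc j) ℕ.+ 2 ℕ.* 0)) (0<n! (2 ℕ.* suc j ℕ.+ 2 ℕ.* 0)) factorials ⟩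
  fromℕ (n₀ ℕ.* t₂) * 1/ℕ d₀
    ≡⟨ trans (cong (_* 1/ℕ d₀) (fromℕ-* n₀ t₂)) (solve 3 (λ a b c → a :* c :* b := a :* b :* c) refl (fromℕ n₀) (1/ℕ d₀) (fromℕ t₂)) ⟩
  fromℕ n₀ * 1/ℕ d₀ * fromℕ t₂
    ≡⟨ cong (_* fromℕ t₂) (sym (trans (rhs₁≡ 0 (suc j)) (ℚP.*-identityˡ (fromℕ n₀ * 1/ℕ d₀)))) ⟩
  rhs₁ 0 (suc j) * fromℕ t₂ ∎
  where
  open ≡-Reasoning
  t₃ = suc (suc (suc (2 ℕ.* j)))
  t₂ = suc (suc (2 ℕ.* j))
  n₁ = rhs₁-num 0 (suc (suc j))
  n₀ = rhs₁-num 0 (suc j)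
  d₁ = rhs₁-den 0 (suc (suc j))
  d₀ = rhs₁-den 0 (suc j)
  p = 2 ^ suc (2 ℕ.* j)
  num₀ : n₀ ≡ p ℕ.* j ! ℕ.* (suc j ℕ.* j !)
  num₀ = cong₂ (λ u v → 2 ^ u ℕ.* j ! ℕ.* v) (trans (cong (λ x → x ℕ.+ 0 ∸ 1) (2*[1+n]≡2+2*n j)) (cong suc (ℕP.+-identityʳ _)))
    (cong _! (ℕP.+-identityʳ (suc j)))
  num₁ : n₁ ≡ 2 ℕ.* (2 ℕ.* p) ℕ.* (suc j ℕ.* j !) ℕ.* (suc (suc j) ℕ.* (suc j ℕ.* j !))
  num₁ = cong₂ (λ u v → 2 ^ u ℕ.* (suc j) ! ℕ.* v)
    (trans (cong (λ x → x ℕ.+ 0 ∸ 1) (trans (2*[1+n]≡2+2*n (suc j)) (cong (λ x → suc (suc x)) (2*[1+n]≡2+2*n j))))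
           (cong (λ x → suc (suc (suc x))) (ℕP.+-identityʳ _)))
    (cong _! (ℕP.+-identityʳ (suc (suc j))))
  den₀ : d₀ ≡ t₂ ℕ.* (suc (2 ℕ.* j) ℕ.* (2 ℕ.* j) !)
  den₀ = cong _! (trans (ℕP.+-identityʳ _) (2*[1+n]≡2+2*n j))
  den₁ : d₁ ≡ suc (suc (suc (suc (2 ℕ.* j)))) ℕ.* (t₃ ℕ.* (t₂ ℕ.* (suc (2 ℕ.* j) ℕ.* (2 ℕ.* j) !)))
  den₁ = cong _! (trans (ℕP.+-identityʳ _) (trans (2*[1+n]≡2+2*n (suc j)) (cong (λ x → suc (suc x)) (2*[1+n]≡2+2*n j))))
  algebra : ∀ j p f x → 2 ℕ.* (2 ℕ.* p) ℕ.* (suc j ℕ.* f) ℕ.* (suc (suc j) ℕ.* (suc j ℕ.* f)) ℕ.* suc (suc (suc (2 ℕ.* j)))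
                          ℕ.* (suc (suc (2 ℕ.* j)) ℕ.* (suc (2 ℕ.* j) ℕ.* x))
                      ≡ p ℕ.* f ℕ.* (suc j ℕ.* f) ℕ.* suc (suc (2 ℕ.* j))
                          ℕ.* (suc (suc (suc (suc (2 ℕ.* j)))) ℕ.* (suc (suc (suc (2 ℕ.* j))) ℕ.* (suc (suc (2 ℕ.* j)) ℕ.* (suc (2 ℕ.* j) ℕ.* x))))
  algebra = solve-∀
  factorials : n₁ ℕ.* t₃ ℕ.* d₀ ≡ n₀ ℕ.* t₂ ℕ.* d₁
  factorials = trans (cong₂ (λ u v → u ℕ.* t₃ ℕ.* v) num₁ den₀)
    (trans (algebra j p (j !) ((2 ℕ.* j) !)) (sym (cong₂ (λ u v → u ℕ.* t₂ ℕ.* v) num₀ den₁)))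

rhs₁-0≡α : ∀ j → rhs₁ 0 (suc j) ≡ α j
rhs₁-0≡α zero    = sym α-0
rhs₁-0≡α (suc j) = *-cancelʳ-fromℕ-suc (suc (suc (2 ℕ.* j)))
  (trans (rhs₁-0-suc j) (trans (cong (_* fromℕ (suc (suc (2 ℕ.* j)))) (rhs₁-0≡α j)) (sym (α-suc j))))

coef₂-num : ℕ → ℕ
coef₂-num m = (2 ℕ.* m) !

coef₂-den : ℕ → ℕ → ℕ
coef₂-den ν m = 2 ^ (2 ℕ.* m ℕ.+ ν ℕ.+ 1) ℕ.* (m ℕ.+ ν) ! ℕ.* m !

0<coef₂-den : ∀ ν m → 0 ℕ.< coef₂-den ν m
0<coef₂-den ν m = 0<* (0<* (ℕP.m^n>0 2 (2 ℕ.* m ℕ.+ ν ℕ.+ 1)) (0<n! (m ℕ.+ ν))) (0<n! m)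

coef₂≡ : ∀ ν m → coef₂ ν m ≡ sgnℚ ν * (fromℕ (coef₂-num m) * 1/ℕ (coef₂-den ν m))
coef₂≡ ν m = sgn*n÷d≡sgnℚ*n/d ν (coef₂-num m) (coef₂-den ν m)

2*coef₂-recurrence : ∀ m ν → fromℕ (suc (2 ℕ.* m) ℕ.+ suc (2 ℕ.* ν)) * (fromℕ 2 * coef₂ (suc ν) m) ≡ - (fromℕ 2 * coef₂ ν m)
2*coef₂-recurrence m ν = begin
  fromℕ s * (fromℕ 2 * coef₂ (suc ν) m)                ≡⟨ solve 3 (λ s t x → s :* (t :* x) := t :* (s :* x)) refl (fromℕ s) (fromℕ 2) _ ⟩
  fromℕ 2 * (fromℕ s * coef₂ (suc ν) m)                ≡⟨ cong (λ x → fromℕ 2 * (fromℕ s * x)) (coef₂≡ (suc ν) m) ⟩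
  fromℕ 2 * (fromℕ s * (- sgnℚ ν * (fromℕ (coef₂-num m) * 1/ℕ (coef₂-den (suc ν) m))))
                                                       ≡⟨ cong (fromℕ 2 *_) (sgn-fraction-step ν _ _ _ _ s (0<coef₂-den (suc ν) m) (0<coef₂-den ν m) factorials) ⟩
  fromℕ 2 * - (sgnℚ ν * (fromℕ (coef₂-num m) * 1/ℕ (coef₂-den ν m)))
                                                       ≡⟨ cong (λ x → fromℕ 2 * - x) (sym (coef₂≡ ν m)) ⟩
  fromℕ 2 * - coef₂ ν m                                ≡⟨ sym (ℚP.neg-distribʳ-* (fromℕ 2) (coef₂ ν m)) ⟩
  - (fromℕ 2 * coef₂ ν m)                              ∎
  where
  open ≡-Reasoning
  s = suc (2 ℕ.* m) ℕ.+ suc (2 ℕ.* ν)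
  p = 2 ^ (2 ℕ.* m ℕ.+ ν ℕ.+ 1)
  exp : 2 ℕ.* m ℕ.+ suc ν ℕ.+ 1 ≡ suc (2 ℕ.* m ℕ.+ ν ℕ.+ 1)
  exp = cong (ℕ._+ 1) (ℕP.+-suc (2 ℕ.* m) ν)
  algebra : ∀ m ν y p f g → (suc (2 ℕ.* m) ℕ.+ suc (2 ℕ.* ν)) ℕ.* y ℕ.* (p ℕ.* f ℕ.* g)
                            ≡ y ℕ.* (2 ℕ.* p ℕ.* (suc (m ℕ.+ ν) ℕ.* f) ℕ.* g)
  algebra = solve-∀
  factorials : s ℕ.* coef₂-num m ℕ.* coef₂-den ν m ≡ coef₂-num m ℕ.* coef₂-den (suc ν) m
  factorials = trans (algebra m ν (coef₂-num m) p ((m ℕ.+ ν) !) (m !))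
    (cong₂ (λ u v → coef₂-num m ℕ.* (2 ^ u ℕ.* v ℕ.* m !)) (sym exp) (cong _! (sym (ℕP.+-suc m ν))))

coef₂-0-suc : ∀ m → coef₂ 0 (suc m) * fromℕ (suc (suc (2 ℕ.* m))) ≡ coef₂ 0 m * fromℕ (suc (2 ℕ.* m))
coef₂-0-suc m = begin
  coef₂ 0 (suc m) * fromℕ t₂
    ≡⟨ cong (_* fromℕ t₂) (trans (coef₂≡ 0 (suc m)) (ℚP.*-identityˡ (fromℕ (coef₂-num (suc m)) * 1/ℕ (coef₂-den 0 (suc m))))) ⟩
  fromℕ (coef₂-num (suc m)) * 1/ℕ (coef₂-den 0 (suc m)) * fromℕ t₂
    ≡⟨ trans (solve 3 (λ a b c → a :* b :* c := (a :* c) :* b) refl (fromℕ (coef₂-num (suc m))) (1/ℕ (coef₂-den 0 (suc m))) (fromℕ t₂))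
             (cong (_* 1/ℕ (coef₂-den 0 (suc m))) (sym (fromℕ-* (coef₂-num (suc m)) t₂))) ⟩
  fromℕ (coef₂-num (suc m) ℕ.* t₂) * 1/ℕ (coef₂-den 0 (suc m))
    ≡⟨ fraction-cong (coef₂-num (suc m) ℕ.* t₂) (coef₂-den 0 (suc m)) (coef₂-num m ℕ.* t₁) (coef₂-den 0 m)
         (0<coef₂-den 0 (suc m)) (0<coef₂-den 0 m) factorials ⟩
  fromℕ (coef₂-num m ℕ.* t₁) * 1/ℕ (coef₂-den 0 m)
    ≡⟨ trans (cong (_* 1/ℕ (coef₂-den 0 m)) (fromℕ-* (coef₂-num m) t₁))
             (solve 3 (λ a b c → a :* c :* b := a :* b :* c) refl (fromℕ (coef₂-num m)) (1/ℕ (coef₂-den 0 m)) (fromℕ t₁)) ⟩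
  fromℕ (coef₂-num m) * 1/ℕ (coef₂-den 0 m) * fromℕ t₁
    ≡⟨ cong (_* fromℕ t₁) (sym (trans (coef₂≡ 0 m) (ℚP.*-identityˡ (fromℕ (coef₂-num m) * 1/ℕ (coef₂-den 0 m))))) ⟩
  coef₂ 0 m * fromℕ t₁ ∎
  where
  open ≡-Reasoning
  t₂ = suc (suc (2 ℕ.* m))
  t₁ = suc (2 ℕ.* m)
  p = 2 ^ suc (2 ℕ.* m)
  num₁ : coef₂-num (suc m) ≡ t₂ ℕ.* (t₁ ℕ.* (2 ℕ.* m) !)
  num₁ = cong _! (2*[1+n]≡2+2*n m)
  den₀ : coef₂-den 0 m ≡ p ℕ.* m ! ℕ.* m !
  den₀ = cong₂ (λ u v → 2 ^ u ℕ.* v ℕ.* m !) (trans (cong (ℕ._+ 1) (ℕP.+-identityʳ (2 ℕ.* m))) (ℕP.+-comm (2 ℕ.* m) 1))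
    (cong _! (ℕP.+-identityʳ m))
  den₁ : coef₂-den 0 (suc m) ≡ 2 ℕ.* (2 ℕ.* p) ℕ.* (suc m ℕ.* m !) ℕ.* (suc m ℕ.* m !)
  den₁ = cong₂ (λ u v → 2 ^ u ℕ.* v ℕ.* (suc m) !)
    (trans (cong (ℕ._+ 1) (trans (ℕP.+-identityʳ _) (2*[1+n]≡2+2*n m))) (cong (λ x → suc (suc x)) (ℕP.+-comm _ 1)))
    (cong _! (ℕP.+-identityʳ (suc m)))
  algebra : ∀ m x p f → (suc (suc (2 ℕ.* m)) ℕ.* (suc (2 ℕ.* m) ℕ.* x) ℕ.* suc (suc (2 ℕ.* m))) ℕ.* (p ℕ.* f ℕ.* f)
                        ≡ (x ℕ.* suc (2 ℕ.* m)) ℕ.* (2 ℕ.* (2 ℕ.* p) ℕ.* (suc m ℕ.* f) ℕ.* (suc m ℕ.* f))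
  algebra = solve-∀
  factorials : coef₂-num (suc m) ℕ.* t₂ ℕ.* coef₂-den 0 m ≡ coef₂-num m ℕ.* t₁ ℕ.* coef₂-den 0 (suc m)
  factorials = trans (cong₂ (λ u v → u ℕ.* t₂ ℕ.* v) num₁ den₀)
    (trans (algebra m ((2 ℕ.* m) !) p (m !)) (cong (coef₂-num m ℕ.* t₁ ℕ.*_) (sym den₁)))

2*coef₂-0≡c : ∀ m → fromℕ 2 * coef₂ 0 m ≡ c m
2*coef₂-0≡c zero = trans (cong (fromℕ 2 *_) (trans (coef₂≡ 0 0) (trans (ℚP.*-identityˡ _)
  (trans (cong (_* 1/ℕ 2) fromℕ-1) (ℚP.*-identityˡ _))))) (fromℕ*1/ℕ-suc 1)
2*coef₂-0≡c (suc m) = *-cancelʳ-fromℕ-suc (suc (2 ℕ.* m)) (begin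
  fromℕ 2 * coef₂ 0 (suc m) * fromℕ (suc (suc (2 ℕ.* m)))    ≡⟨ trans (ℚP.*-assoc (fromℕ 2) _ _) (cong (fromℕ 2 *_) (coef₂-0-suc m)) ⟩
  fromℕ 2 * (coef₂ 0 m * fromℕ (suc (2 ℕ.* m)))              ≡⟨ sym (ℚP.*-assoc (fromℕ 2) _ _) ⟩
  fromℕ 2 * coef₂ 0 m * fromℕ (suc (2 ℕ.* m))                ≡⟨ cong (_* fromℕ (suc (2 ℕ.* m))) (2*coef₂-0≡c m) ⟩
  c m * fromℕ (suc (2 ℕ.* m))                                ≡⟨ sym (c-suc m) ⟩
  c (suc m) * fromℕ (suc (suc (2 ℕ.* m)))                    ∎)
  where open ≡-Reasoning

[1+2k]C[k]≡[1+2k]C[1+k] : ∀ k → suc (2 ℕ.* k) C k ≡ suc (2 ℕ.* k) C suc k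
[1+2k]C[k]≡[1+2k]C[1+k] k = begin
  suc (2 ℕ.* k) C k                       ≡⟨ nCk≡nC[n∸k] (ℕP.≤-trans (ℕP.m≤m+n k (k ℕ.+ 0)) (ℕP.n≤1+n _)) ⟩
  suc (2 ℕ.* k) C (suc (2 ℕ.* k) ∸ k)     ≡⟨ cong (suc (2 ℕ.* k) C_) (trans (cong (λ x → suc (k ℕ.+ x) ∸ k) (ℕP.+-identityʳ k)) (ℕP.m+n∸n≡m (suc k) k)) ⟩
  suc (2 ℕ.* k) C suc k                   ∎
  where open ≡-Reasoning

[1+k]*C[2+2k,1+k]≡2[1+2k]*C[2k,k] : ∀ k → suc k ℕ.* (2 ℕ.* suc k C suc k) ≡ 2 ℕ.* suc (2 ℕ.* k) ℕ.* (2 ℕ.* k C k)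
[1+k]*C[2+2k,1+k]≡2[1+2k]*C[2k,k] k = ℕP.*-cancelˡ-≡ _ _ (suc k) (begin
  suc k ℕ.* (suc k ℕ.* (2 ℕ.* suc k C suc k))
    ≡⟨ cong (λ n → suc k ℕ.* (suc k ℕ.* (n C suc k))) (2*[1+n]≡2+2*n k) ⟩
  suc k ℕ.* (suc k ℕ.* (suc (suc (2 ℕ.* k)) C suc k))
    ≡⟨ cong (suc k ℕ.*_) ([1+k]*[1+n]C[1+k]≡[1+n]*nCk (suc (2 ℕ.* k)) k) ⟩
  suc k ℕ.* (suc (suc (2 ℕ.* k)) ℕ.* (suc (2 ℕ.* k) C k))
    ≡⟨ cong (λ x → suc k ℕ.* (suc (suc (2 ℕ.* k)) ℕ.* x)) ([1+2k]C[k]≡[1+2k]C[1+k] k) ⟩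
  suc k ℕ.* (suc (suc (2 ℕ.* k)) ℕ.* (suc (2 ℕ.* k) C suc k))
    ≡⟨ regroup₁ k (suc (suc (2 ℕ.* k))) (suc (2 ℕ.* k) C suc k) ⟩
  suc (suc (2 ℕ.* k)) ℕ.* (suc k ℕ.* (suc (2 ℕ.* k) C suc k))
    ≡⟨ cong (suc (suc (2 ℕ.* k)) ℕ.*_) ([1+k]*[1+n]C[1+k]≡[1+n]*nCk (2 ℕ.* k) k) ⟩
  suc (suc (2 ℕ.* k)) ℕ.* (suc (2 ℕ.* k) ℕ.* (2 ℕ.* k C k))
    ≡⟨ regroup₂ k (2 ℕ.* k C k) ⟩
  suc k ℕ.* (2 ℕ.* suc (2 ℕ.* k) ℕ.* (2 ℕ.* k C k)) ∎)
  where
  open ≡-Reasoning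
  regroup₁ : ∀ k a x → suc k ℕ.* (a ℕ.* x) ≡ a ℕ.* (suc k ℕ.* x)
  regroup₁ = solve-∀
  regroup₂ : ∀ k x → suc (suc (2 ℕ.* k)) ℕ.* (suc (2 ℕ.* k) ℕ.* x) ≡ suc k ℕ.* (2 ℕ.* suc (2 ℕ.* k) ℕ.* x)
  regroup₂ = solve-∀

c*4^k≡C[2k,k] : ∀ k → c k * fromℕ (4 ^ k) ≡ fromℕ (2 ℕ.* k C k)
c*4^k≡C[2k,k] zero    = trans (ℚP.*-identityˡ _) refl
c*4^k≡C[2k,k] (suc k) = begin
  c k * (fromℕ 1+2k * 1/ℕ 2+2k) * fromℕ (4 ℕ.* 4 ^ k)
    ≡⟨ cong (c k * (fromℕ 1+2k * 1/ℕ 2+2k) *_) (fromℕ-* 4 (4 ^ k)) ⟩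
  c k * (fromℕ 1+2k * 1/ℕ 2+2k) * (fromℕ 4 * fromℕ (4 ^ k))
    ≡⟨ solve 5 (λ c a i f p → c :* (a :* i) :* (f :* p) := f :* a :* (c :* p) :* i) refl (c k) (fromℕ 1+2k) (1/ℕ 2+2k) (fromℕ 4) (fromℕ (4 ^ k)) ⟩
  fromℕ 4 * fromℕ 1+2k * (c k * fromℕ (4 ^ k)) * 1/ℕ 2+2k
    ≡⟨ cong (λ x → fromℕ 4 * fromℕ 1+2k * x * 1/ℕ 2+2k) (c*4^k≡C[2k,k] k) ⟩
  fromℕ 4 * fromℕ 1+2k * fromℕ (2 ℕ.* k C k) * 1/ℕ 2+2k
    ≡⟨ cong (_* 1/ℕ 2+2k) (trans (cong (_* fromℕ (2 ℕ.* k C k)) (sym (fromℕ-* 4 _))) (sym (fromℕ-* _ (2 ℕ.* k C k)))) ⟩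
  fromℕ (4 ℕ.* 1+2k ℕ.* (2 ℕ.* k C k)) * 1/ℕ 2+2k
    ≡⟨ fraction-cong _ _ _ 1 (s≤s z≤n) (s≤s z≤n) cross-multiplied ⟩
  fromℕ (2 ℕ.* suc k C suc k) * 1/ℕ 1
    ≡⟨ trans (cong (fromℕ (2 ℕ.* suc k C suc k) *_) 1/ℕ-1) (ℚP.*-identityʳ _) ⟩
  fromℕ (2 ℕ.* suc k C suc k) ∎
  where
  open ≡-Reasoning
  1+2k = suc (2 ℕ.* k)
  2+2k = suc 1+2k
  regroup₁ : ∀ a x → 4 ℕ.* a ℕ.* x ℕ.* 1 ≡ 2 ℕ.* (2 ℕ.* a ℕ.* x)
  regroup₁ = solve-∀
  regroup₂ : ∀ k x → 2 ℕ.* (suc k ℕ.* x) ≡ x ℕ.* (2 ℕ.+ 2 ℕ.* k)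
  regroup₂ = solve-∀
  cross-multiplied : 4 ℕ.* 1+2k ℕ.* (2 ℕ.* k C k) ℕ.* 1 ≡ (2 ℕ.* suc k C suc k) ℕ.* 2+2k
  cross-multiplied = begin
    4 ℕ.* 1+2k ℕ.* (2 ℕ.* k C k) ℕ.* 1         ≡⟨ regroup₁ 1+2k (2 ℕ.* k C k) ⟩
    2 ℕ.* (2 ℕ.* 1+2k ℕ.* (2 ℕ.* k C k))       ≡⟨ cong (2 ℕ.*_) (sym ([1+k]*C[2+2k,1+k]≡2[1+2k]*C[2k,k] k)) ⟩
    2 ℕ.* (suc k ℕ.* (2 ℕ.* suc k C suc k))    ≡⟨ regroup₂ k (2 ℕ.* suc k C suc k) ⟩
    (2 ℕ.* suc k C suc k) ℕ.* 2+2k             ∎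

1/ℤ[X*oddProd] : ∀ X ν k → 0 ℕ.< X → 1/ℤ (+ X ℤ.* oddProd ν k) ≡ 1/ℕ X * P⁻¹ ν k
1/ℤ[X*oddProd] X ν k 0<X = sym (inverse-unique {x = fromℤ (+ X ℤ.* oddProd ν k)}
  (trans (cong (_* (1/ℕ X * P⁻¹ ν k)) (trans (fromℤ-* (+ X) (oddProd ν k)) (cong (_* P ν k) (sym (fromℕ≡fromℤ X)))))
         (*-inverse {fromℕ X} {1/ℕ X} {P ν k} {P⁻¹ ν k} (fromℕ*1/ℕ X 0<X) (P*P⁻¹≡1 ν k)))
  (fromℤ*1/ℤ _ X*P≢0))
  where
  X*P≢0 : + X ℤ.* oddProd ν k ≢ + 0
  X*P≢0 eq with ℤP.i*j≡0⇒i≡0∨j≡0 (+ X) eq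
  ... | inj₁ X≡0 = ℕP.<⇒≢ 0<X (sym (ℤP.+-injective X≡0))
  ... | inj₂ P≡0 = oddProd≢0 ν k P≡0

C[2k,k]÷[4^k*Y*oddProd]≡ : ∀ ν k Y → 0 ℕ.< Y →
  (+ (2 ℕ.* k C k)) ÷ (+ (4 ^ k ℕ.* Y) ℤ.* oddProd ν k) ≡ c k * 1/ℕ Y * P⁻¹ ν k
C[2k,k]÷[4^k*Y*oddProd]≡ ν k Y 0<Y = begin
  (+ (2 ℕ.* k C k)) ÷ (+ (4 ^ k ℕ.* Y) ℤ.* oddProd ν k)
    ≡⟨ ÷≡fromℤ*1/ℤ (+ (2 ℕ.* k C k)) (+ (4 ^ k ℕ.* Y) ℤ.* oddProd ν k) ⟩
  fromℤ (+ (2 ℕ.* k C k)) * 1/ℤ (+ (4 ^ k ℕ.* Y) ℤ.* oddProd ν k)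
    ≡⟨ cong₂ _*_ (sym (fromℕ≡fromℤ _)) (1/ℤ[X*oddProd] _ ν k (0<* 0<4^k 0<Y)) ⟩
  fromℕ (2 ℕ.* k C k) * (1/ℕ (4 ^ k ℕ.* Y) * P⁻¹ ν k)
    ≡⟨ cong₂ (λ x y → x * (y * P⁻¹ ν k)) (sym (c*4^k≡C[2k,k] k)) (1/ℕ-* (4 ^ k) Y 0<4^k 0<Y) ⟩
  c k * fromℕ (4 ^ k) * (1/ℕ (4 ^ k) * 1/ℕ Y * P⁻¹ ν k)
    ≡⟨ solve 5 (λ c f i y p → c :* f :* (i :* y :* p) := c :* y :* p :* (f :* i)) refl (c k) (fromℕ (4 ^ k)) (1/ℕ (4 ^ k)) (1/ℕ Y) (P⁻¹ ν k) ⟩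
  c k * 1/ℕ Y * P⁻¹ ν k * (fromℕ (4 ^ k) * 1/ℕ (4 ^ k))
    ≡⟨ trans (cong (c k * 1/ℕ Y * P⁻¹ ν k *_) (fromℕ*1/ℕ (4 ^ k) 0<4^k)) (ℚP.*-identityʳ _) ⟩
  c k * 1/ℕ Y * P⁻¹ ν k ∎
  where
  open ≡-Reasoning
  0<4^k = ℕP.m^n>0 4 k

term₁≡t/P : ∀ ν m k → term₁ ν (suc m) k ≡ t/P ν (suc (suc (2 ℕ.* m))) k
term₁≡t/P ν m k = trans (C[2k,k]÷[4^k*Y*oddProd]≡ ν k (2 ℕ.* k ℕ.+ 2 ℕ.* suc m) (ℕP.<-≤-trans (s≤s z≤n) (ℕP.m≤n+m _ (2 ℕ.* k))))
  (cong (λ x → c k * 1/ℕ (2 ℕ.* k ℕ.+ x) * P⁻¹ ν k) (2*[1+n]≡2+2*n m))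

term₂≡t/P : ∀ ν m k → term₂ ν m k ≡ t/P ν (suc (2 ℕ.* m)) k
term₂≡t/P ν m k = trans (C[2k,k]÷[4^k*Y*oddProd]≡ ν k (2 ℕ.* k ℕ.+ 2 ℕ.* m ℕ.+ 1) (ℕP.<-≤-trans (s≤s z≤n) (ℕP.m≤n+m 1 _)))
  (cong (λ x → c k * 1/ℕ x * P⁻¹ ν k) (reorder k m))
  where
  reorder : ∀ k m → 2 ℕ.* k ℕ.+ 2 ℕ.* m ℕ.+ 1 ≡ 2 ℕ.* k ℕ.+ suc (2 ℕ.* m)
  reorder = solve-∀

∑leibnizTerm≡4*leibniz : ∀ n → ∑ leibnizTerm n ≡ fromℕ 4 * leibniz n
∑leibnizTerm≡4*leibniz n = trans (∑-cong leibnizTerm≡ n) (∑-*ˡ (fromℕ 4) _ n)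
  where
  leibnizTerm≡ : ∀ k → leibnizTerm k ≡ fromℕ 4 * (sgnℚ k * 1/ℕ (suc (2 ℕ.* k)))
  leibnizTerm≡ k = begin
    (+ 4 ℤ.* sgn k) ÷ (+ (2 ℕ.* k ℕ.+ 1))              ≡⟨ ÷≡fromℤ*1/ℤ (+ 4 ℤ.* sgn k) (+ (2 ℕ.* k ℕ.+ 1)) ⟩
    fromℤ (+ 4 ℤ.* sgn k) * 1/ℕ (2 ℕ.* k ℕ.+ 1)        ≡⟨ cong₂ _*_ (trans (fromℤ-* (+ 4) (sgn k)) (cong₂ _*_ (sym (fromℕ≡fromℤ 4)) (fromℤ-sgn k)))
                                                                    (cong 1/ℕ (ℕP.+-comm (2 ℕ.* k) 1)) ⟩
    fromℕ 4 * sgnℚ k * 1/ℕ (suc (2 ℕ.* k))             ≡⟨ ℚP.*-assoc (fromℕ 4) _ _ ⟩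
    fromℕ 4 * (sgnℚ k * 1/ℕ (suc (2 ℕ.* k)))           ∎
    where open ≡-Reasoning

first-series : ∀ ν m → m ≥ 1 → ConvergesTo (partialSum (term₁ ν m)) (rhs₁ ν m)
first-series ν (suc m) _ = Null-cong (λ n → cong (_- rhs₁ ν (suc m)) (sym (∑-cong (term₁≡t/P ν m) n)))
  (∑t/P-L→0 (suc (2 ℕ.* m)) (λ ν _ → rhs₁ ν (suc m)) base (λ ν _ → rhs₁-recurrence m ν) ν)
  where
  base : Null (λ n → T (suc (suc (2 ℕ.* m))) n - rhs₁ 0 (suc m))
  base = Null-cong (λ n → cong₂ (λ a l → T a n - l) (2*[1+n]≡2+2*n m) (sym (rhs₁-0≡α m))) (T[2+2j]→α m)

second-series : ∀ ν m → SameLimit (partialSum (term₂ ν m)) (cπPartial (coef₂ ν m))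
second-series ν m = Null-cong regroup (null-+ ∑t/P→2coef₂*T1 (null-*ˡ (fromℕ 2 * coef₂ ν m) T1-2leibniz→0))
  where
  L : ℕ → ℕ → ℚ
  L ν n = fromℕ 2 * coef₂ ν m * T 1 n
  base : Null (λ n → T (suc (2 ℕ.* m)) n - L 0 n)
  base = Null-cong (λ n → cong (λ x → T (suc (2 ℕ.* m)) n - x * T 1 n) (sym (2*coef₂-0≡c m))) (T[1+2m]-c*T1→0 m)
  L-suc : ∀ ν n → fromℕ (suc (2 ℕ.* m) ℕ.+ suc (2 ℕ.* ν)) * L (suc ν) n ≡ - L ν n
  L-suc ν n = trans (sym (ℚP.*-assoc (fromℕ (suc (2 ℕ.* m) ℕ.+ suc (2 ℕ.* ν))) (fromℕ 2 * coef₂ (suc ν) m) (T 1 n)))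
    (trans (cong (_* T 1 n) (2*coef₂-recurrence m ν)) (sym (ℚP.neg-distribˡ-* (fromℕ 2 * coef₂ ν m) (T 1 n))))
  ∑t/P→2coef₂*T1 : Null (λ n → ∑ (t/P ν (suc (2 ℕ.* m))) n - L ν n)
  ∑t/P→2coef₂*T1 = ∑t/P-L→0 (2 ℕ.* m) L base L-suc ν
  regroup : ∀ n → (∑ (t/P ν (suc (2 ℕ.* m))) n - L ν n) + fromℕ 2 * coef₂ ν m * (T 1 n - fromℕ 2 * leibniz n)
                ≡ partialSum (term₂ ν m) n - coef₂ ν m * partialSum leibnizTerm n
  regroup n = begin
    (∑ (t/P ν (suc (2 ℕ.* m))) n - L ν n) + fromℕ 2 * coef₂ ν m * (T 1 n - fromℕ 2 * leibniz n)
      ≡⟨ solve 5 (λ s t c x l → (s :- t :* c :* x) :+ t :* c :* (x :- t :* l) := s :- c :* ((t :* t) :* l))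
           refl (∑ (t/P ν (suc (2 ℕ.* m))) n) (fromℕ 2) (coef₂ ν m) (T 1 n) (leibniz n) ⟩
    ∑ (t/P ν (suc (2 ℕ.* m))) n - coef₂ ν m * ((fromℕ 2 * fromℕ 2) * leibniz n)
      ≡⟨ cong₂ (λ x y → x - coef₂ ν m * (y * leibniz n)) (sym (∑-cong (term₂≡t/P ν m) n)) (sym (fromℕ-* 2 2)) ⟩
    partialSum (term₂ ν m) n - coef₂ ν m * (fromℕ 4 * leibniz n)
      ≡⟨ cong (λ x → partialSum (term₂ ν m) n - coef₂ ν m * x) (sym (∑leibnizTerm≡4*leibniz n)) ⟩
    partialSum (term₂ ν m) n - coef₂ ν m * partialSum leibnizTerm n ∎
    where open ≡-Reasoning

corollary6p4 : (∀ (ν m : ℕ) → m ≥ 1 → ConvergesTo (partialSum (term₁ ν m)) (rhs₁ ν m))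
               × (∀ (ν m : ℕ) → SameLimit (partialSum (term₂ ν m)) (cπPartial (coef₂ ν m)))
corollary6p4 = first-series , second-series
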